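{- For all integers $a,b\ge 0$, $$H(a,b)=2\sum_{k=1}^{a+b+1}(-1)^k\, c_{a,b}^{k}\,\zeta(2k+1)\,H(a+b+1-k),$$ where $$c_{a,b}^{k}=\binom{2k}{2a+2}-\left(1-\frac{1}{2^{2k}}\right)\binom{2k}{2b+1}.$$
   Context: For positive integers $k_1,\dots,k_r$ with $k_r>1$, the multiple zeta value is $$\zeta(k_1,\dots,k_r)=\sum_{1\le n_1<n_2<\cdots<n_r}\frac{1}{n_1^{k_1}n_2^{k_2}\cdots n_r^{k_r}}$$ (sum over integers), so that in depth $1$ it is the Riemann zeta value. For integers $n,a,b\ge 0$ put $$H(n)=\zeta(\underbrace{2,\dots,2}_{n}),\qquad H(a,b)=\zeta(\underbrace{2,\dots,2}_{a},3,\underbrace{2,\dots,2}_{b}),$$ with $H(0)=1$. Binomial coefficients $\binom{m}{j}$ with $j>m\ge 0$ are $0$. -}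

module Defs where

open import Data.Nat.Base as ℕ using (ℕ; zero; suc; pred; NonZero; s≤s; z≤n)
open import Data.Nat.Combinatorics using (_C_)
import Data.Nat.Properties as ℕₚ
open import Data.Integer.Base as ℤ using (+_; -1ℤ)
import Data.Integer.Properties as ℤₚ
open import Data.List.Base using (List; []; _∷_; _∷ʳ_; _++_; replicate; reverse)
open import Data.List.Properties using (unfold-reverse)
open import Data.List.Relation.Unary.All as All using (All; []; _∷_)
import Data.List.Relation.Unary.All.Properties as Allₚ
open import Data.Product.Base using (∃-syntax; _×_; _,_)
open import Data.Rational.Base hiding (NonZero)
open import Data.Rational.Properties
open import Data.Rational.Solver using (module +-*-Solver)
import Data.Rational.Unnormalised.Base as ℚᵘ
import Data.Rational.Unnormalised.Properties as ℚᵘₚ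
open import Data.Sum.Base using (inj₁; inj₂)
open import Relation.Binary.PropositionalEquality

open +-*-Solver using (solve; _:=_; _:+_; _:*_; _:-_; :-_; con)

infixl 6 _+ℝ_
infixl 7 _*ℝ_
infix  4 _≈ℝ_

recast-≤ : ∀ {p q r s} → p ≤ q → p ≡ r → q ≡ s → r ≤ s
recast-≤ p≤q refl refl = p≤q

recast-< : ∀ {p q r} → p ≡ q → p < r → q < r
recast-< refl p<r = p<r

*-monoˡ : ∀ {p q} r → 0ℚ ≤ r → p ≤ q → r * p ≤ r * q
*-monoˡ r 0≤r = *-monoˡ-≤-nonNeg r {{nonNegative 0≤r}}

*-monoʳ : ∀ {p q} r → 0ℚ ≤ r → p ≤ q → p * r ≤ q * r
*-monoʳ r 0≤r = *-monoʳ-≤-nonNeg r {{nonNegative 0≤r}}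

0≤* : ∀ {p q} → 0ℚ ≤ p → 0ℚ ≤ q → 0ℚ ≤ p * q
0≤* {p} 0≤p 0≤q = recast-≤ (*-monoˡ p 0≤p 0≤q) (*-zeroʳ p) refl

0≤+ : ∀ {p q} → 0ℚ ≤ p → 0ℚ ≤ q → 0ℚ ≤ p + q
0≤+ 0≤p 0≤q = +-mono-≤ 0≤p 0≤q

0<½ : 0ℚ < ½
0<½ = positive⁻¹ ½

0<* : ∀ {p q} → 0ℚ < p → 0ℚ < q → 0ℚ < p * q
0<* {p} {q} 0<p 0<q =
  subst (_< p * q) (*-zeroʳ p) (*-monoʳ-<-pos p {{positive 0<p}} 0<q)

half+half : ∀ ε → ½ * ε + ½ * ε ≡ ε
half+half = solve 1 (λ e → con ½ :* e :+ con ½ :* e := e) refl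

+-cauchy-split : ∀ a b c d → (a + b) - (c + d) ≡ (a - c) + (b - d)
+-cauchy-split = solve 4 (λ a b c d → (a :+ b) :- (c :+ d) := (a :- c) :+ (b :- d)) refl

*-cauchy-split : ∀ a b c d → a * b - c * d ≡ a * (b - d) + d * (a - c)
*-cauchy-split = solve 4 (λ a b c d → a :* b :- c :* d := a :* (b :- d) :+ d :* (a :- c)) refl

shrink : ∀ {ε B} → 0ℚ < ε → 0ℚ < B → ∃[ δ ] 0ℚ < δ × B * δ ≡ ε
shrink {ε} {B} 0<ε 0<B = ε * 1/ B , 0<* 0<ε 0<1/B , eq
  where
  instance
    B-pos = positive 0<B
    B-nz = pos⇒nonZero B
  0<1/B : 0ℚ < 1/ B
  0<1/B = positive⁻¹ (1/ B) {{1/pos⇒pos B}}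
  eq : B * (ε * 1/ B) ≡ ε
  eq = trans (solve 3 (λ b e r → b :* (e :* r) := e :* (b :* r)) refl B ε (1/ B))
             (trans (cong (ε *_) (*-inverseʳ B)) (*-identityʳ ε))

∣p-q∣≡∣q-p∣ : ∀ p q → ∣ p - q ∣ ≡ ∣ q - p ∣
∣p-q∣≡∣q-p∣ p q =
  trans (sym (∣-p∣≡∣p∣ (p - q)))
        (cong ∣_∣ (solve 2 (λ a b → :- (a :- b) := b :- a) refl p q))

-- Real numbers are Cauchy sequences of rationals, considered up to _≈ℝ_.

IsCauchy : (ℕ → ℚ) → Set
IsCauchy x = ∀ ε → 0ℚ < ε →
  ∃[ N ] (∀ m n → N ℕ.≤ m → N ℕ.≤ n → ∣ x m - x n ∣ < ε)

record ℝ : Set where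
  constructor mkℝ
  field
    seq    : ℕ → ℚ
    cauchy : IsCauchy seq

open ℝ public

_≈ℝ_ : ℝ → ℝ → Set
x ≈ℝ y = ∀ ε → 0ℚ < ε →
  ∃[ N ] (∀ n → N ℕ.≤ n → ∣ seq x n - seq y n ∣ < ε)

fromℚ : ℚ → ℝ
fromℚ q = mkℝ (λ _ → q) λ ε 0<ε →
  0 , λ _ _ _ _ → subst (λ p → ∣ p ∣ < ε) (sym (+-inverseʳ q)) 0<ε

+-cauchy : ∀ {x y} → IsCauchy x → IsCauchy y → IsCauchy (λ n → x n + y n)
+-cauchy {x} {y} cx cy ε 0<ε
  with cx (½ * ε) (0<* 0<½ 0<ε) | cy (½ * ε) (0<* 0<½ 0<ε)
... | M , x-close | N , y-close = M ℕ.⊔ N , λ m n K≤m K≤n → begin-strict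
  ∣ x m + y m - (x n + y n) ∣
    ≡⟨ cong ∣_∣ (+-cauchy-split (x m) (y m) (x n) (y n)) ⟩
  ∣ (x m - x n) + (y m - y n) ∣
    ≤⟨ ∣p+q∣≤∣p∣+∣q∣ (x m - x n) (y m - y n) ⟩
  ∣ x m - x n ∣ + ∣ y m - y n ∣
    <⟨ +-mono-< (x-close m n (ℕₚ.m⊔n≤o⇒m≤o M N K≤m) (ℕₚ.m⊔n≤o⇒m≤o M N K≤n))
                (y-close m n (ℕₚ.m⊔n≤o⇒n≤o M N K≤m) (ℕₚ.m⊔n≤o⇒n≤o M N K≤n)) ⟩
  ½ * ε + ½ * ε
    ≡⟨ half+half ε ⟩
  ε ∎
  where open ≤-Reasoning

eventuallyBounded : ∀ {x} → IsCauchy x →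
  ∃[ N ] ∃[ B ] 0ℚ < B × (∀ n → N ℕ.≤ n → ∣ x n ∣ ≤ B)
eventuallyBounded {x} cx with cx 1ℚ (positive⁻¹ 1ℚ)
... | N , close = N , 1ℚ + ∣ x N ∣
                , +-mono-<-≤ (positive⁻¹ 1ℚ) (0≤∣p∣ (x N))
                , λ n N≤n → begin
  ∣ x n ∣                ≡⟨ cong ∣_∣ (solve 2 (λ a b → a := (a :- b) :+ b) refl (x n) (x N)) ⟩
  ∣ (x n - x N) + x N ∣  ≤⟨ ∣p+q∣≤∣p∣+∣q∣ (x n - x N) (x N) ⟩
  ∣ x n - x N ∣ + ∣ x N ∣ ≤⟨ +-monoˡ-≤ ∣ x N ∣ (<⇒≤ (close n N N≤n ℕₚ.≤-refl)) ⟩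
  1ℚ + ∣ x N ∣           ∎
  where open ≤-Reasoning

product-close : ∀ {a b c d B D δ η ε} → 0ℚ < B → 0ℚ < D →
  B * δ ≡ ½ * ε → D * η ≡ ½ * ε → ∣ a ∣ ≤ B → ∣ d ∣ ≤ D →
  ∣ b - d ∣ < δ → ∣ a - c ∣ < η → ∣ a * b - c * d ∣ < ε
product-close {a} {b} {c} {d} {B} {D} {δ} {η} {ε} 0<B 0<D Bδ≡ε/2 Dη≡ε/2 ∣a∣≤B ∣d∣≤D b-close a-close =
  begin-strict
  ∣ a * b - c * d ∣
    ≡⟨ cong ∣_∣ (*-cauchy-split a b c d) ⟩
  ∣ a * (b - d) + d * (a - c) ∣
    ≤⟨ ∣p+q∣≤∣p∣+∣q∣ (a * (b - d)) (d * (a - c)) ⟩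
  ∣ a * (b - d) ∣ + ∣ d * (a - c) ∣
    ≡⟨ cong₂ _+_ (∣p*q∣≡∣p∣*∣q∣ a (b - d)) (∣p*q∣≡∣p∣*∣q∣ d (a - c)) ⟩
  ∣ a ∣ * ∣ b - d ∣ + ∣ d ∣ * ∣ a - c ∣
    ≤⟨ +-mono-≤ (*-monoʳ ∣ b - d ∣ (0≤∣p∣ (b - d)) ∣a∣≤B)
                (*-monoʳ ∣ a - c ∣ (0≤∣p∣ (a - c)) ∣d∣≤D) ⟩
  B * ∣ b - d ∣ + D * ∣ a - c ∣
    <⟨ +-mono-< (*-monoʳ-<-pos B {{positive 0<B}} b-close)
                (*-monoʳ-<-pos D {{positive 0<D}} a-close) ⟩
  B * δ + D * η
    ≡⟨ cong₂ _+_ Bδ≡ε/2 Dη≡ε/2 ⟩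
  ½ * ε + ½ * ε
    ≡⟨ half+half ε ⟩
  ε ∎
  where open ≤-Reasoning

*-cauchy : ∀ {x y} → IsCauchy x → IsCauchy y → IsCauchy (λ n → x n * y n)
*-cauchy {x} {y} cx cy ε 0<ε =
  let K , B , 0<B , ∣x∣≤B = eventuallyBounded cx
      L , D , 0<D , ∣y∣≤D = eventuallyBounded cy
      δ , 0<δ , Bδ≡ε/2 = shrink (0<* 0<½ 0<ε) 0<B
      η , 0<η , Dη≡ε/2 = shrink (0<* 0<½ 0<ε) 0<D
      M , y-close = cy δ 0<δ
      N , x-close = cx η 0<η
  in (K ℕ.⊔ L) ℕ.⊔ (M ℕ.⊔ N) , λ m n T≤m T≤n →
    let KL≤m = ℕₚ.m⊔n≤o⇒m≤o (K ℕ.⊔ L) (M ℕ.⊔ N) T≤m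
        KL≤n = ℕₚ.m⊔n≤o⇒m≤o (K ℕ.⊔ L) (M ℕ.⊔ N) T≤n
        MN≤m = ℕₚ.m⊔n≤o⇒n≤o (K ℕ.⊔ L) (M ℕ.⊔ N) T≤m
        MN≤n = ℕₚ.m⊔n≤o⇒n≤o (K ℕ.⊔ L) (M ℕ.⊔ N) T≤n
    in product-close {x m} {y m} {x n} {y n} 0<B 0<D Bδ≡ε/2 Dη≡ε/2
         (∣x∣≤B m (ℕₚ.m⊔n≤o⇒m≤o K L KL≤m)) (∣y∣≤D n (ℕₚ.m⊔n≤o⇒n≤o K L KL≤n))
         (y-close m n (ℕₚ.m⊔n≤o⇒m≤o M N MN≤m) (ℕₚ.m⊔n≤o⇒m≤o M N MN≤n))
         (x-close m n (ℕₚ.m⊔n≤o⇒n≤o M N MN≤m) (ℕₚ.m⊔n≤o⇒n≤o M N MN≤n))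

_+ℝ_ : ℝ → ℝ → ℝ
x +ℝ y = mkℝ (λ n → seq x n + seq y n) (+-cauchy {seq x} {seq y} (cauchy x) (cauchy y))

_*ℝ_ : ℝ → ℝ → ℝ
x *ℝ y = mkℝ (λ n → seq x n * seq y n) (*-cauchy {seq x} {seq y} (cauchy x) (cauchy y))

-- Both sums range over 1 ≤ k ≤ N; the instance argument makes k ≥ 1
-- available in the summand.

∑ℚ : ℕ → ((k : ℕ) → .{{NonZero k}} → ℚ) → ℚ
∑ℚ zero    f = 0ℚ
∑ℚ (suc N) f = ∑ℚ N f + f (suc N)

∑ℝ : ℕ → ((k : ℕ) → .{{NonZero k}} → ℝ) → ℝ
∑ℝ zero    f = fromℚ 0ℚ
∑ℝ (suc N) f = ∑ℝ N f +ℝ f (suc N)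

recipPow : (n : ℕ) .{{_ : NonZero n}} → ℕ → ℚ
recipPow n k = _/_ (+ 1) (n ℕ.^ k) {{ℕₚ.m^n≢0 n k}}

-- The exponents are listed from the last to the first:
--   nestedSum (kᵣ ∷ … ∷ k₁ ∷ []) N = ∑_{1 ≤ n₁ < … < nᵣ ≤ N} 1 / (n₁^k₁ ⋯ nᵣ^kᵣ),
-- the outermost summation variable being nᵣ.
nestedSum : List ℕ → ℕ → ℚ
nestedSum []       N = 1ℚ
nestedSum (k ∷ ks) N = ∑ℚ N λ n → recipPow n k * nestedSum ks (pred n)

-- Non-empty lists of positive integers whose last entry exceeds 1.
data Admissible : List ℕ → Set where
  last : ∀ {k} → 1 ℕ.< k → Admissible (k ∷ [])
  _∷_  : ∀ {k ks} → 1 ℕ.≤ k → Admissible ks → Admissible (k ∷ ks)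

reverse-admissible : ∀ {ks} → Admissible ks →
  ∃[ l ] ∃[ ls ] reverse ks ≡ l ∷ ls × 1 ℕ.< l × All (1 ℕ.≤_) ls
reverse-admissible (last {k} 1<k) = k , [] , refl , 1<k , []
reverse-admissible (_∷_ {k} {ks} 1≤k adm) with reverse-admissible adm
... | l , ls , eq , 1<l , 1≤ls =
  l , ls ∷ʳ k , trans (unfold-reverse k ks) (cong (_∷ʳ k) eq)
    , 1<l , Allₚ.∷ʳ⁺ 1≤ls 1≤k

ι : ℕ → ℚ
ι n = + n / 1

w : ℕ → ℚ
w n = + 1 / suc n

toℚᵘ-/ : ∀ n d → toℚᵘ (n / suc d) ℚᵘ.≃ ℚᵘ.mkℚᵘ n d
toℚᵘ-/ n d = toℚᵘ-fromℚᵘ (ℚᵘ.mkℚᵘ n d)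

recip-anti : ∀ d e .{{_ : NonZero d}} .{{_ : NonZero e}} →
             d ℕ.≤ e → + 1 / e ≤ + 1 / d
recip-anti (suc d) (suc e) d≤e = toℚᵘ-cancel-≤ (begin
  toℚᵘ (+ 1 / suc e) ≃⟨ toℚᵘ-/ (+ 1) e ⟩
  ℚᵘ.mkℚᵘ (+ 1) e    ≤⟨ ℚᵘ.*≤* (ℤₚ.*-monoˡ-≤-nonNeg (+ 1) (ℤ.+≤+ d≤e)) ⟩
  ℚᵘ.mkℚᵘ (+ 1) d    ≃⟨ toℚᵘ-/ (+ 1) d ⟨
  toℚᵘ (+ 1 / suc d) ∎)
  where open ℚᵘₚ.≤-Reasoning

recip-pos : ∀ d .{{_ : NonZero d}} → 0ℚ < + 1 / d
recip-pos d = positive⁻¹ (+ 1 / d) {{normalize-pos 1 d}}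

w-nonNeg : ∀ n → 0ℚ ≤ w n
w-nonNeg n = <⇒≤ (recip-pos (suc n))

ι-suc : ∀ n → ι (suc n) ≡ ι n + 1ℚ
ι-suc n = toℚᵘ-injective (begin
  toℚᵘ (ι (suc n))              ≈⟨ toℚᵘ-/ (+ suc n) 0 ⟩
  ℚᵘ.mkℚᵘ (+ suc n) 0           ≈⟨ ℚᵘ.*≡* (cong (ℤ._* + 1) numerators) ⟩
  ℚᵘ.mkℚᵘ (+ n) 0 ℚᵘ.+ ℚᵘ.1ℚᵘ   ≈⟨ ℚᵘₚ.+-congˡ ℚᵘ.1ℚᵘ (toℚᵘ-/ (+ n) 0) ⟨
  toℚᵘ (ι n) ℚᵘ.+ ℚᵘ.1ℚᵘ        ≈⟨ toℚᵘ-homo-+ (ι n) 1ℚ ⟨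
  toℚᵘ (ι n + 1ℚ)               ∎)
  where
  open ℚᵘₚ.≃-Reasoning
  numerators : + suc n ≡ + n ℤ.* + 1 ℤ.+ + 1 ℤ.* + 1
  numerators = trans (cong +_ (ℕₚ.+-comm 1 n))
                     (cong (ℤ._+ + 1) (sym (ℤₚ.*-identityʳ (+ n))))

ι-nonNeg : ∀ n → 0ℚ ≤ ι n
ι-nonNeg zero    = ≤-refl
ι-nonNeg (suc n) = recast-≤ (0≤+ (ι-nonNeg n) (<⇒≤ (positive⁻¹ 1ℚ))) refl (sym (ι-suc n))

ι-mono : ∀ {m n} → m ℕ.≤ n → ι m ≤ ι n
ι-mono {m} {n} m≤n = toℚᵘ-cancel-≤ (begin
  toℚᵘ (ι m)      ≃⟨ toℚᵘ-/ (+ m) 0 ⟩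
  ℚᵘ.mkℚᵘ (+ m) 0 ≤⟨ ℚᵘ.*≤* (ℤₚ.*-monoʳ-≤-nonNeg (+ 1) (ℤ.+≤+ m≤n)) ⟩
  ℚᵘ.mkℚᵘ (+ n) 0 ≃⟨ toℚᵘ-/ (+ n) 0 ⟨
  toℚᵘ (ι n)      ∎)
  where open ℚᵘₚ.≤-Reasoning

ι*w : ∀ n → ι (suc n) * w n ≡ 1ℚ
ι*w n = toℚᵘ-injective (begin
  toℚᵘ (ι (suc n) * w n)          ≈⟨ toℚᵘ-homo-* (ι (suc n)) (w n) ⟩
  toℚᵘ (ι (suc n)) ℚᵘ.* toℚᵘ (w n) ≈⟨ ℚᵘₚ.*-cong (toℚᵘ-/ (+ suc n) 0) (toℚᵘ-/ (+ 1) n) ⟩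
  ℚᵘ.mkℚᵘ (+ suc n) 0 ℚᵘ.* ℚᵘ.mkℚᵘ (+ 1) n ≈⟨ ℚᵘ.*≡* numerators ⟩
  ℚᵘ.1ℚᵘ                          ∎)
  where
  open ℚᵘₚ.≃-Reasoning
  numerators : + suc n ℤ.* + 1 ℤ.* + 1 ≡ + 1 ℤ.* (+ 1 ℤ.* + suc n)
  numerators = trans (ℤₚ.*-identityʳ (+ suc n ℤ.* + 1))
              (trans (ℤₚ.*-comm (+ suc n) (+ 1))
                     (sym (ℤₚ.*-identityˡ (+ 1 ℤ.* + suc n))))

recip-* : ∀ m n → + 1 / (suc m ℕ.* suc n) ≡ w m * w n
recip-* m n = toℚᵘ-injective (begin
  toℚᵘ (+ 1 / (suc m ℕ.* suc n))          ≈⟨ toℚᵘ-/ (+ 1) (n ℕ.+ m ℕ.* suc n) ⟩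
  ℚᵘ.mkℚᵘ (+ 1) m ℚᵘ.* ℚᵘ.mkℚᵘ (+ 1) n    ≈⟨ ℚᵘₚ.*-cong (toℚᵘ-/ (+ 1) m) (toℚᵘ-/ (+ 1) n) ⟨
  toℚᵘ (w m) ℚᵘ.* toℚᵘ (w n)              ≈⟨ toℚᵘ-homo-* (w m) (w n) ⟨
  toℚᵘ (w m * w n)                        ∎)
  where open ℚᵘₚ.≃-Reasoning

w-telescope : ∀ m → w (suc m) + w m * w (suc m) ≡ w m
w-telescope m = begin
  w (suc m) + w m * w (suc m)
    ≡⟨ solve 2 (λ a b → a :+ b :* a := (con 1ℚ :+ b) :* a) refl (w (suc m)) (w m) ⟩
  (1ℚ + w m) * w (suc m)
    ≡⟨ cong (λ z → (z + w m) * w (suc m)) (ι*w m) ⟨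
  (ι (suc m) * w m + w m) * w (suc m)
    ≡⟨ solve 3 (λ i a b → (i :* b :+ b) :* a := b :* ((i :+ con 1ℚ) :* a))
             refl (ι (suc m)) (w (suc m)) (w m) ⟩
  w m * ((ι (suc m) + 1ℚ) * w (suc m))
    ≡⟨ cong (λ z → w m * (z * w (suc m))) (ι-suc (suc m)) ⟨
  w m * (ι (suc (suc m)) * w (suc m))
    ≡⟨ cong (w m *_) (ι*w (suc m)) ⟩
  w m * 1ℚ
    ≡⟨ *-identityʳ (w m) ⟩
  w m ∎
  where open ≡-Reasoning

w-null : ∀ {ε} → 0ℚ < ε → ∃[ N ] (∀ n → N ℕ.≤ n → w n < ε)
w-null {mkℚ (+ suc p) d-1 _} _ = suc d-1 , λ n d≤n → toℚᵘ-cancel-< (begin-strict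
  toℚᵘ (w n)              ≃⟨ toℚᵘ-/ (+ 1) n ⟩
  ℚᵘ.mkℚᵘ (+ 1) n         <⟨ ℚᵘ.*<* (subst₂ ℤ._<_ (sym (ℤₚ.*-identityˡ (+ suc d-1)))
                                       (ℤₚ.pos-* (suc p) (suc n))
                                       (ℤ.+<+ (ℕₚ.<-≤-trans (s≤s d≤n) (ℕₚ.m≤m+n (suc n) (p ℕ.* suc n))))) ⟩
  ℚᵘ.mkℚᵘ (+ suc p) d-1   ∎)
  where open ℚᵘₚ.≤-Reasoning
w-null {mkℚ (+ zero)      _ _} (*<* (ℤ.+<+ ()))
w-null {mkℚ ℤ.-[1+ _ ]    _ _} (*<* ())

Sublinear : (ℕ → ℚ) → Set
Sublinear f = ∀ ε → 0ℚ < ε → ∃[ K ] 0ℚ < K × (∀ n → f n ≤ ε * ι n + K)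

ι*w≤1 : ∀ n → ι n * w n ≤ 1ℚ
ι*w≤1 n = recast-≤ (*-monoʳ (w n) (w-nonNeg n) (ι-mono (ℕₚ.n≤1+n n))) refl (ι*w n)

module _ {f g : ℕ → ℚ} (f0≤1 : f 0 ≤ 1ℚ) (f-step : ∀ n → f (suc n) ≤ f n + w n * g n)
  {ε K δ : ℚ} {N : ℕ} (0<ε : 0ℚ < ε) (0<K : 0ℚ < K) (g≤ : ∀ n → g n ≤ ½ * ε * ι n + K)
  (Kδ≡ε/2 : K * δ ≡ ½ * ε) (w<δ : ∀ n → N ℕ.≤ n → w n < δ) where

  open ≤-Reasoning

  private
    increment-split : ∀ F W E i c → F + W * (E * i + c) ≡ F + (E * (i * W) + c * W)
    increment-split =
      solve 5 (λ F W E i c → F :+ W :* (E :* i :+ c) := F :+ (E :* (i :* W) :+ c :* W)) refl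

    early-zero : ∀ e c → 1ℚ ≡ e * 0ℚ + (1ℚ + c * 0ℚ)
    early-zero = solve 2 (λ e c → con 1ℚ := e :* con 0ℚ :+ (con 1ℚ :+ c :* con 0ℚ)) refl

    early-suc : ∀ e i c → e * i + (1ℚ + c * i) + (e + c * 1ℚ) ≡ e * (i + 1ℚ) + (1ℚ + c * (i + 1ℚ))
    early-suc = solve 3 (λ e i c → e :* i :+ (con 1ℚ :+ c :* i) :+ (e :+ c :* con 1ℚ)
                               := e :* (i :+ con 1ℚ) :+ (con 1ℚ :+ c :* (i :+ con 1ℚ))) refl

    late-suc : ∀ e i b → e * i + b + e ≡ e * (i + 1ℚ) + b
    late-suc = solve 3 (λ e i b → e :* i :+ b :+ e := e :* (i :+ con 1ℚ) :+ b) refl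

  increment : ∀ n → f (suc n) ≤ f n + (½ * ε + K * w n)
  increment n = begin
    f (suc n)                          ≤⟨ f-step n ⟩
    f n + w n * g n                    ≤⟨ +-monoʳ-≤ (f n) (*-monoˡ (w n) (w-nonNeg n) (g≤ n)) ⟩
    f n + w n * (½ * ε * ι n + K)      ≡⟨ increment-split (f n) (w n) (½ * ε) (ι n) K ⟩
    f n + (½ * ε * (ι n * w n) + K * w n)
      ≤⟨ +-monoʳ-≤ (f n) (+-monoˡ-≤ (K * w n)
           (*-monoˡ (½ * ε) (<⇒≤ (0<* 0<½ 0<ε)) (ι*w≤1 n))) ⟩
    f n + (½ * ε * 1ℚ + K * w n)
      ≡⟨ cong (λ z → f n + (z + K * w n)) (*-identityʳ (½ * ε)) ⟩
    f n + (½ * ε + K * w n)            ∎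

  ε/2≤ε : ½ * ε ≤ ε
  ε/2≤ε = recast-≤ (+-monoʳ-≤ (½ * ε) (<⇒≤ (0<* 0<½ 0<ε))) (+-identityʳ (½ * ε)) (half+half ε)

  early : ∀ n → f n ≤ ε * ι n + (1ℚ + K * ι n)
  early zero = recast-≤ f0≤1 refl (early-zero ε K)
  early (suc n) = begin
    f (suc n)                ≤⟨ increment n ⟩
    f n + (½ * ε + K * w n)
      ≤⟨ +-mono-≤ (early n) (+-mono-≤ ε/2≤ε (*-monoˡ K (<⇒≤ 0<K) (recip-anti 1 (suc n) (s≤s z≤n)))) ⟩
    ε * ι n + (1ℚ + K * ι n) + (ε + K * 1ℚ)
      ≡⟨ early-suc ε (ι n) K ⟩
    ε * (ι n + 1ℚ) + (1ℚ + K * (ι n + 1ℚ))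
      ≡⟨ cong (λ z → ε * z + (1ℚ + K * z)) (ι-suc n) ⟨
    ε * ι (suc n) + (1ℚ + K * ι (suc n)) ∎

  bound : ∀ n → f n ≤ ε * ι n + (1ℚ + K * ι N)
  bound-late : ∀ n → N ℕ.≤ n → f n ≤ ε * ι n + (1ℚ + K * ι N) →
               f (suc n) ≤ ε * ι (suc n) + (1ℚ + K * ι N)
  bound-late n N≤n fn≤ = begin
    f (suc n)                ≤⟨ increment n ⟩
    f n + (½ * ε + K * w n)
      ≤⟨ +-mono-≤ fn≤ (+-monoʳ-≤ (½ * ε) (*-monoˡ K (<⇒≤ 0<K) (<⇒≤ (w<δ n N≤n)))) ⟩
    ε * ι n + (1ℚ + K * ι N) + (½ * ε + K * δ)
      ≡⟨ cong (λ z → ε * ι n + (1ℚ + K * ι N) + (½ * ε + z)) Kδ≡ε/2 ⟩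
    ε * ι n + (1ℚ + K * ι N) + (½ * ε + ½ * ε)
      ≡⟨ cong (λ z → ε * ι n + (1ℚ + K * ι N) + z) (half+half ε) ⟩
    ε * ι n + (1ℚ + K * ι N) + ε
      ≡⟨ late-suc ε (ι n) (1ℚ + K * ι N) ⟩
    ε * (ι n + 1ℚ) + (1ℚ + K * ι N)
      ≡⟨ cong (λ z → ε * z + (1ℚ + K * ι N)) (ι-suc n) ⟨
    ε * ι (suc n) + (1ℚ + K * ι N) ∎

  bound n with ℕₚ.≤-total n N
  bound n       | inj₁ n≤N = ≤-trans (early n)
    (+-monoʳ-≤ (ε * ι n) (+-monoʳ-≤ 1ℚ (*-monoˡ K (<⇒≤ 0<K) (ι-mono n≤N))))
  bound zero    | inj₂ z≤n = early zero
  bound (suc n) | inj₂ N≤1+n with ℕₚ.m≤n⇒m<n∨m≡n N≤1+n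
  ... | inj₂ refl      = early (suc n)
  ... | inj₁ (s≤s N≤n) = bound-late n N≤n (bound n)

sublinear-sum : ∀ {f g} → f 0 ≤ 1ℚ → (∀ n → f (suc n) ≤ f n + w n * g n) →
                Sublinear g → Sublinear f
sublinear-sum f0≤1 f-step g-sub ε 0<ε =
  let K , 0<K , g≤ = g-sub (½ * ε) (0<* 0<½ 0<ε)
      δ , 0<δ , Kδ≡ε/2 = shrink (0<* 0<½ 0<ε) 0<K
      N , w<δ = w-null 0<δ
  in 1ℚ + K * ι N
   , +-mono-<-≤ (positive⁻¹ 1ℚ) (0≤* (<⇒≤ 0<K) (ι-nonNeg N))
   , bound f0≤1 f-step 0<ε 0<K g≤ Kδ≡ε/2 w<δ

nestedSum-nonNeg : ∀ ks n → 0ℚ ≤ nestedSum ks n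
nestedSum-nonNeg []       n       = <⇒≤ (positive⁻¹ 1ℚ)
nestedSum-nonNeg (k ∷ ks) zero    = ≤-refl
nestedSum-nonNeg (k ∷ ks) (suc n) =
  0≤+ (nestedSum-nonNeg (k ∷ ks) n)
      (0≤* (<⇒≤ (recip-pos (suc n ℕ.^ k) {{ℕₚ.m^n≢0 (suc n) k}})) (nestedSum-nonNeg ks n))

recipPow≤w : ∀ n k → 1 ℕ.≤ k → recipPow (suc n) k ≤ w n
recipPow≤w n k 1≤k = recip-anti (suc n) (suc n ℕ.^ k) {{_}} {{ℕₚ.m^n≢0 (suc n) k}}
  (subst (ℕ._≤ suc n ℕ.^ k) (ℕₚ.^-identityʳ (suc n)) (ℕₚ.^-monoʳ-≤ (suc n) 1≤k))

recipPow≤w*w : ∀ m k → 1 ℕ.< k → recipPow (suc (suc m)) k ≤ w m * w (suc m)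
recipPow≤w*w m k 1<k = recast-≤
  (recip-anti (suc m ℕ.* suc (suc m)) (suc (suc m) ℕ.^ k) {{_}} {{ℕₚ.m^n≢0 (suc (suc m)) k}}
    (ℕₚ.≤-trans (ℕₚ.*-monoˡ-≤ (suc (suc m)) (ℕₚ.n≤1+n (suc m)))
                (subst (ℕ._≤ suc (suc m) ℕ.^ k)
                       (cong (suc (suc m) ℕ.*_) (ℕₚ.^-identityʳ (suc (suc m))))
                       (ℕₚ.^-monoʳ-≤ (suc (suc m)) 1<k))))
  refl (recip-* m (suc m))

suffixSum : List ℕ → ℕ → ℚ
suffixSum []       n = 1ℚ
suffixSum (k ∷ ks) n = nestedSum (k ∷ ks) n + suffixSum ks n

properSuffixSum : List ℕ → ℕ → ℚ
properSuffixSum []       n = 0ℚ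
properSuffixSum (k ∷ ks) n = suffixSum ks n

suffixSum-nonNeg : ∀ ks n → 0ℚ ≤ suffixSum ks n
suffixSum-nonNeg []       n = <⇒≤ (positive⁻¹ 1ℚ)
suffixSum-nonNeg (k ∷ ks) n = 0≤+ (nestedSum-nonNeg (k ∷ ks) n) (suffixSum-nonNeg ks n)

properSuffixSum-nonNeg : ∀ ks n → 0ℚ ≤ properSuffixSum ks n
properSuffixSum-nonNeg []       n = ≤-refl
properSuffixSum-nonNeg (k ∷ ks) n = suffixSum-nonNeg ks n

suffixSum-split : ∀ ks n → suffixSum ks n ≡ nestedSum ks n + properSuffixSum ks n
suffixSum-split []       n = refl
suffixSum-split (k ∷ ks) n = refl

suffixSum-step : ∀ {ks} → All (1 ℕ.≤_) ks → ∀ n →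
  suffixSum ks (suc n) ≤ suffixSum ks n + w n * properSuffixSum ks n
suffixSum-step [] n = ≤-reflexive
  (solve 1 (λ W → con 1ℚ := con 1ℚ :+ W :* con 0ℚ) refl (w n))
suffixSum-step (_∷_ {k} {ks} 1≤k 1≤ks) n = begin
  nestedSum (k ∷ ks) n + recipPow (suc n) k * nestedSum ks n + suffixSum ks (suc n)
    ≤⟨ +-mono-≤ (+-monoʳ-≤ (nestedSum (k ∷ ks) n)
                  (*-monoʳ (nestedSum ks n) (nestedSum-nonNeg ks n) (recipPow≤w n k 1≤k)))
                (suffixSum-step 1≤ks n) ⟩
  nestedSum (k ∷ ks) n + w n * nestedSum ks n
    + (suffixSum ks n + w n * properSuffixSum ks n)
    ≡⟨ solve 5 (λ P W Q S T → P :+ W :* Q :+ (S :+ W :* T) := P :+ S :+ W :* (Q :+ T))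
             refl (nestedSum (k ∷ ks) n) (w n) (nestedSum ks n)
                  (suffixSum ks n) (properSuffixSum ks n) ⟩
  nestedSum (k ∷ ks) n + suffixSum ks n
    + w n * (nestedSum ks n + properSuffixSum ks n)
    ≡⟨ cong (λ z → nestedSum (k ∷ ks) n + suffixSum ks n + w n * z) (suffixSum-split ks n) ⟨
  nestedSum (k ∷ ks) n + suffixSum ks n + w n * suffixSum ks n ∎
  where open ≤-Reasoning

suffixSum-zero : ∀ ks → suffixSum ks 0 ≤ 1ℚ
suffixSum-zero []       = ≤-refl
suffixSum-zero (k ∷ ks) = recast-≤ (suffixSum-zero ks) (sym (+-identityˡ (suffixSum ks 0))) refl

suffixSum-sublinear : ∀ {ks} → All (1 ℕ.≤_) ks → Sublinear (suffixSum ks)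
suffixSum-sublinear [] ε 0<ε = 1ℚ , positive⁻¹ 1ℚ , λ n →
  recast-≤ (+-monoˡ-≤ 1ℚ (0≤* (<⇒≤ 0<ε) (ι-nonNeg n))) (+-identityˡ 1ℚ) refl
suffixSum-sublinear {k ∷ ks} (1≤k ∷ 1≤ks) =
  sublinear-sum (suffixSum-zero (k ∷ ks)) (suffixSum-step (1≤k ∷ 1≤ks))
                (suffixSum-sublinear 1≤ks)

-- remainder bounds the tail of the series: nestedSum (k ∷ ks) (m + 1) + remainder ks m
-- is antitone in m, and remainder ks m tends to 0.
remainder : List ℕ → ℕ → ℚ
remainder ks m = suffixSum ks (suc m) * w m

remainder-nonNeg : ∀ ks m → 0ℚ ≤ remainder ks m
remainder-nonNeg ks m = 0≤* (suffixSum-nonNeg ks (suc m)) (w-nonNeg m)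

remainder-split : ∀ E i c W → (E * i + c) * W ≡ E * (i * W) + c * W
remainder-split = solve 4 (λ E i c W → (E :* i :+ c) :* W := E :* (i :* W) :+ c :* W) refl

remainder-bound : ∀ ks {ε K δ} m → 0ℚ < K → K * δ ≡ ½ * ε →
  suffixSum ks (suc m) ≤ ½ * ε * ι (suc m) + K → w m < δ → remainder ks m < ε
remainder-bound ks {ε} {K} {δ} m 0<K Kδ≡ε/2 A≤ w<δ = begin-strict
  suffixSum ks (suc m) * w m
    ≤⟨ *-monoʳ (w m) (w-nonNeg m) A≤ ⟩
  (½ * ε * ι (suc m) + K) * w m
    ≡⟨ remainder-split (½ * ε) (ι (suc m)) K (w m) ⟩
  ½ * ε * (ι (suc m) * w m) + K * w m
    ≡⟨ cong (λ z → ½ * ε * z + K * w m) (ι*w m) ⟩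
  ½ * ε * 1ℚ + K * w m
    <⟨ +-monoʳ-< (½ * ε * 1ℚ) (*-monoʳ-<-pos K {{positive 0<K}} w<δ) ⟩
  ½ * ε * 1ℚ + K * δ
    ≡⟨ cong₂ _+_ (*-identityʳ (½ * ε)) Kδ≡ε/2 ⟩
  ½ * ε + ½ * ε
    ≡⟨ half+half ε ⟩
  ε ∎
  where open ≤-Reasoning

remainder-null : ∀ {ks} → All (1 ℕ.≤_) ks → ∀ ε → 0ℚ < ε →
  ∃[ N ] (∀ m → N ℕ.≤ m → remainder ks m < ε)
remainder-null {ks} 1≤ks ε 0<ε =
  let K , 0<K , A≤ = suffixSum-sublinear 1≤ks (½ * ε) (0<* 0<½ 0<ε)
      δ , 0<δ , Kδ≡ε/2 = shrink (0<* 0<½ 0<ε) 0<K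
      N , w<δ = w-null 0<δ
  in N , λ m N≤m → remainder-bound ks m 0<K Kδ≡ε/2 (A≤ (suc m)) (w<δ m N≤m)

remainder-regroup : ∀ s a b p t →
  s + a * b * p + ((p + t) + a * t) * b ≡ s + (p + t) * (b + a * b)
remainder-regroup = solve 5 (λ s a b p t → s :+ a :* b :* p :+ ((p :+ t) :+ a :* t) :* b
                                        := s :+ (p :+ t) :* (b :+ a :* b)) refl

remainder-step : ∀ {k ks} → 1 ℕ.< k → All (1 ℕ.≤_) ks → ∀ m →
  nestedSum (k ∷ ks) (suc (suc m)) + remainder ks (suc m)
    ≤ nestedSum (k ∷ ks) (suc m) + remainder ks m
remainder-step {k} {ks} 1<k 1≤ks m = begin
  S + recipPow (suc (suc m)) k * P + suffixSum ks (suc (suc m)) * w′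
    ≤⟨ +-mono-≤ (+-monoʳ-≤ S (*-monoʳ P (nestedSum-nonNeg ks (suc m)) (recipPow≤w*w m k 1<k)))
                (*-monoʳ w′ (w-nonNeg (suc m)) (suffixSum-step 1≤ks (suc m))) ⟩
  S + w m * w′ * P + (A + w′ * T) * w′
    ≤⟨ +-monoʳ-≤ (S + w m * w′ * P) (*-monoʳ w′ (w-nonNeg (suc m)) (+-monoʳ-≤ A
         (*-monoʳ T (properSuffixSum-nonNeg ks (suc m))
           (recip-anti (suc m) (suc (suc m)) (ℕₚ.n≤1+n (suc m)))))) ⟩
  S + w m * w′ * P + (A + w m * T) * w′
    ≡⟨ cong (λ z → S + w m * w′ * P + (z + w m * T) * w′) (suffixSum-split ks (suc m)) ⟩
  S + w m * w′ * P + ((P + T) + w m * T) * w′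
    ≡⟨ remainder-regroup S (w m) w′ P T ⟩
  S + (P + T) * (w′ + w m * w′)
    ≡⟨ cong₂ (λ y z → S + y * z) (sym (suffixSum-split ks (suc m))) (w-telescope m) ⟩
  S + A * w m ∎
  where
  open ≤-Reasoning
  S = nestedSum (k ∷ ks) (suc m)
  P = nestedSum ks (suc m)
  A = suffixSum ks (suc m)
  T = properSuffixSum ks (suc m)
  w′ = w (suc m)

antitone : ∀ {u : ℕ → ℚ} → (∀ n → u (suc n) ≤ u n) → ∀ {m n} → m ℕ.≤ n → u n ≤ u m
antitone step {zero}  {zero}  z≤n       = ≤-refl
antitone step {zero}  {suc n} z≤n       = ≤-trans (step n) (antitone step {zero} {n} z≤n)
antitone step {suc m} {suc n} (s≤s m≤n) = antitone (λ i → step (suc i)) m≤n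

nestedSum-mono : ∀ k ks {m n} → m ℕ.≤ n → nestedSum (k ∷ ks) m ≤ nestedSum (k ∷ ks) n
nestedSum-mono k ks {m} {n} m≤n =
  recast-≤ (neg-antimono-≤ (antitone {λ i → - nestedSum (k ∷ ks) i}
           (λ i → neg-antimono-≤ (recast-≤ (+-monoʳ-≤ (nestedSum (k ∷ ks) i) (0≤term i))
                                         (+-identityʳ (nestedSum (k ∷ ks) i)) refl)) m≤n))
         (neg-neg (nestedSum (k ∷ ks) m)) (neg-neg (nestedSum (k ∷ ks) n))
  where
  neg-neg = solve 1 (λ p → :- (:- p) := p) refl
  0≤term : ∀ i → 0ℚ ≤ recipPow (suc i) k * nestedSum ks i
  0≤term i = 0≤* (<⇒≤ (recip-pos (suc i ℕ.^ k) {{ℕₚ.m^n≢0 (suc i) k}})) (nestedSum-nonNeg ks i)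

cancel-middle : ∀ s r → s + r - s ≡ r
cancel-middle = solve 2 (λ s r → s :+ r :- s := r) refl

close-by-remainder : ∀ {s s′ r r′ ε} → s ≤ s′ → 0ℚ ≤ r′ → s′ + r′ ≤ s + r → r < ε →
  ∣ s′ - s ∣ < ε
close-by-remainder {s} {s′} {r} {r′} {ε} s≤s′ 0≤r′ s′+r′≤s+r r<ε = begin-strict
  ∣ s′ - s ∣     ≡⟨ 0≤p⇒∣p∣≡p (recast-≤ (+-monoˡ-≤ (- s) s≤s′) (+-inverseʳ s) refl) ⟩
  s′ - s         ≡⟨ cong (_- s) (+-identityʳ s′) ⟨
  s′ + 0ℚ - s    ≤⟨ +-monoˡ-≤ (- s) (+-monoʳ-≤ s′ 0≤r′) ⟩
  s′ + r′ - s    ≤⟨ +-monoˡ-≤ (- s) s′+r′≤s+r ⟩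
  s + r - s      ≡⟨ cancel-middle s r ⟩
  r              <⟨ r<ε ⟩
  ε              ∎
  where open ≤-Reasoning

nestedSum-cauchy : ∀ {k ks} → 1 ℕ.< k → All (1 ℕ.≤_) ks → IsCauchy (nestedSum (k ∷ ks))
nestedSum-cauchy {k} {ks} 1<k 1≤ks ε 0<ε =
  let N , small = remainder-null 1≤ks ε 0<ε in suc N , close N small
  where
  S : ℕ → ℚ
  S = nestedSum (k ∷ ks)

  module _ (N : ℕ) (small : ∀ m → N ℕ.≤ m → remainder ks m < ε) where
    ordered : ∀ m n → N ℕ.≤ m → m ℕ.≤ n → ∣ S (suc n) - S (suc m) ∣ < ε
    ordered m n N≤m m≤n = close-by-remainder {S (suc m)} {S (suc n)} {remainder ks m} {remainder ks n}
      (nestedSum-mono k ks (s≤s m≤n)) (remainder-nonNeg ks n)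
      (antitone {λ i → S (suc i) + remainder ks i} (remainder-step 1<k 1≤ks) m≤n)
      (small m N≤m)

    close : ∀ m n → suc N ℕ.≤ m → suc N ℕ.≤ n → ∣ S m - S n ∣ < ε
    close (suc m) (suc n) (s≤s N≤m) (s≤s N≤n) with ℕₚ.≤-total m n
    ... | inj₁ m≤n = recast-< (∣p-q∣≡∣q-p∣ (S (suc n)) (S (suc m))) (ordered m n N≤m m≤n)
    ... | inj₂ n≤m = ordered n m N≤n n≤m

-- The argument list is k₁ ∷ … ∷ kᵣ ∷ [], and the approximants are the
-- truncations nᵣ ≤ N of the defining series.
ζ : (ks : List ℕ) → Admissible ks → ℝ
ζ ks adm = mkℝ (nestedSum (reverse ks)) convergent
  where
  convergent : IsCauchy (nestedSum (reverse ks))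
  convergent with reverse-admissible adm
  ... | l , ls , eq , 1<l , 1≤ls =
    subst (λ xs → IsCauchy (nestedSum xs)) (sym eq) (nestedSum-cauchy 1<l 1≤ls)

2k+1-admissible : ∀ k → .{{NonZero k}} → Admissible (2 ℕ.* k ℕ.+ 1 ∷ [])
2k+1-admissible k = last (ℕₚ.+-monoˡ-≤ 1 (ℕₚ.≤-trans (ℕ.>-nonZero⁻¹ k) (ℕₚ.m≤m+n k (k ℕ.+ 0))))

twos-admissible : ∀ n → Admissible (replicate (suc n) 2)
twos-admissible zero    = last (s≤s (s≤s z≤n))
twos-admissible (suc n) = s≤s z≤n ∷ twos-admissible n

twos-3-twos-admissible : ∀ a b → Admissible (replicate a 2 ++ 3 ∷ replicate b 2)
twos-3-twos-admissible zero    zero    = last (s≤s (s≤s z≤n))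
twos-3-twos-admissible zero    (suc b) = s≤s z≤n ∷ twos-admissible b
twos-3-twos-admissible (suc a) b       = s≤s z≤n ∷ twos-3-twos-admissible a b

H : ℕ → ℝ
H zero    = fromℚ 1ℚ
H (suc n) = ζ (replicate (suc n) 2) (twos-admissible n)

-- H₂ a b is H(a,b); H above is the one-argument H(n).
H₂ : ℕ → ℕ → ℝ
H₂ a b = ζ (replicate a 2 ++ 3 ∷ replicate b 2) (twos-3-twos-admissible a b)

c : ℕ → ℕ → ℕ → ℚ
c a b k = + ((2 ℕ.* k) C (2 ℕ.* a ℕ.+ 2)) / 1
        - (1ℚ - recipPow 2 (2 ℕ.* k)) * (+ ((2 ℕ.* k) C (2 ℕ.* b ℕ.+ 1)) / 1)

sign : ℕ → ℚ
sign k = (-1ℤ ℤ.^ k) / 1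

-- Truncate every series at N and put P(x) = ∏_{n ≤ N} (1 - x²/n²). The partial fractions of 1/P(x) have
-- coefficients ± 2 ρ(n), ρ(n) = N!²/((N - n)! (N + n)!), and induction on N gives the exact identity
--   ∑_{a,b} (-1)ᵃ⁺ᵇ H_N(a,b) x²ᵃ y²ᵇ = 4 P(x) P(y) ∑_{j ≤ n ≤ N} (-1)ⁿ⁻¹ ρ(n)/(n² - x²) · j/(j² - y²),
-- in which terms with j = n count one half. By dominated convergence ρ may be replaced by 1, so that the
-- coefficients of the double sum become alternating Euler sums ∑_n (-1)ⁿ⁻¹ n⁻ˢ ∑_{j ≤ n} j⁻ʳ with s even
-- and r odd. These are evaluated by expanding n⁻ˢ ((q + n)⁻ʳ + (q - n)⁻ʳ) into partial fractions and summing
-- with signs (-1)ⁿ over the square n, q ≤ N: the inner sums telescope up to errors which are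
-- O(∑_n 1/(n (N + 1 - n))), and only products of a zeta or eta value of odd weight with a coefficient of
-- 1/P survive. The factors P(x) P(y) cancel these coefficients, leaving the asserted convolution with H.

module Submission where

open import Algebra.Bundles using (CommutativeRing)
import Data.Integer.Base as ℤ
import Data.Integer.Properties as ℤₚ
open import Data.List.Base using (List; []; _∷_; _++_; replicate; reverse)
open import Data.List.Properties using (reverse-++; unfold-reverse; ++-assoc)
open import Data.List.Relation.Unary.All using ([]; _∷_)
open import Data.Nat.Base as ℕ using (ℕ; zero; suc; z≤n; s≤s; ⌊_/2⌋)
open import Data.Nat.Combinatorics using (_C_; nCn≡1; nCk+nC[k+1]≡[n+1]C[k+1]; k>n⇒nCk≡0)
import Data.Nat.Properties as ℕₚ
open import Data.Product.Base using (∃-syntax; _×_; _,_; proj₁; proj₂)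
open import Data.Rational.Base hiding (NonZero)
open import Data.Rational.Properties
import Data.Rational.Unnormalised.Properties as ℚᵘₚ
open import Data.Sum.Base using (_⊎_; inj₁; inj₂)
open import Level using (0ℓ)
open import Relation.Binary.PropositionalEquality
open import Relation.Nullary.Decidable using (dec⇒maybe)
open import Tactic.RingSolver using (solve-∀)
open import Tactic.RingSolver.Core.AlmostCommutativeRing using (AlmostCommutativeRing; fromCommutativeRing)
open import Algebra.Properties.Semiring.Exp (CommutativeRing.semiring +-*-commutativeRing)
  using (_^_; ^-homo-*)
open import Defs

open ≤-Reasoning

-- The weight one half on the diagonal has two independent origins. In the induction on N, the tails
-- of (-1)ⁿ⁻¹ ρ(n) with halved first term have the closed form (-1)ʲ⁻¹ ρ(j) j/(2N); its factor j
-- absorbs one power of 1/j, so that a double sum collapses to a multiple of a coefficient of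
-- 1/P(y). In the evaluation, summing (q + n)⁻ʳ + (q - n)⁻ʳ over q produces, for odd r, the partial
-- zeta sums up to n and up to n - 1, whose mean is the same half-weighted sum. The obstacle is r =
-- 1, where the zeta sum diverges and no limit can be taken term by term. The identities over the
-- square are therefore kept exact at each N until the product of ζ(r) and η(s) has cancelled; only
-- what remains is compared up to null sequences. Likewise the values 2 η(2i) are turned back into
-- coefficients of the truncated 1/P, which multiplication by P removes exactly at finite N. The
-- factor 1 - 2⁻²ᵏ comes from η(s) = (1 - 2¹⁻ˢ) ζ(s) at s = 2k + 1.

infix 4 _~_

ℚ-ring : AlmostCommutativeRing 0ℓ 0ℓ
ℚ-ring = fromCommutativeRing +-*-commutativeRing (λ x → dec⇒maybe (0ℚ ≟ x))

+-interchange : ∀ a b c d → (a + b) + (c + d) ≡ (a + c) + (b + d)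
+-interchange = solve-∀ ℚ-ring

-- Finite sums over ranges and antidiagonals

sum : ℕ → (ℕ → ℚ) → ℚ
sum zero    f = 0ℚ
sum (suc n) f = sum n f + f n

sum-cong : ∀ n {f g} → (∀ k → f k ≡ g k) → sum n f ≡ sum n g
sum-cong zero    f≗g = refl
sum-cong (suc n) f≗g = cong₂ _+_ (sum-cong n f≗g) (f≗g n)

sum-+ : ∀ n f g → sum n (λ k → f k + g k) ≡ sum n f + sum n g
sum-+ zero    f g = refl
sum-+ (suc n) f g = trans (cong (_+ (f n + g n)) (sum-+ n f g))
                          (+-interchange (sum n f) (sum n g) (f n) (g n))

sum-*ˡ : ∀ n c f → sum n (λ k → c * f k) ≡ c * sum n f
sum-*ˡ zero    c f = sym (*-zeroʳ c)
sum-*ˡ (suc n) c f = trans (cong (_+ c * f n) (sum-*ˡ n c f)) (sym (*-distribˡ-+ c (sum n f) (f n)))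

sum-*ʳ : ∀ n c f → sum n (λ k → f k * c) ≡ sum n f * c
sum-*ʳ n c f = trans (sum-cong n (λ k → *-comm (f k) c)) (trans (sum-*ˡ n c f) (*-comm c (sum n f)))

-1ℚ : ℚ
-1ℚ = - 1ℚ

-≡-1* : ∀ p → - p ≡ -1ℚ * p
-≡-1* = solve-∀ ℚ-ring

sum-neg : ∀ n f → sum n (λ k → - f k) ≡ - sum n f
sum-neg n f = trans (sum-cong n (λ k → -≡-1* (f k)))
                    (trans (sum-*ˡ n -1ℚ f) (sym (-≡-1* (sum n f))))

sum-- : ∀ n f g → sum n (λ k → f k - g k) ≡ sum n f - sum n g
sum-- n f g = trans (sum-+ n f (λ k → - g k)) (cong (sum n f +_) (sum-neg n g))

sum-zero : ∀ n → sum n (λ _ → 0ℚ) ≡ 0ℚ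
sum-zero zero    = refl
sum-zero (suc n) = trans (+-identityʳ _) (sum-zero n)

sum-swap : ∀ m n (F : ℕ → ℕ → ℚ) →
  sum m (λ i → sum n (F i)) ≡ sum n (λ j → sum m (λ i → F i j))
sum-swap zero    n F = sym (sum-zero n)
sum-swap (suc m) n F = trans (cong (_+ sum n (F m)) (sum-swap m n F))
                             (sym (sum-+ n (λ j → sum m (λ i → F i j)) (F m)))

sum-front : ∀ n f → sum (suc n) f ≡ f 0 + sum n (λ k → f (suc k))
sum-front zero    f = +-comm 0ℚ (f 0)
sum-front (suc n) f = trans (cong (_+ f (suc n)) (sum-front n f))
                            (+-assoc (f 0) (sum n (λ k → f (suc k))) (f (suc n)))

sum-++ : ∀ m k f → sum (k ℕ.+ m) f ≡ sum m f + sum k (λ i → f (i ℕ.+ m))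
sum-++ m zero    f = sym (+-identityʳ (sum m f))
sum-++ m (suc k) f = trans (cong (_+ f (k ℕ.+ m)) (sum-++ m k f))
                           (+-assoc (sum m f) (sum k (λ i → f (i ℕ.+ m))) (f (k ℕ.+ m)))

sum-mono : ∀ n {f g} → (∀ k → k ℕ.< n → f k ≤ g k) → sum n f ≤ sum n g
sum-mono zero    f≤g = ≤-refl
sum-mono (suc n) f≤g = +-mono-≤ (sum-mono n (λ k k<n → f≤g k (ℕₚ.m<n⇒m<1+n k<n))) (f≤g n ℕₚ.≤-refl)

∣sum∣≤ : ∀ n f → ∣ sum n f ∣ ≤ sum n (λ k → ∣ f k ∣)
∣sum∣≤ zero    f = ≤-refl
∣sum∣≤ (suc n) f = ≤-trans (∣p+q∣≤∣p∣+∣q∣ (sum n f) (f n)) (+-monoˡ-≤ ∣ f n ∣ (∣sum∣≤ n f))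

∣sum∣≤-bound : ∀ n {f g} → (∀ k → k ℕ.< n → ∣ f k ∣ ≤ g k) → ∣ sum n f ∣ ≤ sum n g
∣sum∣≤-bound n {f} f≤g = ≤-trans (∣sum∣≤ n f) (sum-mono n f≤g)

-- ∑_{i + j = n} F i j
antidiagonal : (ℕ → ℕ → ℚ) → ℕ → ℚ
antidiagonal F zero    = F 0 0
antidiagonal F (suc n) = F 0 (suc n) + antidiagonal (λ i j → F (suc i) j) n

antidiagonal-cong : ∀ n {F G : ℕ → ℕ → ℚ} → (∀ i j → F i j ≡ G i j) → antidiagonal F n ≡ antidiagonal G n
antidiagonal-cong zero    F≗G = F≗G 0 0
antidiagonal-cong (suc n) F≗G = cong₂ _+_ (F≗G 0 (suc n)) (antidiagonal-cong n (λ i j → F≗G (suc i) j))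

antidiagonal-+ : ∀ n (F G : ℕ → ℕ → ℚ) →
  antidiagonal (λ i j → F i j + G i j) n ≡ antidiagonal F n + antidiagonal G n
antidiagonal-+ zero    F G = refl
antidiagonal-+ (suc n) F G =
  trans (cong ((F 0 (suc n) + G 0 (suc n)) +_) (antidiagonal-+ n (λ i j → F (suc i) j) (λ i j → G (suc i) j)))
        (+-interchange (F 0 (suc n)) (G 0 (suc n)) _ _)

antidiagonal-*ˡ : ∀ n c (F : ℕ → ℕ → ℚ) → antidiagonal (λ i j → c * F i j) n ≡ c * antidiagonal F n
antidiagonal-*ˡ zero    c F = refl
antidiagonal-*ˡ (suc n) c F =
  trans (cong (c * F 0 (suc n) +_) (antidiagonal-*ˡ n c (λ i j → F (suc i) j)))
        (sym (*-distribˡ-+ c (F 0 (suc n)) _))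

antidiagonal-*ʳ : ∀ n c (F : ℕ → ℕ → ℚ) → antidiagonal (λ i j → F i j * c) n ≡ antidiagonal F n * c
antidiagonal-*ʳ n c F = trans (antidiagonal-cong n (λ i j → *-comm (F i j) c))
                              (trans (antidiagonal-*ˡ n c F) (*-comm c _))

antidiagonal-neg : ∀ n (F : ℕ → ℕ → ℚ) → antidiagonal (λ i j → - F i j) n ≡ - antidiagonal F n
antidiagonal-neg n F = trans (antidiagonal-cong n (λ i j → -≡-1* (F i j)))
                             (trans (antidiagonal-*ˡ n -1ℚ F) (sym (-≡-1* _)))

antidiagonal-- : ∀ n (F G : ℕ → ℕ → ℚ) →
  antidiagonal (λ i j → F i j - G i j) n ≡ antidiagonal F n - antidiagonal G n
antidiagonal-- n F G = trans (antidiagonal-+ n F (λ i j → - G i j))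
                             (cong (antidiagonal F n +_) (antidiagonal-neg n G))

antidiagonal-last : ∀ n (F : ℕ → ℕ → ℚ) →
  antidiagonal F (suc n) ≡ antidiagonal (λ i j → F i (suc j)) n + F (suc n) 0
antidiagonal-last zero    F = refl
antidiagonal-last (suc n) F =
  trans (cong (F 0 (suc (suc n)) +_) (antidiagonal-last n (λ i j → F (suc i) j)))
        (sym (+-assoc (F 0 (suc (suc n))) _ _))

antidiagonal-flip : ∀ n (F : ℕ → ℕ → ℚ) → antidiagonal F n ≡ antidiagonal (λ i j → F j i) n
antidiagonal-flip zero    F = refl
antidiagonal-flip (suc n) F =
  trans (cong (F 0 (suc n) +_) (antidiagonal-flip n (λ i j → F (suc i) j)))
        (trans (+-comm (F 0 (suc n)) _) (sym (antidiagonal-last n (λ i j → F j i))))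

sum-antidiagonal : ∀ m n (F : ℕ → ℕ → ℕ → ℚ) →
  sum m (λ k → antidiagonal (F k) n) ≡ antidiagonal (λ i j → sum m (λ k → F k i j)) n
sum-antidiagonal m zero    F = refl
sum-antidiagonal m (suc n) F =
  trans (sum-+ m (λ k → F k 0 (suc n)) (λ k → antidiagonal (λ i j → F k (suc i) j) n))
        (cong (sum m (λ k → F k 0 (suc n)) +_) (sum-antidiagonal m n (λ k i j → F k (suc i) j)))

antidiagonal-cong-≡ : ∀ n {F G : ℕ → ℕ → ℚ} → (∀ i j → i ℕ.+ j ≡ n → F i j ≡ G i j) →
  antidiagonal F n ≡ antidiagonal G n
antidiagonal-cong-≡ zero    F≗G = F≗G 0 0 refl
antidiagonal-cong-≡ (suc n) F≗G =
  cong₂ _+_ (F≗G 0 (suc n) refl) (antidiagonal-cong-≡ n (λ i j i+j≡n → F≗G (suc i) j (cong suc i+j≡n)))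

antidiagonal-const : ∀ n (f : ℕ → ℚ) → antidiagonal (λ i _ → f i) n ≡ sum (suc n) f
antidiagonal-const zero    f = sym (+-identityˡ (f 0))
antidiagonal-const (suc n) f = trans (antidiagonal-last n (λ i _ → f i)) (cong (_+ f (suc n)) (antidiagonal-const n f))

double : ℕ → ℕ
double zero    = zero
double (suc n) = suc (suc (double n))

double≡2* : ∀ n → double n ≡ 2 ℕ.* n
double≡2* zero    = refl
double≡2* (suc n) = cong suc (trans (cong suc (double≡2* n)) (sym (ℕₚ.+-suc n (n ℕ.+ 0))))

-- With an odd total the indices have opposite parity, with an even total the same one. In
-- `expansionˡ-even` and `odd-part`, where these splittings are used, one of the two halves vanishes
-- by signs.
antidiagonal-odd : ∀ m (F : ℕ → ℕ → ℚ) → antidiagonal F (suc (double m))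
  ≡ antidiagonal (λ i j → F (double i) (suc (double j))) m
  + antidiagonal (λ i j → F (suc (double i)) (double j)) m
antidiagonal-odd zero    F = refl
antidiagonal-odd (suc m) F =
  trans (cong (λ s → F 0 (suc (double (suc m))) + (F 1 (double (suc m)) + s))
              (antidiagonal-odd m (λ i j → F (suc (suc i)) j)))
        (trans (sym (+-assoc (F 0 (suc (double (suc m)))) _ _))
               (+-interchange (F 0 (suc (double (suc m)))) (F 1 (double (suc m))) _ _))

antidiagonal-even : ∀ m (F : ℕ → ℕ → ℚ) → antidiagonal F (double (suc m))
  ≡ antidiagonal (λ i j → F (double i) (double j)) (suc m)
  + antidiagonal (λ i j → F (suc (double i)) (suc (double j))) m
antidiagonal-even m F =
  trans (cong (F 0 (double (suc m)) +_) (trans (antidiagonal-odd m (λ i j → F (suc i) j)) (+-comm A B)))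
        (sym (+-assoc (F 0 (double (suc m))) B A))
  where
  A = antidiagonal (λ i j → F (suc (double i)) (suc (double j))) m
  B = antidiagonal (λ i j → F (double (suc i)) (double j)) m

sum-cong-< : ∀ n {f g} → (∀ k → k ℕ.< n → f k ≡ g k) → sum n f ≡ sum n g
sum-cong-< zero    f≗g = refl
sum-cong-< (suc n) f≗g = cong₂ _+_ (sum-cong-< n (λ k k<n → f≗g k (ℕₚ.m<n⇒m<1+n k<n))) (f≗g n ℕₚ.≤-refl)

-- Null sequences and asymptotic equality

-- A record rather than a bare statement, like `Bounded` and `_~_` below: record types are injective
-- for unification, so the implicit sequences can be inferred.
record Null (f : ℕ → ℚ) : Set where
  constructor mkNull
  field small : ∀ ε → 0ℚ < ε → ∃[ N ] (∀ n → N ℕ.≤ n → ∣ f n ∣ < ε)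
open Null public

record Bounded (f : ℕ → ℚ) : Set where
  constructor mkBounded
  field eventual-bound : ∃[ N ] ∃[ B ] 0ℚ < B × (∀ n → N ℕ.≤ n → ∣ f n ∣ ≤ B)

record _~_ (f g : ℕ → ℚ) : Set where
  constructor mk~
  field diff-null : Null (λ n → f n - g n)
open _~_ public

null-cong : ∀ {f g} → (∀ n → f n ≡ g n) → Null f → Null g
null-cong f≗g (mkNull f-small) = mkNull λ ε 0<ε →
  let N , f<ε = f-small ε 0<ε in N , λ n N≤n → recast-< (cong ∣_∣ (f≗g n)) (f<ε n N≤n)

null-≤ : ∀ {f g} → (∀ n → ∣ f n ∣ ≤ g n) → Null g → Null f
null-≤ {f} {g} f≤g (mkNull g-small) = mkNull λ ε 0<ε →
  let N , g<ε = g-small ε 0<ε in N , λ n N≤n →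
    ≤-<-trans (recast-≤ (f≤g n) refl (sym (0≤p⇒∣p∣≡p (≤-trans (0≤∣p∣ (f n)) (f≤g n))))) (g<ε n N≤n)

null-+ : ∀ {f g} → Null f → Null g → Null (λ n → f n + g n)
null-+ {f} {g} (mkNull f-small) (mkNull g-small) = mkNull λ ε 0<ε →
  let M , f<ε/2 = f-small (½ * ε) (0<* 0<½ 0<ε)
      N , g<ε/2 = g-small (½ * ε) (0<* 0<½ 0<ε)
  in M ℕ.⊔ N , λ n K≤n → begin-strict
  ∣ f n + g n ∣      ≤⟨ ∣p+q∣≤∣p∣+∣q∣ (f n) (g n) ⟩
  ∣ f n ∣ + ∣ g n ∣  <⟨ +-mono-< (f<ε/2 n (ℕₚ.m⊔n≤o⇒m≤o M N K≤n)) (g<ε/2 n (ℕₚ.m⊔n≤o⇒n≤o M N K≤n)) ⟩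
  ½ * ε + ½ * ε      ≡⟨ half+half ε ⟩
  ε                  ∎

null-neg : ∀ {f} → Null f → Null (λ n → - f n)
null-neg {f} (mkNull f-small) = mkNull λ ε 0<ε →
  let N , f<ε = f-small ε 0<ε in N , λ n N≤n → recast-< (sym (∣-p∣≡∣p∣ (f n))) (f<ε n N≤n)

null-0 : Null (λ _ → 0ℚ)
null-0 = mkNull λ ε 0<ε → 0 , λ _ _ → 0<ε

bounded*null : ∀ {f g} → Bounded f → Null g → Null (λ n → f n * g n)
bounded*null {f} {g} (mkBounded (M , B , 0<B , ∣f∣≤B)) (mkNull g-small) = mkNull λ ε 0<ε →
  let δ , 0<δ , Bδ≡ε = shrink 0<ε 0<B
      N , g<δ = g-small δ 0<δ
  in M ℕ.⊔ N , λ n K≤n → begin-strict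
  ∣ f n * g n ∣      ≡⟨ ∣p*q∣≡∣p∣*∣q∣ (f n) (g n) ⟩
  ∣ f n ∣ * ∣ g n ∣  ≤⟨ *-monoʳ ∣ g n ∣ (0≤∣p∣ (g n)) (∣f∣≤B n (ℕₚ.m⊔n≤o⇒m≤o M N K≤n)) ⟩
  B * ∣ g n ∣        <⟨ *-monoʳ-<-pos B {{positive 0<B}} (g<δ n (ℕₚ.m⊔n≤o⇒n≤o M N K≤n)) ⟩
  B * δ              ≡⟨ Bδ≡ε ⟩
  ε                  ∎

cauchy⇒bounded : ∀ {f} → IsCauchy f → Bounded f
cauchy⇒bounded f-cauchy = mkBounded (eventuallyBounded f-cauchy)

bounded-const : ∀ c → Bounded (λ _ → c)
bounded-const c = cauchy⇒bounded (cauchy (fromℚ c))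

const*null : ∀ c {f} → Null f → Null (λ n → c * f n)
const*null c = bounded*null (bounded-const c)

≗⇒~ : ∀ {f g} → (∀ n → f n ≡ g n) → f ~ g
≗⇒~ {f} f≗g = mk~ (null-cong (λ n → trans (sym (+-inverseʳ (f n))) (cong (λ z → f n - z) (f≗g n))) null-0)

~-refl : ∀ {f} → f ~ f
~-refl = ≗⇒~ (λ _ → refl)

~-sym : ∀ {f g} → f ~ g → g ~ f
~-sym {f} {g} (mk~ f-g) = mk~ (null-cong (λ n → neg-- (f n) (g n)) (null-neg f-g))
  where
  neg-- : ∀ p q → - (p - q) ≡ q - p
  neg-- = solve-∀ ℚ-ring

~-trans : ∀ {f g h} → f ~ g → g ~ h → f ~ h
~-trans {f} {g} {h} (mk~ f-g) (mk~ g-h) = mk~ (null-cong (λ n → telescope (f n) (g n) (h n)) (null-+ f-g g-h))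
  where
  telescope : ∀ p q r → (p - q) + (q - r) ≡ p - r
  telescope = solve-∀ ℚ-ring

~-+ : ∀ {f f′ g g′} → f ~ f′ → g ~ g′ → (λ n → f n + g n) ~ (λ n → f′ n + g′ n)
~-+ {f} {f′} {g} {g′} (mk~ f-f′) (mk~ g-g′) =
  mk~ (null-cong (λ n → sym (+-cauchy-split (f n) (g n) (f′ n) (g′ n))) (null-+ f-f′ g-g′))

~-neg : ∀ {f g} → f ~ g → (λ n → - f n) ~ (λ n → - g n)
~-neg {f} {g} (mk~ f-g) = mk~ (null-cong (λ n → neg-- (f n) (g n)) (null-neg f-g))
  where
  neg-- : ∀ p q → - (p - q) ≡ - p - - q
  neg-- = solve-∀ ℚ-ring

~-- : ∀ {f f′ g g′} → f ~ f′ → g ~ g′ → (λ n → f n - g n) ~ (λ n → f′ n - g′ n)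
~-- f~f′ g~g′ = ~-+ f~f′ (~-neg g~g′)

~-* : ∀ {f f′ g g′} → Bounded f → Bounded g′ → f ~ f′ → g ~ g′ → (λ n → f n * g n) ~ (λ n → f′ n * g′ n)
~-* {f} {f′} {g} {g′} f-bdd g′-bdd (mk~ f-f′) (mk~ g-g′) =
  mk~ (null-cong (λ n → sym (*-cauchy-split (f n) (g n) (f′ n) (g′ n)))
                 (null-+ (bounded*null f-bdd g-g′) (bounded*null g′-bdd f-f′)))

~-*ˡ : ∀ {b f g} → Bounded b → f ~ g → (λ n → b n * f n) ~ (λ n → b n * g n)
~-*ˡ {b} {f} {g} b-bdd (mk~ f-g) = mk~ (null-cong (λ n → distrib (b n) (f n) (g n)) (bounded*null b-bdd f-g))
  where
  distrib : ∀ b p q → b * (p - q) ≡ b * p - b * q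
  distrib = solve-∀ ℚ-ring

~-const* : ∀ c {f g} → f ~ g → (λ n → c * f n) ~ (λ n → c * g n)
~-const* c = ~-*ˡ (bounded-const c)

~-antidiagonal : ∀ m {F G : ℕ → ℕ → ℕ → ℚ} → (∀ i j → F i j ~ G i j) →
  (λ N → antidiagonal (λ i j → F i j N) m) ~ (λ N → antidiagonal (λ i j → G i j N) m)
~-antidiagonal zero    F~G = F~G 0 0
~-antidiagonal (suc m) F~G = ~-+ (F~G 0 (suc m)) (~-antidiagonal m (λ i j → F~G (suc i) j))

bounded-cong : ∀ {f g} → (∀ n → f n ≡ g n) → Bounded f → Bounded g
bounded-cong f≗g (mkBounded (N , B , 0<B , f≤B)) =
  mkBounded (N , B , 0<B , λ n N≤n → recast-≤ (f≤B n N≤n) (cong ∣_∣ (f≗g n)) refl)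

bounded-* : ∀ {f g} → Bounded f → Bounded g → Bounded (λ n → f n * g n)
bounded-* {f} {g} (mkBounded (M , B , 0<B , f≤B)) (mkBounded (N , C , 0<C , g≤C)) =
  mkBounded (M ℕ.⊔ N , B * C , 0<* 0<B 0<C , λ n K≤n → begin
  ∣ f n * g n ∣      ≡⟨ ∣p*q∣≡∣p∣*∣q∣ (f n) (g n) ⟩
  ∣ f n ∣ * ∣ g n ∣  ≤⟨ *-monoʳ ∣ g n ∣ (0≤∣p∣ (g n)) (f≤B n (ℕₚ.m⊔n≤o⇒m≤o M N K≤n)) ⟩
  B * ∣ g n ∣        ≤⟨ *-monoˡ B (<⇒≤ 0<B) (g≤C n (ℕₚ.m⊔n≤o⇒n≤o M N K≤n)) ⟩
  B * C              ∎)

~-*ʳ : ∀ {b f g} → Bounded b → f ~ g → (λ n → f n * b n) ~ (λ n → g n * b n)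
~-*ʳ {b} {f} {g} b-bdd f~g = ~-trans (≗⇒~ (λ n → *-comm (f n) (b n)))
  (~-trans (~-*ˡ b-bdd f~g) (≗⇒~ (λ n → *-comm (b n) (g n))))

-- The exact formula for truncated sums; ranges are 0-based, so that w k stands for 1/n with n = k + 1

ι-+ : ∀ m n → ι (m ℕ.+ n) ≡ ι m + ι n
ι-+ zero    n = sym (+-identityˡ (ι n))
ι-+ (suc m) n = begin-equality
  ι (suc (m ℕ.+ n))   ≡⟨ ι-suc (m ℕ.+ n) ⟩
  ι (m ℕ.+ n) + 1ℚ    ≡⟨ cong (_+ 1ℚ) (ι-+ m n) ⟩
  ι m + ι n + 1ℚ      ≡⟨ swap (ι m) (ι n) ⟩
  ι m + 1ℚ + ι n      ≡⟨ cong (_+ ι n) (ι-suc m) ⟨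
  ι (suc m) + ι n     ∎
  where
  swap : ∀ a b → a + b + 1ℚ ≡ a + 1ℚ + b
  swap = solve-∀ ℚ-ring

-- At the 0-based index k this is (-1)ⁿ⁻¹ with n = k + 1, so the sign (-1)ⁿ of the statement is
-- `σ (suc k)`.
σ : ℕ → ℚ
σ zero    = 1ℚ
σ (suc k) = - σ k

-- ρ N j = N!² / ((N - j)! (N + j)!), which is 0 for j > N.
ρ : ℕ → ℕ → ℚ
ρ N zero    = 1ℚ
ρ N (suc j) = ρ N j * ((ι N - ι j) * w (j ℕ.+ N))

ρ-ratio : ∀ N j → ρ N (suc j) * (ι N + ι (suc j)) ≡ ρ N j * (ι N - ι j)
ρ-ratio N j = begin-equality
  ρ N j * ((ι N - ι j) * w (j ℕ.+ N)) * (ι N + ι (suc j))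
    ≡⟨ regroup (ρ N j) (ι N - ι j) (w (j ℕ.+ N)) (ι N) (ι (suc j)) ⟩
  ρ N j * (ι N - ι j) * ((ι (suc j) + ι N) * w (j ℕ.+ N))
    ≡⟨ cong (λ z → ρ N j * (ι N - ι j) * (z * w (j ℕ.+ N))) (ι-+ (suc j) N) ⟨
  ρ N j * (ι N - ι j) * (ι (suc (j ℕ.+ N)) * w (j ℕ.+ N))
    ≡⟨ cong (ρ N j * (ι N - ι j) *_) (ι*w (j ℕ.+ N)) ⟩
  ρ N j * (ι N - ι j) * 1ℚ
    ≡⟨ *-identityʳ _ ⟩
  ρ N j * (ι N - ι j) ∎
  where
  regroup : ∀ r d v n i → r * (d * v) * (n + i) ≡ r * d * ((i + n) * v)
  regroup = solve-∀ ℚ-ring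

ρ-beyond : ∀ N → ρ N (suc N) ≡ 0ℚ
ρ-beyond N = begin-equality
  ρ N N * ((ι N - ι N) * w (N ℕ.+ N))  ≡⟨ cong (λ z → ρ N N * (z * w (N ℕ.+ N))) (+-inverseʳ (ι N)) ⟩
  ρ N N * (0ℚ * w (N ℕ.+ N))           ≡⟨ vanish (ρ N N) (w (N ℕ.+ N)) ⟩
  0ℚ                                   ∎
  where
  vanish : ∀ r v → r * (0ℚ * v) ≡ 0ℚ
  vanish = solve-∀ ℚ-ring

-- The new factor 1 - x²/(N + 1)² of P takes the value 1 - j²/(N + 1)² at the pole x = j of 1/P, and
-- the partial fraction coefficient there is divided by it.
ρ-suc : ∀ N j → ρ N j * (ι (suc N) * ι (suc N)) ≡ ρ (suc N) j * (ι (suc N) * ι (suc N) - ι j * ι j)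
ρ-suc N zero    = base (ι (suc N))
  where
  base : ∀ m → 1ℚ * (m * m) ≡ 1ℚ * (m * m - 0ℚ * 0ℚ)
  base = solve-∀ ℚ-ring
ρ-suc N (suc j) = begin-equality
  ρ N j * ((ι N - a) * v) * (m * m)
    ≡⟨ front (ρ N j) (ι N - a) v m ⟩
  ρ N j * (m * m) * ((ι N - a) * v)
    ≡⟨ cong (_* ((ι N - a) * v)) (ρ-suc N j) ⟩
  R * (m * m - a * a) * ((ι N - a) * v)
    ≡⟨ factor R m a (ι N) v ⟩
  R * (m - a) * (ι N - a) * ((a + m) * v)
    ≡⟨ cong (λ z → R * (m - a) * (ι N - a) * (z * v)) (trans (sym (ι-+ j (suc N))) (cong ι (ℕₚ.+-suc j N))) ⟩
  R * (m - a) * (ι N - a) * (ι (suc (j ℕ.+ N)) * v)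
    ≡⟨ cong (R * (m - a) * (ι N - a) *_) (trans (ι*w (j ℕ.+ N)) (sym (ι*w (j ℕ.+ suc N)))) ⟩
  R * (m - a) * (ι N - a) * (ι (suc (j ℕ.+ suc N)) * v′)
    ≡⟨ cong₂ (λ y z → R * (m - a) * y * (z * v′))
         (trans (shift (ι N) a) (cong₂ _-_ (sym (ι-suc N)) (sym (ι-suc j)))) (ι-+ (suc j) (suc N)) ⟩
  R * (m - a) * (m - ι (suc j)) * ((ι (suc j) + m) * v′)
    ≡⟨ unfactor R m a (ι (suc j)) v′ ⟩
  R * ((m - a) * v′) * (m * m - ι (suc j) * ι (suc j)) ∎
  where
  a = ι j
  m = ι (suc N)
  v = w (j ℕ.+ N)
  v′ = w (j ℕ.+ suc N)
  R = ρ (suc N) j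
  front : ∀ r d v m → r * (d * v) * (m * m) ≡ r * (m * m) * (d * v)
  front = solve-∀ ℚ-ring
  factor : ∀ r m a n v → r * (m * m - a * a) * ((n - a) * v) ≡ r * (m - a) * (n - a) * ((a + m) * v)
  factor = solve-∀ ℚ-ring
  shift : ∀ n a → n - a ≡ (n + 1ℚ) - (a + 1ℚ)
  shift = solve-∀ ℚ-ring
  unfactor : ∀ r m a b v → r * (m - a) * (m - b) * ((b + m) * v) ≡ r * ((m - a) * v) * (m * m - b * b)
  unfactor = solve-∀ ℚ-ring

ρ-suc-w : ∀ N k → ρ (suc N) (suc k) * (w k * w k - w N * w N) ≡ ρ N (suc k) * (w k * w k)
ρ-suc-w N k = begin-equality
  R * (u * u - v * v)
    ≡⟨ insert R u v ⟩
  R * ((1ℚ * 1ℚ) * (u * u) - (1ℚ * 1ℚ) * (v * v))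
    ≡⟨ cong₂ (λ y z → R * ((y * y) * (u * u) - (z * z) * (v * v))) (ι*w N) (ι*w k) ⟨
  R * (((m * v) * (m * v)) * (u * u) - ((a * u) * (a * u)) * (v * v))
    ≡⟨ gather R u v m a ⟩
  R * (m * m - a * a) * ((u * u) * (v * v))
    ≡⟨ cong (_* ((u * u) * (v * v))) (ρ-suc N (suc k)) ⟨
  ρ N (suc k) * (m * m) * ((u * u) * (v * v))
    ≡⟨ extract (ρ N (suc k)) m u v ⟩
  ρ N (suc k) * ((m * v) * (m * v) * (u * u))
    ≡⟨ cong (λ z → ρ N (suc k) * (z * z * (u * u))) (ι*w N) ⟩
  ρ N (suc k) * (1ℚ * 1ℚ * (u * u))
    ≡⟨ cong (ρ N (suc k) *_) (*-identityˡ (u * u)) ⟩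
  ρ N (suc k) * (u * u) ∎
  where
  R = ρ (suc N) (suc k)
  u = w k
  v = w N
  m = ι (suc N)
  a = ι (suc k)
  insert : ∀ r u v → r * (u * u - v * v) ≡ r * ((1ℚ * 1ℚ) * (u * u) - (1ℚ * 1ℚ) * (v * v))
  insert = solve-∀ ℚ-ring
  gather : ∀ r u v m a → r * (((m * v) * (m * v)) * (u * u) - ((a * u) * (a * u)) * (v * v))
                       ≡ r * (m * m - a * a) * ((u * u) * (v * v))
  gather = solve-∀ ℚ-ring
  extract : ∀ r m u v → r * (m * m) * ((u * u) * (v * v)) ≡ r * ((m * v) * (m * v) * (u * u))
  extract = solve-∀ ℚ-ring

-- Summation by parts and the partial fractions of 1/P

module _ (c T x : ℕ → ℚ) (T-step : ∀ k → T k - T (suc k) ≡ ½ * c k + ½ * c (suc k)) where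

  private
    T≡ : ∀ k → T k ≡ T (suc k) + (½ * c k + ½ * c (suc k))
    T≡ k = trans (rearrange (T k) (T (suc k))) (cong (λ z → T (suc k) + z) (T-step k))
      where
      rearrange : ∀ a b → a ≡ b + (a - b)
      rearrange = solve-∀ ℚ-ring

  -- By `T-step`, `T` differs by a constant from the tail of `c` whose first term is halved.
  -- Interchanging the summations replaces the half-weighted sums of `x` by these tails; the last
  -- term corrects for the constant, which is zero when `T M` is `½ * c M`.
  sum-by-parts : ∀ M → sum (suc M) (λ k → c k * (sum k x + ½ * x k))
    ≡ sum (suc M) (λ k → T k * x k) - (T M - ½ * c M) * sum (suc M) x
  sum-by-parts zero = base (c 0) (T 0) (x 0)
    where
    base : ∀ c t x → 0ℚ + c * (0ℚ + ½ * x) ≡ 0ℚ + t * x - (t - ½ * c) * (0ℚ + x)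
    base = solve-∀ ℚ-ring
  sum-by-parts (suc M) = begin-equality
    sum (suc M) (λ k → c k * (sum k x + ½ * x k)) + c′ * (X + ½ * x′)
      ≡⟨ cong (_+ c′ * (X + ½ * x′)) (sum-by-parts M) ⟩
    A - (T M - ½ * c M) * X + c′ * (X + ½ * x′)
      ≡⟨ cong (λ t → A - (t - ½ * c M) * X + c′ * (X + ½ * x′)) (T≡ M) ⟩
    A - (T′ + (½ * c M + ½ * c′) - ½ * c M) * X + c′ * (X + ½ * x′)
      ≡⟨ collect A T′ (c M) c′ X x′ ⟩
    A + T′ * x′ - (T′ - ½ * c′) * (X + x′) ∎
    where
    A = sum (suc M) (λ k → T k * x k)
    X = sum (suc M) x
    c′ = c (suc M)
    T′ = T (suc M)
    x′ = x (suc M)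
    collect : ∀ A t b c X x → A - (t + (½ * b + ½ * c) - ½ * b) * X + c * (X + ½ * x)
                            ≡ A + t * x - (t - ½ * c) * (X + x)
    collect = solve-∀ ℚ-ring

  sum-telescope : ∀ M → sum (suc M) c ≡ (T 0 + ½ * c 0) - (T M - ½ * c M)
  sum-telescope zero = base (c 0) (T 0)
    where
    base : ∀ c t → 0ℚ + c ≡ (t + ½ * c) - (t - ½ * c)
    base = solve-∀ ℚ-ring
  sum-telescope (suc M) = begin-equality
    sum (suc M) c + c′
      ≡⟨ cong (_+ c′) (sum-telescope M) ⟩
    B - (T M - ½ * c M) + c′
      ≡⟨ cong (λ t → B - (t - ½ * c M) + c′) (T≡ M) ⟩
    B - (T (suc M) + (½ * c M + ½ * c′) - ½ * c M) + c′
      ≡⟨ collect B (T (suc M)) (c M) c′ ⟩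
    B - (T (suc M) - ½ * c′) ∎
    where
    B = T 0 + ½ * c 0
    c′ = c (suc M)
    collect : ∀ b t g c → b - (t + (½ * g + ½ * c) - ½ * g) + c ≡ b - (t - ½ * c)
    collect = solve-∀ ℚ-ring

alternating : ℕ → ℕ → ℚ
alternating N k = σ k * ρ N (suc k)

halfSum : ℕ → ℕ → ℚ
halfSum r k = sum k (λ j → w j ^ r) + ½ * w k ^ r

private
  -- With N = M + 1 and j = k + 1 this is (-1)ʲ⁻¹ ρ(j) j/(2N), the closed form of the sum of (-1)ⁿ⁻¹
  -- ρ(n) over j ≤ n ≤ N with its first term halved. `ρ-ratio` makes it telescope, and `tail-end`
  -- fixes the constant.
  tail : ℕ → ℕ → ℚ
  tail M k = alternating (suc M) k * ι (suc k) * (½ * w M)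

  tail-step : ∀ M k → tail M k - tail M (suc k)
                    ≡ ½ * alternating (suc M) k + ½ * alternating (suc M) (suc k)
  tail-step M k = begin-equality
    s * R * ι (suc k) * (½ * w M) - - s * R′ * ι (suc (suc k)) * (½ * w M)
      ≡⟨ expand s R R′ (ι (suc k)) n (ι (suc (suc k))) (w M) ⟩
    ½ * (s * w M) * (R′ * (n + ι (suc (suc k))) + R * ι (suc k) - R′ * n)
      ≡⟨ cong (λ z → ½ * (s * w M) * (z + R * ι (suc k) - R′ * n)) (ρ-ratio (suc M) (suc k)) ⟩
    ½ * (s * w M) * (R * (n - ι (suc k)) + R * ι (suc k) - R′ * n)
      ≡⟨ collect s R R′ (ι (suc k)) n (w M) ⟩
    ½ * (s * (R - R′)) * (n * w M)
      ≡⟨ cong (½ * (s * (R - R′)) *_) (ι*w M) ⟩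
    ½ * (s * (R - R′)) * 1ℚ
      ≡⟨ finish s R R′ ⟩
    ½ * (s * R) + ½ * (- s * R′) ∎
    where
    s = σ k
    R = ρ (suc M) (suc k)
    R′ = ρ (suc M) (suc (suc k))
    n = ι (suc M)
    expand : ∀ s R R′ i n i′ v → s * R * i * (½ * v) - - s * R′ * i′ * (½ * v)
                               ≡ ½ * (s * v) * (R′ * (n + i′) + R * i - R′ * n)
    expand = solve-∀ ℚ-ring
    collect : ∀ s R R′ i n v → ½ * (s * v) * (R * (n - i) + R * i - R′ * n) ≡ ½ * (s * (R - R′)) * (n * v)
    collect = solve-∀ ℚ-ring
    finish : ∀ s R R′ → ½ * (s * (R - R′)) * 1ℚ ≡ ½ * (s * R) + ½ * (- s * R′)
    finish = solve-∀ ℚ-ring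

  tail-end : ∀ M → tail M M - ½ * alternating (suc M) M ≡ 0ℚ
  tail-end M = begin-equality
    A * ι (suc M) * (½ * w M) - ½ * A   ≡⟨ regroup A (ι (suc M)) (w M) ⟩
    ½ * A * (ι (suc M) * w M) - ½ * A   ≡⟨ cong (λ z → ½ * A * z - ½ * A) (ι*w M) ⟩
    ½ * A * 1ℚ - ½ * A                  ≡⟨ cancel A ⟩
    0ℚ                                  ∎
    where
    A = alternating (suc M) M
    regroup : ∀ a i v → a * i * (½ * v) - ½ * a ≡ ½ * a * (i * v) - ½ * a
    regroup = solve-∀ ℚ-ring
    cancel : ∀ a → ½ * a * 1ℚ - ½ * a ≡ 0ℚ
    cancel = solve-∀ ℚ-ring

  tail-start : ∀ M → tail M 0 + ½ * alternating (suc M) 0 ≡ ½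
  tail-start M = begin-equality
    1ℚ * R * 1ℚ * (½ * w M) + ½ * (1ℚ * R)
      ≡⟨ insert R (w M) ⟩
    ½ * (R * (1ℚ + 1ℚ * w M) + (R * 1ℚ - R))
      ≡⟨ cong (λ z → ½ * (R * (z + 1ℚ * w M) + (R * 1ℚ - R))) (ι*w M) ⟨
    ½ * (R * (n * w M + 1ℚ * w M) + (R * 1ℚ - R))
      ≡⟨ regroup R n (w M) ⟩
    ½ * (R * (n + 1ℚ)) * w M
      ≡⟨ cong (λ z → ½ * z * w M) (ρ-ratio (suc M) 0) ⟩
    ½ * (1ℚ * (n - 0ℚ)) * w M
      ≡⟨ regroup′ n (w M) ⟩
    ½ * (n * w M)
      ≡⟨ cong (½ *_) (ι*w M) ⟩
    ½ * 1ℚ ∎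
    where
    R = ρ (suc M) 1
    n = ι (suc M)
    insert : ∀ r v → 1ℚ * r * 1ℚ * (½ * v) + ½ * (1ℚ * r) ≡ ½ * (r * (1ℚ + 1ℚ * v) + (r * 1ℚ - r))
    insert = solve-∀ ℚ-ring
    regroup : ∀ r n v → ½ * (r * (n * v + 1ℚ * v) + (r * 1ℚ - r)) ≡ ½ * (r * (n + 1ℚ)) * v
    regroup = solve-∀ ℚ-ring
    regroup′ : ∀ n v → ½ * (1ℚ * (n - 0ℚ)) * v ≡ ½ * (n * v)
    regroup′ = solve-∀ ℚ-ring

  -- The factor j in `tail` lowers the exponent from r + 1 to r, and the boundary term of the
  -- summation by parts vanishes by `tail-end`.
  sum-halfSum : ∀ M r → sum (suc M) (λ k → alternating (suc M) k * halfSum (suc r) k)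
                      ≡ ½ * w M * sum (suc M) (λ k → alternating (suc M) k * w k ^ r)
  sum-halfSum M r = begin-equality
    sum (suc M) (λ k → alternating (suc M) k * halfSum (suc r) k)
      ≡⟨ sum-by-parts (alternating (suc M)) (tail M) (λ k → w k ^ suc r) (tail-step M) M ⟩
    A - (tail M M - ½ * alternating (suc M) M) * X
      ≡⟨ cong (λ z → A - z * X) (tail-end M) ⟩
    A - 0ℚ * X
      ≡⟨ drop A X ⟩
    A
      ≡⟨ sum-cong (suc M) term ⟩
    sum (suc M) (λ k → ½ * w M * (alternating (suc M) k * w k ^ r))
      ≡⟨ sum-*ˡ (suc M) (½ * w M) (λ k → alternating (suc M) k * w k ^ r) ⟩
    ½ * w M * sum (suc M) (λ k → alternating (suc M) k * w k ^ r) ∎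
    where
    A = sum (suc M) (λ k → tail M k * w k ^ suc r)
    X = sum (suc M) (λ k → w k ^ suc r)
    drop : ∀ a x → a - 0ℚ * x ≡ a
    drop = solve-∀ ℚ-ring
    regroup : ∀ a i h u p → a * i * h * (u * p) ≡ h * (a * p) * (i * u)
    regroup = solve-∀ ℚ-ring
    term : ∀ k → tail M k * w k ^ suc r ≡ ½ * w M * (alternating (suc M) k * w k ^ r)
    term k = begin-equality
      alternating (suc M) k * ι (suc k) * (½ * w M) * (w k * w k ^ r)
        ≡⟨ regroup (alternating (suc M) k) (ι (suc k)) (½ * w M) (w k) (w k ^ r) ⟩
      ½ * w M * (alternating (suc M) k * w k ^ r) * (ι (suc k) * w k)
        ≡⟨ cong (½ * w M * (alternating (suc M) k * w k ^ r) *_) (ι*w k) ⟩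
      ½ * w M * (alternating (suc M) k * w k ^ r) * 1ℚ
        ≡⟨ *-identityʳ _ ⟩
      ½ * w M * (alternating (suc M) k * w k ^ r) ∎

  -- This is the partial fraction decomposition of 1/P(x) at x = 0, where P is 1. It extends the
  -- formula for the higher coefficients to the constant one.
  sum-alternating : ∀ M → sum (suc M) (alternating (suc M)) ≡ ½
  sum-alternating M = begin-equality
    sum (suc M) (alternating (suc M))
      ≡⟨ sum-telescope (alternating (suc M)) (tail M) (λ _ → 0ℚ) (tail-step M) M ⟩
    (tail M 0 + ½ * alternating (suc M) 0) - (tail M M - ½ * alternating (suc M) M)
      ≡⟨ cong₂ _-_ (tail-start M) (tail-end M) ⟩
    ½ - 0ℚ ∎

2ℚ : ℚ
2ℚ = ℤ.+ 2 / 1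

-- h N is the coefficient sequence of ∏_{n ≤ N} (1 - x²/n²)⁻¹ = ∑_b (h N b) x²ᵇ,
-- written through its partial fraction decomposition.
h : ℕ → ℕ → ℚ
h N zero    = 1ℚ
h N (suc b) = 2ℚ * sum N (λ k → alternating N k * w k ^ double (suc b))

private
  -- A uniform formula is available only for N > 0: at N = 0 the empty product has constant
  -- coefficient 1, while the sum is empty. Hence the separate clause of `h` at 0.
  h-suc : ∀ M b → h (suc M) b ≡ 2ℚ * sum (suc M) (λ k → alternating (suc M) k * w k ^ double b)
  h-suc M zero    = cong (2ℚ *_) (sym (trans (sum-cong (suc M) (λ k → *-identityʳ (alternating (suc M) k)))
                                            (sum-alternating M)))
  h-suc M (suc b) = refl

sum-halfSum-h : ∀ M b → sum (suc M) (λ k → alternating (suc M) k * halfSum (suc (double b)) k)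
                     ≡ ½ * ½ * (w M * h (suc M) b)
sum-halfSum-h M b = begin-equality
  sum (suc M) (λ k → alternating (suc M) k * halfSum (suc (double b)) k)
    ≡⟨ sum-halfSum M (double b) ⟩
  ½ * w M * A
    ≡⟨ regroup (w M) A ⟩
  ½ * ½ * (w M * (2ℚ * A))
    ≡⟨ cong (λ z → ½ * ½ * (w M * z)) (h-suc M b) ⟨
  ½ * ½ * (w M * h (suc M) b) ∎
  where
  A = sum (suc M) (λ k → alternating (suc M) k * w k ^ double b)
  regroup : ∀ v a → ½ * v * a ≡ ½ * ½ * (v * (2ℚ * a))
  regroup = solve-∀ ℚ-ring

alternating-suc : ∀ N k → alternating (suc N) k * (w k * w k - w N * w N) ≡ alternating N k * (w k * w k)
alternating-suc N k = trans (*-assoc (σ k) _ _)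
  (trans (cong (σ k *_) (ρ-suc-w N k)) (sym (*-assoc (σ k) _ _)))

sum-alternating-suc : ∀ N (f : ℕ → ℚ) → sum (suc N) (λ k → alternating N k * f k) ≡ sum N (λ k → alternating N k * f k)
sum-alternating-suc N f = begin-equality
  A + σ N * ρ N (suc N) * f N  ≡⟨ cong (λ z → A + σ N * z * f N) (ρ-beyond N) ⟩
  A + σ N * 0ℚ * f N           ≡⟨ drop A (σ N) (f N) ⟩
  A                            ∎
  where
  A = sum N (λ k → alternating N k * f k)
  drop : ∀ a s x → a + s * 0ℚ * x ≡ a
  drop = solve-∀ ℚ-ring

-- Coefficients of (1 - c x) f and of ∏_{n ≤ N} (1 - x/n²) f, for f = ∑_a (f a) xᵃ.
factor : ℚ → (ℕ → ℚ) → ℕ → ℚ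
factor c f zero    = f zero
factor c f (suc a) = f (suc a) - c * f a

euler : ℕ → (ℕ → ℚ) → ℕ → ℚ
euler zero    f = f
euler (suc N) f = factor (w N * w N) (euler N f)

δ : ℕ → ℚ
δ zero    = 1ℚ
δ (suc _) = 0ℚ

factor-cong : ∀ c {f g : ℕ → ℚ} → (∀ a → f a ≡ g a) → ∀ a → factor c f a ≡ factor c g a
factor-cong c f≗g zero    = f≗g zero
factor-cong c f≗g (suc a) = cong₂ (λ y z → y - c * z) (f≗g (suc a)) (f≗g a)

factor-linear : ∀ c s f g a → factor c (λ i → f i + s * g i) a ≡ factor c f a + s * factor c g a
factor-linear c s f g zero    = refl
factor-linear c s f g (suc a) = regroup c s (f (suc a)) (g (suc a)) (f a) (g a)
  where
  regroup : ∀ c s p q p′ q′ → p + s * q - c * (p′ + s * q′) ≡ p - c * p′ + s * (q - c * q′)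
  regroup = solve-∀ ℚ-ring

factor-comm : ∀ c d f a → factor c (factor d f) a ≡ factor d (factor c f) a
factor-comm c d f zero          = refl
factor-comm c d f (suc zero)    = swap (f 1) c d (f 0)
  where
  swap : ∀ p c d q → p - d * q - c * q ≡ p - c * q - d * q
  swap = solve-∀ ℚ-ring
factor-comm c d f (suc (suc a)) = swap (f (suc (suc a))) c d (f (suc a)) (f a)
  where
  swap : ∀ p c d q r → p - d * q - c * (q - d * r) ≡ p - c * q - d * (q - c * r)
  swap = solve-∀ ℚ-ring

euler-cong : ∀ N {f g : ℕ → ℚ} → (∀ a → f a ≡ g a) → ∀ a → euler N f a ≡ euler N g a
euler-cong zero    f≗g = f≗g
euler-cong (suc N) f≗g = factor-cong (w N * w N) (euler-cong N f≗g)

euler-linear : ∀ N s f g a → euler N (λ i → f i + s * g i) a ≡ euler N f a + s * euler N g a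
euler-linear zero    s f g a = refl
euler-linear (suc N) s f g a = trans (factor-cong (w N * w N) (euler-linear N s f g) a)
                                     (factor-linear (w N * w N) s (euler N f) (euler N g) a)

euler-factor : ∀ N c f a → euler N (factor c f) a ≡ factor c (euler N f) a
euler-factor zero    c f a = refl
euler-factor (suc N) c f a = trans (factor-cong (w N * w N) (euler-factor N c f) a)
                                   (factor-comm (w N * w N) c (euler N f) a)

-- On the coefficients of a single partial fraction, which are powers of `w k * w k`, the factor
-- acts through the number `w k * w k - w N * w N`; `alternating-suc` absorbs it into the weights
-- and brings them back to level N.
factor-h : ∀ N b → factor (w N * w N) (h (suc N)) b ≡ h N b
factor-h N zero    = refl
factor-h N (suc b) = begin-equality
  2ℚ * sum (suc N) (λ k → A k * w k ^ double (suc b)) - v * v * h (suc N) b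
    ≡⟨ cong (λ z → 2ℚ * S - v * v * z) (h-suc N b) ⟩
  2ℚ * S - v * v * (2ℚ * S′)
    ≡⟨ regroup v S S′ ⟩
  2ℚ * (S - v * v * S′)
    ≡⟨ cong (λ z → 2ℚ * (S - z)) (sum-*ˡ (suc N) (v * v) (λ k → A k * w k ^ double b)) ⟨
  2ℚ * (S - sum (suc N) (λ k → v * v * (A k * w k ^ double b)))
    ≡⟨ cong (2ℚ *_) (sum-- (suc N) (λ k → A k * w k ^ double (suc b)) (λ k → v * v * (A k * w k ^ double b))) ⟨
  2ℚ * sum (suc N) (λ k → A k * w k ^ double (suc b) - v * v * (A k * w k ^ double b))
    ≡⟨ cong (2ℚ *_) (sum-cong (suc N) term) ⟩
  2ℚ * sum (suc N) (λ k → alternating N k * w k ^ double (suc b))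
    ≡⟨ cong (2ℚ *_) (sum-alternating-suc N (λ k → w k ^ double (suc b))) ⟩
  h N (suc b) ∎
  where
  v = w N
  A = alternating (suc N)
  S = sum (suc N) (λ k → A k * w k ^ double (suc b))
  S′ = sum (suc N) (λ k → A k * w k ^ double b)
  regroup : ∀ v s s′ → 2ℚ * s - v * v * (2ℚ * s′) ≡ 2ℚ * (s - v * v * s′)
  regroup = solve-∀ ℚ-ring
  gather : ∀ a u v p → a * (u * (u * p)) - v * v * (a * p) ≡ a * (u * u - v * v) * p
  gather = solve-∀ ℚ-ring
  spread : ∀ a u p → a * (u * u) * p ≡ a * (u * (u * p))
  spread = solve-∀ ℚ-ring
  term : ∀ k → A k * w k ^ double (suc b) - v * v * (A k * w k ^ double b) ≡ alternating N k * w k ^ double (suc b)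
  term k = trans (gather (A k) (w k) v (w k ^ double b))
          (trans (cong (_* w k ^ double b) (alternating-suc N k)) (spread (alternating N k) (w k) (w k ^ double b)))

euler-h : ∀ N b → euler N (h N) b ≡ δ b
euler-h zero    zero    = refl
euler-h zero    (suc b) = refl
euler-h (suc N) b = begin-equality
  factor (w N * w N) (euler N (h (suc N))) b  ≡⟨ euler-factor N (w N * w N) (h (suc N)) b ⟨
  euler N (factor (w N * w N) (h (suc N))) b  ≡⟨ euler-cong N (factor-h N) b ⟩
  euler N (h N) b                             ≡⟨ euler-h N b ⟩
  δ b                                         ∎

-- Coefficient of x²ᶜ y²ᵈ in ∑_{j ≤ n ≤ N} (-1)ⁿ⁻¹ (ρ N n) / (n² - x²) · j / (j² - y²), terms with
-- j = n counting one half.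
weightedSum : ℕ → ℕ → ℕ → ℚ
weightedSum N c d = sum N (λ k → alternating N k * w k ^ double (suc c) * halfSum (suc (double d)) k)

4ℚ : ℚ
4ℚ = ℤ.+ 4 / 1

-- For c > 0 the factor changes the level of the weights as in `factor-h`. For c = 0 there is no
-- lower coefficient to subtract, so `w N * w N` times the sum of
-- `alternating (suc N) k * halfSum _ k` is left over. `sum-halfSum-h` evaluates it, supplying the
-- third factor `w N`; the constant 4 is chosen to cancel its `½ * ½`.
factor-weightedSum : ∀ N d c → factor (w N * w N) (λ i → 4ℚ * weightedSum (suc N) i d) c
  ≡ 4ℚ * weightedSum N c d + w N * w N * w N * h (suc N) d * δ c
factor-weightedSum N d zero = begin-equality
  4ℚ * sum (suc N) (λ k → A k * (w k * (w k * 1ℚ)) * S k)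
    ≡⟨ cong (4ℚ *_) (sum-cong (suc N) (λ k → split (A k) (w k) v (S k))) ⟩
  4ℚ * sum (suc N) (λ k → A k * (w k * w k - v * v) * S k + v * v * (A k * S k))
    ≡⟨ cong (4ℚ *_) (sum-cong (suc N) (λ k →
         cong (λ z → z * S k + v * v * (A k * S k)) (alternating-suc N k))) ⟩
  4ℚ * sum (suc N) (λ k → alternating N k * (w k * w k) * S k + v * v * (A k * S k))
    ≡⟨ cong (4ℚ *_) (sum-+ (suc N) (λ k → alternating N k * (w k * w k) * S k) (λ k → v * v * (A k * S k))) ⟩
  4ℚ * (sum (suc N) (λ k → alternating N k * (w k * w k) * S k) + sum (suc N) (λ k → v * v * (A k * S k)))
    ≡⟨ cong₂ (λ y z → 4ℚ * (y + z))
         (trans (sum-cong (suc N) (λ k → reassoc (alternating N k) (w k) (S k)))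
                (sum-alternating-suc N (λ k → (w k * (w k * 1ℚ)) * S k)))
         (sum-*ˡ (suc N) (v * v) (λ k → A k * S k)) ⟩
  4ℚ * (sum N (λ k → alternating N k * ((w k * (w k * 1ℚ)) * S k)) + v * v * sum (suc N) (λ k → A k * S k))
    ≡⟨ cong₂ (λ y z → 4ℚ * (y + v * v * z))
         (sum-cong N (λ k → sym (*-assoc (alternating N k) (w k * (w k * 1ℚ)) (S k))))
         (sum-halfSum-h N d) ⟩
  4ℚ * (weightedSum N 0 d + v * v * (½ * ½ * (v * H′)))
    ≡⟨ finish (weightedSum N 0 d) v H′ ⟩
  4ℚ * weightedSum N 0 d + v * v * v * H′ * 1ℚ ∎
  where
  v = w N
  A = alternating (suc N)
  S = halfSum (suc (double d))
  H′ = h (suc N) d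
  split : ∀ a u v s → a * (u * (u * 1ℚ)) * s ≡ a * (u * u - v * v) * s + v * v * (a * s)
  split = solve-∀ ℚ-ring
  reassoc : ∀ a u s → a * (u * u) * s ≡ a * ((u * (u * 1ℚ)) * s)
  reassoc = solve-∀ ℚ-ring
  finish : ∀ x v y → 4ℚ * (x + v * v * (½ * ½ * (v * y))) ≡ 4ℚ * x + v * v * v * y * 1ℚ
  finish = solve-∀ ℚ-ring
factor-weightedSum N d (suc c) = begin-equality
  4ℚ * sum (suc N) (λ k → A k * w k ^ double (suc (suc c)) * S k) - v * v * (4ℚ * X)
    ≡⟨ regroup v Y X ⟩
  4ℚ * (Y - v * v * X)
    ≡⟨ cong (λ z → 4ℚ * (Y - z)) (sum-*ˡ (suc N) (v * v) (λ k → A k * w k ^ double (suc c) * S k)) ⟨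
  4ℚ * (Y - sum (suc N) (λ k → v * v * (A k * w k ^ double (suc c) * S k)))
    ≡⟨ cong (4ℚ *_) (sum-- (suc N) (λ k → A k * w k ^ double (suc (suc c)) * S k)
                                   (λ k → v * v * (A k * w k ^ double (suc c) * S k))) ⟨
  4ℚ * sum (suc N) (λ k → A k * w k ^ double (suc (suc c)) * S k - v * v * (A k * w k ^ double (suc c) * S k))
    ≡⟨ cong (4ℚ *_) (sum-cong (suc N) term) ⟩
  4ℚ * sum (suc N) (λ k → alternating N k * (w k ^ double (suc (suc c)) * S k))
    ≡⟨ cong (4ℚ *_) (sum-alternating-suc N (λ k → w k ^ double (suc (suc c)) * S k)) ⟩
  4ℚ * sum N (λ k → alternating N k * (w k ^ double (suc (suc c)) * S k))
    ≡⟨ cong (4ℚ *_) (sum-cong N (λ k → *-assoc (alternating N k) (w k ^ double (suc (suc c))) (S k))) ⟨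
  4ℚ * weightedSum N (suc c) d
    ≡⟨ add-zero (4ℚ * weightedSum N (suc c) d) (v * v * v * h (suc N) d) ⟩
  4ℚ * weightedSum N (suc c) d + v * v * v * h (suc N) d * 0ℚ ∎
  where
  v = w N
  A = alternating (suc N)
  S = halfSum (suc (double d))
  X = weightedSum (suc N) c d
  Y = weightedSum (suc N) (suc c) d
  regroup : ∀ v y x → 4ℚ * y - v * v * (4ℚ * x) ≡ 4ℚ * (y - v * v * x)
  regroup = solve-∀ ℚ-ring
  gather : ∀ a u v p s → a * (u * (u * p)) * s - v * v * (a * p * s) ≡ a * (u * u - v * v) * (p * s)
  gather = solve-∀ ℚ-ring
  spread : ∀ a u p s → a * (u * u) * (p * s) ≡ a * (u * (u * p) * s)
  spread = solve-∀ ℚ-ring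
  add-zero : ∀ x y → x ≡ x + y * 0ℚ
  add-zero = solve-∀ ℚ-ring
  term : ∀ k → A k * w k ^ double (suc (suc c)) * S k - v * v * (A k * w k ^ double (suc c) * S k)
             ≡ alternating N k * (w k ^ double (suc (suc c)) * S k)
  term k = trans (gather (A k) (w k) v (w k ^ double (suc c)) (S k))
          (trans (cong (_* (w k ^ double (suc c) * S k)) (alternating-suc N k))
                 (spread (alternating N k) (w k) (w k ^ double (suc c)) (S k)))

-- The new factor in x lowers the weights to level N at the cost of 1/(N + 1)³ times the
-- coefficients `h (suc N) d` in y. The outer product turns these into `δ b` by `euler-h`, while the
-- new factor in y remains as `factor`. This is the shape of the recursion that splits off the
-- largest summation variable when it equals N + 1.
twice-euler-suc : ∀ N a b →
  euler (suc N) (λ d → euler (suc N) (λ c → 4ℚ * weightedSum (suc N) c d) a) b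
    ≡ factor (w N * w N) (euler N (λ d → euler N (λ c → 4ℚ * weightedSum N c d) a)) b
      + w N * w N * w N * euler N δ a * δ b
twice-euler-suc N a b = begin-equality
  euler (suc N) (λ d → euler (suc N) (λ c → 4ℚ * weightedSum (suc N) c d) a) b
    ≡⟨ euler-cong (suc N) inner b ⟩
  euler (suc N) (λ d → K d + v³ * e * h (suc N) d) b
    ≡⟨ euler-linear (suc N) (v³ * e) K (h (suc N)) b ⟩
  euler (suc N) K b + v³ * e * euler (suc N) (h (suc N)) b
    ≡⟨ cong (λ z → euler (suc N) K b + v³ * e * z) (euler-h (suc N) b) ⟩
  euler (suc N) K b + v³ * e * δ b ∎
  where
  K : ℕ → ℚ
  K d = euler N (λ c → 4ℚ * weightedSum N c d) a
  v³ = w N * w N * w N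
  e = euler N δ a
  swap : ∀ k v h e → k + v * h * e ≡ k + v * e * h
  swap = solve-∀ ℚ-ring
  inner : ∀ d → euler (suc N) (λ c → 4ℚ * weightedSum (suc N) c d) a ≡ K d + v³ * e * h (suc N) d
  inner d = begin-equality
    euler (suc N) (λ c → 4ℚ * weightedSum (suc N) c d) a
      ≡⟨ euler-factor N (w N * w N) (λ c → 4ℚ * weightedSum (suc N) c d) a ⟨
    euler N (factor (w N * w N) (λ c → 4ℚ * weightedSum (suc N) c d)) a
      ≡⟨ euler-cong N (factor-weightedSum N d) a ⟩
    euler N (λ c → 4ℚ * weightedSum N c d + v³ * h (suc N) d * δ c) a
      ≡⟨ euler-linear N (v³ * h (suc N) d) (λ c → 4ℚ * weightedSum N c d) δ a ⟩
    K d + v³ * h (suc N) d * e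
      ≡⟨ swap (K d) v³ (h (suc N) d) e ⟩
    K d + v³ * e * h (suc N) d ∎

-- Identification with the truncated nested sums

recip-mul : ∀ d e .{{_ : ℕ.NonZero d}} .{{_ : ℕ.NonZero e}} .{{_ : ℕ.NonZero (d ℕ.* e)}} →
  ℤ.+ 1 / (d ℕ.* e) ≡ (ℤ.+ 1 / d) * (ℤ.+ 1 / e)
recip-mul (suc d) (suc e) = recip-* d e

recipPow≡ : ∀ n k → recipPow (suc n) k ≡ w n ^ k
recipPow≡ n zero    = refl
recipPow≡ n (suc k) = trans
  (recip-mul (suc n) (suc n ℕ.^ k) {{_}} {{ℕₚ.m^n≢0 (suc n) k}} {{ℕₚ.m^n≢0 (suc n) (suc k)}})
  (cong (w n *_) (recipPow≡ n k))

∑ℚ≡sum : ∀ N (f : (k : ℕ) → .{{ℕ.NonZero k}} → ℚ) → ∑ℚ N f ≡ sum N (λ k → f (suc k))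
∑ℚ≡sum zero    f = refl
∑ℚ≡sum (suc N) f = cong (_+ f (suc N)) (∑ℚ≡sum N f)

nestedSum-∷ : ∀ k ks N → nestedSum (k ∷ ks) N ≡ sum N (λ n → w n ^ k * nestedSum ks n)
nestedSum-∷ k ks N = trans (∑ℚ≡sum N _) (sum-cong N (λ n → cong (_* nestedSum ks n) (recipPow≡ n k)))

nestedSum-single : ∀ k N → nestedSum (k ∷ []) N ≡ sum N (λ n → w n ^ k)
nestedSum-single k N = trans (nestedSum-∷ k [] N) (sum-cong N (λ n → *-identityʳ (w n ^ k)))

-- The coefficients of P itself are, up to sign, the elementary symmetric functions of the numbers
-- 1/n² with n ≤ N.
euler-δ : ∀ N a → euler N δ a ≡ σ a * nestedSum (replicate a 2) N
euler-δ zero    zero    = refl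
euler-δ zero    (suc a) = sym (*-zeroʳ (σ (suc a)))
euler-δ (suc N) zero    = euler-δ N zero
euler-δ (suc N) (suc a) = begin-equality
  euler N δ (suc a) - w N * w N * euler N δ a
    ≡⟨ cong₂ (λ y z → y - w N * w N * z) (euler-δ N (suc a)) (euler-δ N a) ⟩
  - σ a * X - w N * w N * (σ a * Y)
    ≡⟨ regroup (σ a) X (w N) Y ⟩
  - σ a * (X + w N * (w N * 1ℚ) * Y)
    ≡⟨ cong (λ z → - σ a * (X + z * Y)) (recipPow≡ N 2) ⟨
  - σ a * (X + recipPow (suc N) 2 * Y) ∎
  where
  X = nestedSum (replicate (suc a) 2) N
  Y = nestedSum (replicate a 2) N
  regroup : ∀ s x v y → - s * x - v * v * (s * y) ≡ - s * (x + v * (v * 1ℚ) * y)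
  regroup = solve-∀ ℚ-ring

private
  twos-3-twos : ℕ → ℕ → List ℕ
  twos-3-twos a b = replicate b 2 ++ 3 ∷ replicate a 2

  nestedSum-at-0 : ∀ a b → nestedSum (twos-3-twos a b) 0 ≡ 0ℚ
  nestedSum-at-0 a zero    = refl
  nestedSum-at-0 a (suc b) = refl

-- The exponent of the largest variable stands first in the list, so peeling off n = N + 1 acts on
-- `b`, and the exponent 3 is reached exactly when b = 0. This is the summand with `δ b` in
-- `twice-euler-suc`; what then remains is `replicate a 2`, given by `euler-δ`.
nestedSum-twos-3-twos : ∀ N a b →
  euler N (λ d → euler N (λ c → 4ℚ * weightedSum N c d) a) b
    ≡ σ a * σ b * nestedSum (replicate b 2 ++ 3 ∷ replicate a 2) N
nestedSum-twos-3-twos zero    a b = sym (trans (cong (σ a * σ b *_) (nestedSum-at-0 a b)) (*-zeroʳ (σ a * σ b)))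
nestedSum-twos-3-twos (suc N) a zero = begin-equality
  euler (suc N) (λ d → euler (suc N) (λ c → 4ℚ * weightedSum (suc N) c d) a) zero
    ≡⟨ twice-euler-suc N a zero ⟩
  euler N (λ d → euler N (λ c → 4ℚ * weightedSum N c d) a) zero + v * v * v * euler N δ a * 1ℚ
    ≡⟨ cong₂ (λ y z → y + v * v * v * z * 1ℚ) (nestedSum-twos-3-twos N a zero) (euler-δ N a) ⟩
  σ a * 1ℚ * X + v * v * v * (σ a * Y) * 1ℚ
    ≡⟨ regroup (σ a) X v Y ⟩
  σ a * 1ℚ * (X + v * (v * (v * 1ℚ)) * Y)
    ≡⟨ cong (λ z → σ a * 1ℚ * (X + z * Y)) (recipPow≡ N 3) ⟨
  σ a * 1ℚ * (X + recipPow (suc N) 3 * Y) ∎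
  where
  v = w N
  X = nestedSum (twos-3-twos a zero) N
  Y = nestedSum (replicate a 2) N
  regroup : ∀ s x v y → s * 1ℚ * x + v * v * v * (s * y) * 1ℚ ≡ s * 1ℚ * (x + v * (v * (v * 1ℚ)) * y)
  regroup = solve-∀ ℚ-ring
nestedSum-twos-3-twos (suc N) a (suc b) = begin-equality
  euler (suc N) (λ d → euler (suc N) (λ c → 4ℚ * weightedSum (suc N) c d) a) (suc b)
    ≡⟨ twice-euler-suc N a (suc b) ⟩
  euler N (λ d → euler N (λ c → 4ℚ * weightedSum N c d) a) (suc b)
    - v * v * euler N (λ d → euler N (λ c → 4ℚ * weightedSum N c d) a) b + v * v * v * euler N δ a * 0ℚ
    ≡⟨ cong₂ (λ y z → y - v * v * z + v * v * v * euler N δ a * 0ℚ)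
         (nestedSum-twos-3-twos N a (suc b)) (nestedSum-twos-3-twos N a b) ⟩
  σ a * - σ b * X - v * v * (σ a * σ b * Y) + v * v * v * euler N δ a * 0ℚ
    ≡⟨ regroup (σ a) (σ b) X v Y (euler N δ a) ⟩
  σ a * - σ b * (X + v * (v * 1ℚ) * Y)
    ≡⟨ cong (λ z → σ a * - σ b * (X + z * Y)) (recipPow≡ N 2) ⟨
  σ a * - σ b * (X + recipPow (suc N) 2 * Y) ∎
  where
  v = w N
  X = nestedSum (twos-3-twos a (suc b)) N
  Y = nestedSum (twos-3-twos a b) N
  regroup : ∀ s t x v y e → s * - t * x - v * v * (s * t * y) + v * v * v * e * 0ℚ
                          ≡ s * - t * (x + v * (v * 1ℚ) * y)
  regroup = solve-∀ ℚ-ring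

-- Multiplication by P as a convolution

factor-antidiagonal : ∀ c (g f : ℕ → ℚ) a → factor c (antidiagonal (λ i j → g i * f j)) a
                                ≡ antidiagonal (λ i j → factor c g i * f j) a
factor-antidiagonal c g f zero    = refl
factor-antidiagonal c g f (suc a) = begin-equality
  g 0 * f (suc a) + X - c * Y
    ≡⟨ +-assoc (g 0 * f (suc a)) X (- (c * Y)) ⟩
  g 0 * f (suc a) + (X - c * Y)
    ≡⟨ cong (λ z → g 0 * f (suc a) + (X - z)) (antidiagonal-*ˡ a c (λ i j → g i * f j)) ⟨
  g 0 * f (suc a) + (X - antidiagonal (λ i j → c * (g i * f j)) a)
    ≡⟨ cong (λ z → g 0 * f (suc a) + z) (antidiagonal-- a (λ i j → g (suc i) * f j) (λ i j → c * (g i * f j))) ⟨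
  g 0 * f (suc a) + antidiagonal (λ i j → g (suc i) * f j - c * (g i * f j)) a
    ≡⟨ cong (λ z → g 0 * f (suc a) + z) (antidiagonal-cong a (λ i j → regroup (g (suc i)) (f j) c (g i))) ⟩
  g 0 * f (suc a) + antidiagonal (λ i j → (g (suc i) - c * g i) * f j) a ∎
  where
  X = antidiagonal (λ i j → g (suc i) * f j) a
  Y = antidiagonal (λ i j → g i * f j) a
  regroup : ∀ p q c r → p * q - c * (r * q) ≡ (p - c * r) * q
  regroup = solve-∀ ℚ-ring

euler-antidiagonal : ∀ N (g f : ℕ → ℚ) a → euler N (antidiagonal (λ i j → g i * f j)) a
                               ≡ antidiagonal (λ i j → euler N g i * f j) a
euler-antidiagonal zero    g f a = refl
euler-antidiagonal (suc N) g f a = trans (factor-cong (w N * w N) (euler-antidiagonal N g f) a)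
                                         (factor-antidiagonal (w N * w N) (euler N g) f a)

antidiagonal-δ : ∀ (f : ℕ → ℚ) a → antidiagonal (λ i j → δ i * f j) a ≡ f a
antidiagonal-δ f zero    = *-identityˡ (f 0)
antidiagonal-δ f (suc a) = begin-equality
  1ℚ * f (suc a) + antidiagonal (λ i j → 0ℚ * f j) a
    ≡⟨ cong (λ z → 1ℚ * f (suc a) + z) (antidiagonal-*ˡ a 0ℚ (λ i j → f j)) ⟩
  1ℚ * f (suc a) + 0ℚ * antidiagonal (λ i j → f j) a
    ≡⟨ simplify (f (suc a)) (antidiagonal (λ i j → f j) a) ⟩
  f (suc a) ∎
  where
  simplify : ∀ p q → 1ℚ * p + 0ℚ * q ≡ p
  simplify = solve-∀ ℚ-ring

euler-convolution : ∀ N (f : ℕ → ℚ) a → euler N f a ≡ antidiagonal (λ i j → euler N δ i * f j) a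
euler-convolution N f a = begin-equality
  euler N f a                                         ≡⟨ euler-cong N (λ i → sym (antidiagonal-δ f i)) a ⟩
  euler N (antidiagonal (λ i j → δ i * f j)) a        ≡⟨ euler-antidiagonal N δ f a ⟩
  antidiagonal (λ i j → euler N δ i * f j) a          ∎

euler-h-convolution : ∀ N (f : ℕ → ℚ) a → euler N (antidiagonal (λ i j → h N i * f j)) a ≡ f a
euler-h-convolution N f a = begin-equality
  euler N (antidiagonal (λ i j → h N i * f j)) a  ≡⟨ euler-antidiagonal N (h N) f a ⟩
  antidiagonal (λ i j → euler N (h N) i * f j) a  ≡⟨ antidiagonal-cong a (λ i j → cong (_* f j) (euler-h N i)) ⟩
  antidiagonal (λ i j → δ i * f j) a              ≡⟨ antidiagonal-δ f a ⟩
  f a                                             ∎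

-- Passing from the weights ρ to 1

sum-null : ∀ K {v : ℕ → ℕ → ℚ} → (∀ k → Null (λ N → v N k)) → Null (λ N → sum K (v N))
sum-null zero    v-null = null-0
sum-null (suc K) v-null = null-+ (sum-null K v-null) (v-null K)

cauchy-cong : ∀ {f g : ℕ → ℚ} → (∀ n → f n ≡ g n) → IsCauchy f → IsCauchy g
cauchy-cong f≗g f-cauchy ε 0<ε =
  let N , close = f-cauchy ε 0<ε in N , λ m n N≤m N≤n →
    recast-< (cong₂ (λ y z → ∣ y - z ∣) (f≗g m) (f≗g n)) (close m n N≤m N≤n)

-- Tannery's theorem. Beyond a fixed K the dominating series contributes less than ε/2 whatever N
-- is; the first K terms form a finite sum of null sequences.
dominated-convergence : ∀ {v : ℕ → ℕ → ℚ} {b : ℕ → ℚ} → IsCauchy (λ N → sum N b) →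
  (∀ N k → k ℕ.< N → ∣ v N k ∣ ≤ b k) → (∀ k → Null (λ N → v N k)) → Null (λ N → sum N (v N))
dominated-convergence {v} {b} b-cauchy v≤b v-null = mkNull λ ε 0<ε →
  let K , b-close = b-cauchy (½ * ε) (0<* 0<½ 0<ε)
      M , v-small = small (sum-null K v-null) (½ * ε) (0<* 0<½ 0<ε)
  in K ℕ.⊔ M , λ N K⊔M≤N →
    let K≤N = ℕₚ.m⊔n≤o⇒m≤o K M K⊔M≤N
    in bound-at ε K N K≤N (v-small N (ℕₚ.m⊔n≤o⇒n≤o K M K⊔M≤N)) (b-close N K K≤N ℕₚ.≤-refl)
  where
  cancel : ∀ a b → b ≡ (a + b) - a
  cancel = solve-∀ ℚ-ring
  bound-at : ∀ ε K N → K ℕ.≤ N → ∣ sum K (v N) ∣ < ½ * ε → ∣ sum N b - sum K b ∣ < ½ * ε → ∣ sum N (v N) ∣ < ε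
  bound-at ε K N K≤N head<ε/2 tail<ε/2 = begin-strict
    ∣ sum N (v N) ∣
      ≡⟨ cong (λ n → ∣ sum n (v N) ∣) (ℕₚ.m∸n+n≡m K≤N) ⟨
    ∣ sum (i ℕ.+ K) (v N) ∣
      ≡⟨ cong ∣_∣ (sum-++ K i (v N)) ⟩
    ∣ sum K (v N) + sum i (λ j → v N (j ℕ.+ K)) ∣
      ≤⟨ ∣p+q∣≤∣p∣+∣q∣ (sum K (v N)) (sum i (λ j → v N (j ℕ.+ K))) ⟩
    ∣ sum K (v N) ∣ + ∣ sum i (λ j → v N (j ℕ.+ K)) ∣
      ≤⟨ +-monoʳ-≤ ∣ sum K (v N) ∣ (∣sum∣≤-bound i (λ j j<i →
           v≤b N (j ℕ.+ K) (subst (j ℕ.+ K ℕ.<_) (ℕₚ.m∸n+n≡m K≤N) (ℕₚ.+-monoˡ-< K j<i)))) ⟩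
    ∣ sum K (v N) ∣ + sum i (λ j → b (j ℕ.+ K))
      ≡⟨ cong (λ z → ∣ sum K (v N) ∣ + z) (cancel (sum K b) (sum i (λ j → b (j ℕ.+ K)))) ⟩
    ∣ sum K (v N) ∣ + (sum K b + sum i (λ j → b (j ℕ.+ K)) - sum K b)
      ≡⟨ cong (λ z → ∣ sum K (v N) ∣ + (z - sum K b)) (sum-++ K i b) ⟨
    ∣ sum K (v N) ∣ + (sum (i ℕ.+ K) b - sum K b)
      ≡⟨ cong (λ n → ∣ sum K (v N) ∣ + (sum n b - sum K b)) (ℕₚ.m∸n+n≡m K≤N) ⟩
    ∣ sum K (v N) ∣ + (sum N b - sum K b)
      ≤⟨ +-monoʳ-≤ ∣ sum K (v N) ∣ (p≤∣p∣ (sum N b - sum K b)) ⟩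
    ∣ sum K (v N) ∣ + ∣ sum N b - sum K b ∣
      <⟨ +-mono-< head<ε/2 tail<ε/2 ⟩
    ½ * ε + ½ * ε
      ≡⟨ half+half ε ⟩
    ε ∎
    where
    i = N ℕ.∸ K
    p≤∣p∣ : ∀ p → p ≤ ∣ p ∣
    p≤∣p∣ p with ≤-total 0ℚ p
    ... | inj₁ 0≤p = ≤-reflexive (sym (0≤p⇒∣p∣≡p 0≤p))
    ... | inj₂ p≤0 = ≤-trans p≤0 (0≤∣p∣ p)

w≤1 : ∀ n → w n ≤ 1ℚ
w≤1 n = recip-anti 1 (suc n) (s≤s z≤n)

w-anti : ∀ {m n} → m ℕ.≤ n → w n ≤ w m
w-anti {m} {n} m≤n = recip-anti (suc m) (suc n) (s≤s m≤n)

w^-nonNeg : ∀ n k → 0ℚ ≤ w n ^ k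
w^-nonNeg n zero    = <⇒≤ (positive⁻¹ 1ℚ)
w^-nonNeg n (suc k) = 0≤* (w-nonNeg n) (w^-nonNeg n k)

w^≤1 : ∀ n k → w n ^ k ≤ 1ℚ
w^≤1 n zero    = ≤-refl
w^≤1 n (suc k) = ≤-trans (*-monoˡ (w n) (w-nonNeg n) (w^≤1 n k)) (recast-≤ (w≤1 n) (sym (*-identityʳ (w n))) refl)

∣σ∣ : ∀ k → ∣ σ k ∣ ≡ 1ℚ
∣σ∣ zero    = refl
∣σ∣ (suc k) = trans (∣-p∣≡∣p∣ (σ k)) (∣σ∣ k)

∣σ*∣ : ∀ k p → ∣ σ k * p ∣ ≡ ∣ p ∣
∣σ*∣ k p = trans (∣p*q∣≡∣p∣*∣q∣ (σ k) p) (trans (cong (_* ∣ p ∣) (∣σ∣ k)) (*-identityˡ ∣ p ∣))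

w-null′ : ∀ j → Null (λ N → w (j ℕ.+ N))
w-null′ j = null-≤ (λ N → recast-≤ (w-anti (ℕₚ.m≤n+m N j)) (sym (0≤p⇒∣p∣≡p (w-nonNeg (j ℕ.+ N)))) refl)
  (mkNull λ ε 0<ε → let N , w<ε = w-null 0<ε in N , λ n N≤n → recast-< (sym (0≤p⇒∣p∣≡p (w-nonNeg n))) (w<ε n N≤n))

ρ-factor : ∀ N j → (ι N - ι j) * w (j ℕ.+ N) ≡ 1ℚ - (ι j + ι (suc j)) * w (j ℕ.+ N)
ρ-factor N j = trans (split (ι N) (ι j) (ι (suc j)) v)
  (cong (λ z → z - (ι j + ι (suc j)) * v) (trans (cong (_* v) (sym (ι-+ (suc j) N))) (ι*w (j ℕ.+ N))))
  where
  v = w (j ℕ.+ N)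
  split : ∀ n a b v → (n - a) * v ≡ (b + n) * v - (a + b) * v
  split = solve-∀ ℚ-ring

ρ~1 : ∀ j → (λ N → ρ N j) ~ (λ _ → 1ℚ)
ρ~1 zero    = ~-refl
ρ~1 (suc j) = ~-trans (~-* (bounded-~ (ρ~1 j)) (bounded-const 1ℚ) (ρ~1 j) factor~1) ~-refl
  where
  bounded-~ : ∀ {f} → f ~ (λ _ → 1ℚ) → Bounded f
  bounded-~ {f} (mk~ f-1) = mkBounded (let N , <1 = small f-1 1ℚ (positive⁻¹ 1ℚ) in
    N , 1ℚ + 1ℚ , positive⁻¹ (1ℚ + 1ℚ) , λ n N≤n →
      ≤-trans (recast-≤ (∣p+q∣≤∣p∣+∣q∣ (f n - 1ℚ) 1ℚ) (cong ∣_∣ (cancel (f n))) refl)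
              (+-monoˡ-≤ 1ℚ (<⇒≤ (<1 n N≤n))))
    where
    cancel : ∀ p → p - 1ℚ + 1ℚ ≡ p
    cancel = solve-∀ ℚ-ring
  rewrite-diff : ∀ a v → - a * v ≡ 1ℚ - a * v - 1ℚ
  rewrite-diff = solve-∀ ℚ-ring
  factor~1 : (λ N → (ι N - ι j) * w (j ℕ.+ N)) ~ (λ _ → 1ℚ)
  factor~1 = mk~ (null-cong (λ N → trans (rewrite-diff (ι j + ι (suc j)) (w (j ℕ.+ N)))
                                         (cong (_- 1ℚ) (sym (ρ-factor N j))))
                            (const*null (- (ι j + ι (suc j))) (w-null′ j)))

ρ-range : ∀ N j → j ℕ.≤ N → 0ℚ ≤ ρ N j × ρ N j ≤ 1ℚ
ρ-range N zero    _    = <⇒≤ (positive⁻¹ 1ℚ) , ≤-refl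
ρ-range N (suc j) j<N =
  let 0≤ρ , ρ≤1 = ρ-range N j (ℕₚ.<⇒≤ j<N)
  in 0≤* 0≤ρ 0≤factor , ≤-trans (*-monoˡ (ρ N j) 0≤ρ factor≤1) (recast-≤ ρ≤1 (sym (*-identityʳ (ρ N j))) refl)
  where
  v = w (j ℕ.+ N)
  0≤factor : 0ℚ ≤ (ι N - ι j) * v
  0≤factor = 0≤* (recast-≤ (+-monoˡ-≤ (- ι j) (ι-mono (ℕₚ.<⇒≤ j<N))) (+-inverseʳ (ι j)) refl) (w-nonNeg (j ℕ.+ N))
  factor≤1 : (ι N - ι j) * v ≤ 1ℚ
  factor≤1 = recast-≤ (+-monoʳ-≤ 1ℚ (neg-antimono-≤ (0≤* (0≤+ (ι-nonNeg j) (ι-nonNeg (suc j))) (w-nonNeg (j ℕ.+ N)))))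
                      (sym (ρ-factor N j)) refl

sum-ρ~ : ∀ (a b : ℕ → ℚ) → IsCauchy (λ N → sum N b) → (∀ k → ∣ a k ∣ ≤ b k) →
  (λ N → sum N (λ k → ρ N (suc k) * a k)) ~ (λ N → sum N a)
sum-ρ~ a b b-cauchy a≤b = mk~ (null-cong
  (λ N → trans (sum-cong N (λ k → expand (ρ N (suc k)) (a k))) (sum-- N (λ k → ρ N (suc k) * a k) a))
  (dominated-convergence b-cauchy dominated pointwise))
  where
  expand : ∀ r x → x * (r - 1ℚ) ≡ r * x - x
  expand = solve-∀ ℚ-ring
  pointwise : ∀ k → Null (λ N → a k * (ρ N (suc k) - 1ℚ))
  pointwise k = const*null (a k) (diff-null (ρ~1 (suc k)))
  dominated : ∀ N k → k ℕ.< N → ∣ a k * (ρ N (suc k) - 1ℚ) ∣ ≤ b k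
  dominated N k k<N = begin
    ∣ a k * (r - 1ℚ) ∣      ≡⟨ ∣p*q∣≡∣p∣*∣q∣ (a k) (r - 1ℚ) ⟩
    ∣ a k ∣ * ∣ r - 1ℚ ∣    ≡⟨ cong (∣ a k ∣ *_) (∣p-q∣≡∣q-p∣ r 1ℚ) ⟩
    ∣ a k ∣ * ∣ 1ℚ - r ∣    ≡⟨ cong (∣ a k ∣ *_) (0≤p⇒∣p∣≡p (recast-≤ (+-monoˡ-≤ (- r) ρ≤1) (+-inverseʳ r) refl)) ⟩
    ∣ a k ∣ * (1ℚ - r)      ≤⟨ *-monoˡ ∣ a k ∣ (0≤∣p∣ (a k)) (+-monoʳ-≤ 1ℚ (neg-antimono-≤ 0≤ρ)) ⟩
    ∣ a k ∣ * 1ℚ            ≡⟨ *-identityʳ ∣ a k ∣ ⟩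
    ∣ a k ∣                 ≤⟨ a≤b k ⟩
    b k                     ∎
    where
    r = ρ N (suc k)
    0≤ρ = proj₁ (ρ-range N (suc k) k<N)
    ρ≤1 = proj₂ (ρ-range N (suc k) k<N)

zetaSum : ℕ → ℕ → ℚ
zetaSum s N = sum N (λ k → w k ^ s)

etaSum : ℕ → ℕ → ℚ
etaSum s N = sum N (λ k → σ k * w k ^ s)

zetaSum-cauchy : ∀ {s} → 1 ℕ.< s → IsCauchy (zetaSum s)
zetaSum-cauchy {s} 1<s = cauchy-cong (nestedSum-single s) (nestedSum-cauchy 1<s [])

-- This is `h` with ρ replaced by 1, so its limits are the coefficients of πx / sin(πx). The value
-- at 0 is set to 1 as in `h`, since the partial sums `etaSum 0` oscillate.
τ : ℕ → ℕ → ℚ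
τ N zero    = 1ℚ
τ N (suc b) = 2ℚ * etaSum (double (suc b)) N

h~τ : ∀ b → (λ N → h N b) ~ (λ N → τ N b)
h~τ zero    = ~-refl
h~τ (suc b) = ~-const* 2ℚ (~-trans
  (≗⇒~ (λ N → sum-cong N (λ k → swap (σ k) (ρ N (suc k)) (w k ^ s))))
  (sum-ρ~ (λ k → σ k * w k ^ s) (λ k → w k ^ s) (zetaSum-cauchy {s} (s≤s (s≤s z≤n)))
          (λ k → ≤-reflexive (trans (∣σ*∣ k (w k ^ s)) (0≤p⇒∣p∣≡p (w^-nonNeg k s))))))
  where
  s = double (suc b)
  swap : ∀ p r x → p * r * x ≡ r * (p * x)
  swap = solve-∀ ℚ-ring

plainSum : ℕ → ℕ → ℕ → ℚ
plainSum N c d = sum N (λ k → σ k * (w k ^ double (suc c) * halfSum (suc (double d)) k))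

-- The dominating series is a double zeta series with outer exponent s plus ζ(s). It converges
-- because s ≥ 2, also when the inner exponent r is 1.
weightedSum~plainSum : ∀ c d → (λ N → weightedSum N c d) ~ (λ N → plainSum N c d)
weightedSum~plainSum c d = ~-trans
  (≗⇒~ (λ N → sum-cong N (λ k → swap (σ k) (ρ N (suc k)) (w k ^ s) (halfSum r k))))
  (sum-ρ~ (λ k → σ k * (w k ^ s * halfSum r k)) (λ k → w k ^ s * nestedSum (r ∷ []) k + w k ^ s)
    (cauchy-cong (λ N → sym (trans (sum-+ N (λ k → w k ^ s * nestedSum (r ∷ []) k) (λ k → w k ^ s))
                                   (cong (_+ zetaSum s N) (sym (nestedSum-∷ s (r ∷ []) N)))))
      (+-cauchy {nestedSum (s ∷ r ∷ [])} {zetaSum s}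
        (nestedSum-cauchy {s} {r ∷ []} (s≤s (s≤s z≤n)) (s≤s z≤n ∷ [])) (zetaSum-cauchy {s} (s≤s (s≤s z≤n)))))
    bounded)
  where
  s = double (suc c)
  r = suc (double d)
  swap : ∀ p r x y → p * r * x * y ≡ r * (p * (x * y))
  swap = solve-∀ ℚ-ring
  0≤½ : 0ℚ ≤ ½
  0≤½ = <⇒≤ 0<½
  halfSum≡ : ∀ k → halfSum r k ≡ nestedSum (r ∷ []) k + ½ * w k ^ r
  halfSum≡ k = cong (_+ ½ * w k ^ r) (sym (nestedSum-single r k))
  last≤1 : ∀ k → ½ * w k ^ r ≤ 1ℚ
  last≤1 k = ≤-trans (*-monoˡ ½ 0≤½ (w^≤1 k r)) (*≤* (ℤ.+≤+ (s≤s z≤n)))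
  halfSum-nonNeg : ∀ k → 0ℚ ≤ halfSum r k
  halfSum-nonNeg k = recast-≤ (0≤+ (nestedSum-nonNeg (r ∷ []) k) (0≤* 0≤½ (w^-nonNeg k r))) refl (sym (halfSum≡ k))
  bounded : ∀ k → ∣ σ k * (w k ^ s * halfSum r k) ∣ ≤ w k ^ s * nestedSum (r ∷ []) k + w k ^ s
  bounded k = begin
    ∣ σ k * (w k ^ s * halfSum r k) ∣            ≡⟨ ∣σ*∣ k _ ⟩
    ∣ w k ^ s * halfSum r k ∣                    ≡⟨ 0≤p⇒∣p∣≡p (0≤* (w^-nonNeg k s) (halfSum-nonNeg k)) ⟩
    w k ^ s * halfSum r k                        ≡⟨ cong (w k ^ s *_) (halfSum≡ k) ⟩
    w k ^ s * (nestedSum (r ∷ []) k + ½ * w k ^ r)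
      ≤⟨ *-monoˡ (w k ^ s) (w^-nonNeg k s) (+-monoʳ-≤ (nestedSum (r ∷ []) k) (last≤1 k)) ⟩
    w k ^ s * (nestedSum (r ∷ []) k + 1ℚ)        ≡⟨ distrib (w k ^ s) (nestedSum (r ∷ []) k) ⟩
    w k ^ s * nestedSum (r ∷ []) k + w k ^ s     ∎
    where
    distrib : ∀ x y → x * (y + 1ℚ) ≡ x * y + x
    distrib = solve-∀ ℚ-ring

-- Partial fractions

-- The binomial coefficient of b + i over i, indexed by the two kinds of steps of a lattice path.
-- Pascal's rule then holds by computation and the symmetry is `B-sym`; `binomial≡B` links it to
-- `_C_`.
B : ℕ → ℕ → ℚ
B zero    i       = 1ℚ
B (suc b) zero    = 1ℚ
B (suc b) (suc i) = B (suc b) i + B b (suc i)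

B-zeroʳ : ∀ b → B b 0 ≡ 1ℚ
B-zeroʳ zero    = refl
B-zeroʳ (suc b) = refl

B-sym : ∀ b i → B b i ≡ B i b
B-sym zero    i       = sym (B-zeroʳ i)
B-sym (suc b) zero    = refl
B-sym (suc b) (suc i) = trans (cong₂ _+_ (B-sym (suc b) i) (B-sym b (suc i))) (+-comm (B i (suc b)) (B (suc i) b))

hockey-stick : ∀ b n → antidiagonal (λ i j → B b i) n ≡ B (suc b) n
hockey-stick b zero    = B-zeroʳ b
hockey-stick b (suc n) = trans (antidiagonal-last n (λ i j → B b i)) (cong (_+ B b (suc n)) (hockey-stick b n))

binomial≡B : ∀ b i → ℤ.+ ((b ℕ.+ i) C i) / 1 ≡ B b i
binomial≡B zero    i       = cong ι (nCn≡1 i)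
binomial≡B (suc b) zero    = refl
binomial≡B (suc b) (suc i) = begin-equality
  ι (suc (b ℕ.+ suc i) C suc i)
    ≡⟨ cong ι (nCk+nC[k+1]≡[n+1]C[k+1] (b ℕ.+ suc i) i) ⟨
  ι ((b ℕ.+ suc i) C i ℕ.+ (b ℕ.+ suc i) C suc i)
    ≡⟨ ι-+ ((b ℕ.+ suc i) C i) ((b ℕ.+ suc i) C suc i) ⟩
  ι ((b ℕ.+ suc i) C i) + ι ((b ℕ.+ suc i) C suc i)
    ≡⟨ cong₂ _+_ (trans (cong (λ n → ι (n C i)) (ℕₚ.+-suc b i)) (binomial≡B (suc b) i)) (binomial≡B b (suc i)) ⟩
  B (suc b) i + B b (suc i) ∎

module PartialFractions (ω : ℚ) where

  coefficient : ℕ → ℕ → ℚ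
  coefficient b i = B b i * (ω ^ suc b * ω ^ i)

  expansionˡ : ℚ → ℕ → ℕ → ℚ
  expansionˡ u a b = antidiagonal (λ i j → σ i * coefficient b i * u ^ suc j) a

  expansionʳ : ℚ → ℕ → ℕ → ℚ
  expansionʳ v a b = antidiagonal (λ i j → coefficient a i * v ^ suc j) b

  private
    coefficient-00 : ∀ b → coefficient (suc b) 0 ≡ ω * coefficient b 0
    coefficient-00 b = trans (regroup ω (ω ^ suc b)) (cong (λ z → ω * (z * (ω ^ suc b * 1ℚ))) (sym (B-zeroʳ b)))
      where
      regroup : ∀ o p → 1ℚ * (o * p * 1ℚ) ≡ o * (1ℚ * (p * 1ℚ))
      regroup = solve-∀ ℚ-ring

    coefficient-suc : ∀ b i → coefficient (suc b) (suc i) ≡ ω * coefficient (suc b) i + ω * coefficient b (suc i)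
    coefficient-suc b i = regroup ω (B (suc b) i) (B b (suc i)) (ω ^ suc b) (ω ^ i)
      where
      regroup : ∀ o x y p q → (x + y) * (o * p * (o * q)) ≡ o * (x * (o * p * q)) + o * (y * (p * (o * q)))
      regroup = solve-∀ ℚ-ring

    coefficient-zero-suc : ∀ i → coefficient 0 (suc i) ≡ ω * coefficient 0 i
    coefficient-zero-suc i = regroup ω (ω * 1ℚ) (ω ^ i)
      where
      regroup : ∀ o p q → 1ℚ * (p * (o * q)) ≡ o * (1ℚ * (p * q))
      regroup = solve-∀ ℚ-ring

    expansionˡ-suc : ∀ u a b → expansionˡ u (suc a) (suc b) ≡ ω * expansionˡ u (suc a) b - ω * expansionˡ u a (suc b)
    expansionˡ-suc u a b = begin-equality
      1ℚ * coefficient (suc b) 0 * p + antidiagonal (λ i j → - σ i * coefficient (suc b) (suc i) * u ^ suc j) a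
        ≡⟨ cong₂ (λ y z → 1ℚ * y * p + z) (coefficient-00 b) (antidiagonal-cong a (λ i j → trans
             (cong (λ z → - σ i * z * u ^ suc j) (coefficient-suc b i))
             (split (σ i) ω (coefficient (suc b) i) (coefficient b (suc i)) (u ^ suc j)))) ⟩
      1ℚ * (ω * coefficient b 0) * p + antidiagonal (λ i j → ω * (- σ i * coefficient b (suc i) * u ^ suc j)
                                             - ω * (σ i * coefficient (suc b) i * u ^ suc j)) a
        ≡⟨ cong (λ z → 1ℚ * (ω * coefficient b 0) * p + z) (trans
             (antidiagonal-- a (λ i j → ω * (- σ i * coefficient b (suc i) * u ^ suc j))
                               (λ i j → ω * (σ i * coefficient (suc b) i * u ^ suc j)))
             (cong₂ _-_ (antidiagonal-*ˡ a ω (λ i j → - σ i * coefficient b (suc i) * u ^ suc j))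
                        (antidiagonal-*ˡ a ω (λ i j → σ i * coefficient (suc b) i * u ^ suc j)))) ⟩
      1ℚ * (ω * coefficient b 0) * p + (ω * X - ω * expansionˡ u a (suc b))
        ≡⟨ collect ω (coefficient b 0) p X (expansionˡ u a (suc b)) ⟩
      ω * (1ℚ * coefficient b 0 * p + X) - ω * expansionˡ u a (suc b) ∎
      where
      p = u ^ suc (suc a)
      X = antidiagonal (λ i j → - σ i * coefficient b (suc i) * u ^ suc j) a
      split : ∀ s o x y q → - s * (o * x + o * y) * q ≡ o * (- s * y * q) - o * (s * x * q)
      split = solve-∀ ℚ-ring
      collect : ∀ o c p x y → 1ℚ * (o * c) * p + (o * x - o * y) ≡ o * (1ℚ * c * p + x) - o * y
      collect = solve-∀ ℚ-ring

    expansionˡ-suc-zero : ∀ u a → expansionˡ u (suc a) 0 ≡ ω * u ^ suc (suc a) - ω * expansionˡ u a 0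
    expansionˡ-suc-zero u a = begin-equality
      1ℚ * (1ℚ * (ω * 1ℚ * 1ℚ)) * p + antidiagonal (λ i j → - σ i * coefficient 0 (suc i) * u ^ suc j) a
        ≡⟨ cong (λ z → 1ℚ * (1ℚ * (ω * 1ℚ * 1ℚ)) * p + z) (trans (antidiagonal-cong a (λ i j → trans
             (cong (λ z → - σ i * z * u ^ suc j) (coefficient-zero-suc i))
             (pull (σ i) ω (coefficient 0 i) (u ^ suc j))))
             (antidiagonal-*ˡ a (- ω) (λ i j → σ i * coefficient 0 i * u ^ suc j))) ⟩
      1ℚ * (1ℚ * (ω * 1ℚ * 1ℚ)) * p + - ω * expansionˡ u a 0
        ≡⟨ collect ω p (expansionˡ u a 0) ⟩
      ω * p - ω * expansionˡ u a 0 ∎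
      where
      p = u ^ suc (suc a)
      pull : ∀ s o x q → - s * (o * x) * q ≡ - o * (s * x * q)
      pull = solve-∀ ℚ-ring
      collect : ∀ o p x → 1ℚ * (1ℚ * (o * 1ℚ * 1ℚ)) * p + - o * x ≡ o * p - o * x
      collect = solve-∀ ℚ-ring

    expansionʳ-suc : ∀ v a b → expansionʳ v (suc a) (suc b) ≡ ω * expansionʳ v a (suc b) + ω * expansionʳ v (suc a) b
    expansionʳ-suc v a b = begin-equality
      coefficient (suc a) 0 * p + antidiagonal (λ i j → coefficient (suc a) (suc i) * v ^ suc j) b
        ≡⟨ cong₂ (λ y z → y * p + z) (coefficient-00 a) (antidiagonal-cong b (λ i j → trans
             (cong (_* v ^ suc j) (coefficient-suc a i))
             (split ω (coefficient (suc a) i) (coefficient a (suc i)) (v ^ suc j)))) ⟩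
      ω * coefficient a 0 * p + antidiagonal (λ i j → ω * (coefficient (suc a) i * v ^ suc j)
                                             + ω * (coefficient a (suc i) * v ^ suc j)) b
        ≡⟨ cong (λ z → ω * coefficient a 0 * p + z) (trans
             (antidiagonal-+ b (λ i j → ω * (coefficient (suc a) i * v ^ suc j))
                               (λ i j → ω * (coefficient a (suc i) * v ^ suc j)))
             (cong₂ _+_ (antidiagonal-*ˡ b ω (λ i j → coefficient (suc a) i * v ^ suc j))
                        (antidiagonal-*ˡ b ω (λ i j → coefficient a (suc i) * v ^ suc j)))) ⟩
      ω * coefficient a 0 * p + (ω * expansionʳ v (suc a) b + ω * X)
        ≡⟨ collect ω (coefficient a 0) p (expansionʳ v (suc a) b) X ⟩
      ω * (coefficient a 0 * p + X) + ω * expansionʳ v (suc a) b ∎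
      where
      p = v ^ suc (suc b)
      X = antidiagonal (λ i j → coefficient a (suc i) * v ^ suc j) b
      split : ∀ o x y q → (o * x + o * y) * q ≡ o * (x * q) + o * (y * q)
      split = solve-∀ ℚ-ring
      collect : ∀ o c p y x → o * c * p + (o * y + o * x) ≡ o * (c * p + x) + o * y
      collect = solve-∀ ℚ-ring

    expansionʳ-zero-suc : ∀ v b → expansionʳ v 0 (suc b) ≡ ω * v ^ suc (suc b) + ω * expansionʳ v 0 b
    expansionʳ-zero-suc v b = begin-equality
      1ℚ * (ω * 1ℚ * 1ℚ) * p + antidiagonal (λ i j → coefficient 0 (suc i) * v ^ suc j) b
        ≡⟨ cong (λ z → 1ℚ * (ω * 1ℚ * 1ℚ) * p + z) (trans (antidiagonal-cong b (λ i j → trans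
             (cong (_* v ^ suc j) (coefficient-zero-suc i)) (*-assoc ω (coefficient 0 i) (v ^ suc j))))
             (antidiagonal-*ˡ b ω (λ i j → coefficient 0 i * v ^ suc j))) ⟩
      1ℚ * (ω * 1ℚ * 1ℚ) * p + ω * expansionʳ v 0 b
        ≡⟨ collect ω p (expansionʳ v 0 b) ⟩
      ω * p + ω * expansionʳ v 0 b ∎
      where
      p = v ^ suc (suc b)
      collect : ∀ o p x → 1ℚ * (o * 1ℚ * 1ℚ) * p + o * x ≡ o * p + o * x
      collect = solve-∀ ℚ-ring

  module _ {u v : ℚ} (uv≡ : u * v ≡ ω * (u - v)) where

    -- For nonzero u and v the hypothesis `uv≡` says that 1/ω is the difference of 1/v and 1/u. Each
    -- use of it lowers one of the two exponents at the price of a factor ω, with sign -1 when it is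
    -- the exponent of u; counting the ways to exhaust one of them gives the binomials in
    -- `coefficient`.
    partial-fractions : ∀ a b → u ^ suc a * v ^ suc b ≡ expansionˡ u a b - σ a * expansionʳ v a b
    partial-fractions zero zero = trans (unit u v) (trans uv≡ (expand u v ω))
      where
      unit : ∀ u v → u * 1ℚ * (v * 1ℚ) ≡ u * v
      unit = solve-∀ ℚ-ring
      expand : ∀ u v o → o * (u - v) ≡ 1ℚ * (1ℚ * (o * 1ℚ * 1ℚ)) * (u * 1ℚ) - 1ℚ * (1ℚ * (o * 1ℚ * 1ℚ) * (v * 1ℚ))
      expand = solve-∀ ℚ-ring
    partial-fractions zero (suc b) = begin-equality
      u * 1ℚ * (v * v ^ suc b)
        ≡⟨ front u v (v ^ suc b) ⟩
      u * v * v ^ suc b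
        ≡⟨ cong (_* v ^ suc b) uv≡ ⟩
      ω * (u - v) * v ^ suc b
        ≡⟨ distrib ω u v (v ^ suc b) ⟩
      ω * (u * 1ℚ * v ^ suc b) - ω * (v * v ^ suc b)
        ≡⟨ cong (λ z → ω * z - ω * (v * v ^ suc b)) (partial-fractions zero b) ⟩
      ω * (1ℚ * coefficient b 0 * (u * 1ℚ) - 1ℚ * expansionʳ v 0 b) - ω * (v * v ^ suc b)
        ≡⟨ collect ω (coefficient b 0) u (expansionʳ v 0 b) (v * v ^ suc b) ⟩
      1ℚ * (ω * coefficient b 0) * (u * 1ℚ) - 1ℚ * (ω * (v * v ^ suc b) + ω * expansionʳ v 0 b)
        ≡⟨ cong₂ (λ y z → 1ℚ * y * (u * 1ℚ) - 1ℚ * z) (coefficient-00 b) (expansionʳ-zero-suc v b) ⟨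
      1ℚ * coefficient (suc b) 0 * (u * 1ℚ) - 1ℚ * expansionʳ v 0 (suc b) ∎
      where
      front : ∀ u v q → u * 1ℚ * (v * q) ≡ u * v * q
      front = solve-∀ ℚ-ring
      distrib : ∀ o u v q → o * (u - v) * q ≡ o * (u * 1ℚ * q) - o * (v * q)
      distrib = solve-∀ ℚ-ring
      collect : ∀ o c u e q → o * (1ℚ * c * (u * 1ℚ) - 1ℚ * e) - o * q ≡ 1ℚ * (o * c) * (u * 1ℚ) - 1ℚ * (o * q + o * e)
      collect = solve-∀ ℚ-ring
    partial-fractions (suc a) zero = begin-equality
      u * u ^ suc a * (v * 1ℚ)
        ≡⟨ front u v (u ^ suc a) ⟩
      u * v * u ^ suc a
        ≡⟨ cong (_* u ^ suc a) uv≡ ⟩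
      ω * (u - v) * u ^ suc a
        ≡⟨ distrib ω u v (u ^ suc a) ⟩
      ω * (u * u ^ suc a) - ω * (u ^ suc a * (v * 1ℚ))
        ≡⟨ cong (λ z → ω * (u * u ^ suc a) - ω * z) (partial-fractions a zero) ⟩
      ω * (u * u ^ suc a) - ω * (expansionˡ u a 0 - σ a * (coefficient a 0 * (v * 1ℚ)))
        ≡⟨ collect ω (u * u ^ suc a) (expansionˡ u a 0) (σ a) (coefficient a 0) v ⟩
      ω * (u * u ^ suc a) - ω * expansionˡ u a 0 - - σ a * (ω * coefficient a 0 * (v * 1ℚ))
        ≡⟨ cong₂ (λ y z → y - - σ a * (z * (v * 1ℚ))) (expansionˡ-suc-zero u a) (coefficient-00 a) ⟨
      expansionˡ u (suc a) 0 - - σ a * (coefficient (suc a) 0 * (v * 1ℚ)) ∎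
      where
      front : ∀ u v q → u * q * (v * 1ℚ) ≡ u * v * q
      front = solve-∀ ℚ-ring
      distrib : ∀ o u v q → o * (u - v) * q ≡ o * (u * q) - o * (q * (v * 1ℚ))
      distrib = solve-∀ ℚ-ring
      collect : ∀ o p e s c v → o * p - o * (e - s * (c * (v * 1ℚ))) ≡ o * p - o * e - - s * (o * c * (v * 1ℚ))
      collect = solve-∀ ℚ-ring
    partial-fractions (suc a) (suc b) = begin-equality
      u * u ^ suc a * (v * v ^ suc b)
        ≡⟨ front u v (u ^ suc a) (v ^ suc b) ⟩
      u * v * (u ^ suc a * v ^ suc b)
        ≡⟨ cong (_* (u ^ suc a * v ^ suc b)) uv≡ ⟩
      ω * (u - v) * (u ^ suc a * v ^ suc b)
        ≡⟨ distrib ω u v (u ^ suc a) (v ^ suc b) ⟩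
      ω * (u ^ suc (suc a) * v ^ suc b) - ω * (u ^ suc a * v ^ suc (suc b))
        ≡⟨ cong₂ (λ y z → ω * y - ω * z) (partial-fractions (suc a) b) (partial-fractions a (suc b)) ⟩
      ω * (expansionˡ u (suc a) b - - σ a * expansionʳ v (suc a) b)
        - ω * (expansionˡ u a (suc b) - σ a * expansionʳ v a (suc b))
        ≡⟨ collect ω (expansionˡ u (suc a) b) (σ a) (expansionʳ v (suc a) b)
                   (expansionˡ u a (suc b)) (expansionʳ v a (suc b)) ⟩
      (ω * expansionˡ u (suc a) b - ω * expansionˡ u a (suc b))
        - - σ a * (ω * expansionʳ v a (suc b) + ω * expansionʳ v (suc a) b)
        ≡⟨ cong₂ (λ y z → y - - σ a * z) (expansionˡ-suc u a b) (expansionʳ-suc v a b) ⟨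
      expansionˡ u (suc a) (suc b) - - σ a * expansionʳ v (suc a) (suc b) ∎
      where
      front : ∀ u v p q → u * p * (v * q) ≡ u * v * (p * q)
      front = solve-∀ ℚ-ring
      distrib : ∀ o u v p q → o * (u - v) * (p * q) ≡ o * (u * p * q) - o * (p * (v * q))
      distrib = solve-∀ ℚ-ring
      collect : ∀ o x s y x′ y′ → o * (x - - s * y) - o * (x′ - s * y′) ≡ (o * x - o * x′) - - s * (o * y′ + o * y)
      collect = solve-∀ ℚ-ring

σ-+ : ∀ m n → σ (m ℕ.+ n) ≡ σ m * σ n
σ-+ zero    n = sym (*-identityˡ (σ n))
σ-+ (suc m) n = trans (cong -_ (σ-+ m n)) (neg-distribˡ-* (σ m) (σ n))

σ-double : ∀ n → σ (double n) ≡ 1ℚ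
σ-double zero    = refl
σ-double (suc n) = trans (double-neg (σ (double n))) (σ-double n)
  where
  double-neg : ∀ p → - - p ≡ p
  double-neg = solve-∀ ℚ-ring

σ*σ : ∀ n → σ n * σ n ≡ 1ℚ
σ*σ zero    = refl
σ*σ (suc n) = trans (neg*neg (σ n)) (σ*σ n)
  where
  neg*neg : ∀ p → - p * - p ≡ p * p
  neg*neg = solve-∀ ℚ-ring

neg-^ : ∀ p n → (- p) ^ n ≡ σ n * p ^ n
neg-^ p zero    = refl
neg-^ p (suc n) = trans (cong (- p *_) (neg-^ p n)) (regroup p (σ n) (p ^ n))
  where
  regroup : ∀ p s q → - p * (s * q) ≡ - s * (p * q)
  regroup = solve-∀ ℚ-ring

neg-^-double : ∀ p n → (- p) ^ double n ≡ p ^ double n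
neg-^-double p n = trans (neg-^ p (double n)) (trans (cong (_* p ^ double n) (σ-double n)) (*-identityˡ _))

-- In 1-based indices, w⁺ q n = 1/(q + n), while w⁻ q n = 1/(q - n) for q ≠ n and w⁻ n n = 0.
w⁺ : ℕ → ℕ → ℚ
w⁺ q n = w (q ℕ.+ suc n)

w⁻ : ℕ → ℕ → ℚ
w⁻ zero    zero    = 0ℚ
w⁻ (suc q) zero    = w q
w⁻ zero    (suc n) = - w n
w⁻ (suc q) (suc n) = w⁻ q n

w⁻-diag : ∀ n → w⁻ n n ≡ 0ℚ
w⁻-diag zero    = refl
w⁻-diag (suc n) = w⁻-diag n

kronecker : ℕ → ℕ → ℚ
kronecker zero    zero    = 1ℚ
kronecker (suc q) zero    = 0ℚ
kronecker zero    (suc n) = 0ℚ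
kronecker (suc q) (suc n) = kronecker q n

kronecker-diag : ∀ n → kronecker n n ≡ 1ℚ
kronecker-diag zero    = refl
kronecker-diag (suc n) = kronecker-diag n

data Position : ℕ → ℕ → Set where
  equal   : ∀ {n} → Position n n
  distinct : ∀ {q n} → w⁻ q n * (ι q - ι n) ≡ 1ℚ → kronecker q n ≡ 0ℚ → Position q n

position : ∀ q n → Position q n
position zero    zero    = equal
position (suc q) zero    = distinct (trans (unit (w q) (ι (suc q))) (ι*w q)) refl
  where
  unit : ∀ v i → v * (i - 0ℚ) ≡ i * v
  unit = solve-∀ ℚ-ring
position zero    (suc n) = distinct (trans (unit (w n) (ι (suc n))) (ι*w n)) refl
  where
  unit : ∀ v i → - v * (0ℚ - i) ≡ i * v
  unit = solve-∀ ℚ-ring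
position (suc q) (suc n) with position q n
... | equal          = equal
... | distinct inv k = distinct (trans (cong (w⁻ q n *_)
        (trans (cong₂ _-_ (ι-suc q) (ι-suc n)) (shift (ι q) (ι n)))) inv) k
  where
  shift : ∀ a b → (a + 1ℚ) - (b + 1ℚ) ≡ a - b
  shift = solve-∀ ℚ-ring

w⁺-inverse : ∀ q n → w⁺ q n * (ι (suc q) + ι (suc n)) ≡ 1ℚ
w⁺-inverse q n = trans (cong (w⁺ q n *_) (sym (ι-+ (suc q) (suc n)))) (trans (*-comm (w⁺ q n) _) (ι*w (q ℕ.+ suc n)))

w*w⁺ : ∀ q n → w n * w⁺ q n ≡ w q * (w n - w⁺ q n)
w*w⁺ q n = begin-equality
  u * v
    ≡⟨ *-identityʳ (u * v) ⟨
  u * v * 1ℚ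
    ≡⟨ cong (u * v *_) (ι*w q) ⟨
  u * v * (ι (suc q) * o)
    ≡⟨ split u v o (ι (suc q)) (ι (suc n)) ⟩
  o * (u * (v * (ι (suc q) + ι (suc n))) - v * (ι (suc n) * u))
    ≡⟨ cong₂ (λ y z → o * (u * y - v * z)) (w⁺-inverse q n) (ι*w n) ⟩
  o * (u * 1ℚ - v * 1ℚ)
    ≡⟨ cong₂ (λ y z → o * (y - z)) (*-identityʳ u) (*-identityʳ v) ⟩
  o * (u - v) ∎
  where
  u = w n
  v = w⁺ q n
  o = w q
  split : ∀ u v o a b → u * v * (a * o) ≡ o * (u * (v * (a + b)) - v * (b * u))
  split = solve-∀ ℚ-ring

w*w⁻ : ∀ q n → w⁻ q n * (ι q - ι n) ≡ 1ℚ → - w n * w⁻ q n ≡ w q * (- w n - w⁻ q n)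
w*w⁻ q n inv = begin-equality
  - u * v                                       ≡⟨ insert u v ⟩
  - (u * v * 1ℚ)                                ≡⟨ cong (λ y → - (u * v * y)) (ι*w q) ⟨
  - (u * v * (ι (suc q) * o))                   ≡⟨ split u v o (ι (suc q)) (ι (suc n)) ⟩
  - (o * u * (v * (ι (suc q) - ι (suc n))) + o * v * (ι (suc n) * u))
    ≡⟨ cong₂ (λ y z → - (o * u * y + o * v * z))
         (trans (cong (v *_) (trans (cong₂ _-_ (ι-suc q) (ι-suc n)) (shift (ι q) (ι n)))) inv) (ι*w n) ⟩
  - (o * u * 1ℚ + o * v * 1ℚ)                   ≡⟨ finish u v o ⟩
  o * (- u - v)                                 ∎
  where
  u = w n
  v = w⁻ q n
  o = w q
  insert : ∀ u v → - u * v ≡ - (u * v * 1ℚ)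
  insert = solve-∀ ℚ-ring
  split : ∀ u v o a b → - (u * v * (a * o)) ≡ - (o * u * (v * (a - b)) + o * v * (b * u))
  split = solve-∀ ℚ-ring
  shift : ∀ a b → (a + 1ℚ) - (b + 1ℚ) ≡ a - b
  shift = solve-∀ ℚ-ring
  finish : ∀ u v o → - (o * u * 1ℚ + o * v * 1ℚ) ≡ o * (- u - v)
  finish = solve-∀ ℚ-ring

module _ (ω : ℚ) where
  open PartialFractions ω

  -- Adding the expansions at u and -u cancels the odd powers of u. This is why only eta values of
  -- even weight arise when u = 1/n is summed over n with signs.
  expansionˡ-even : ∀ u c b → expansionˡ u (suc (double c)) b + expansionˡ (- u) (suc (double c)) b
    ≡ 2ℚ * antidiagonal (λ i j → coefficient b (double i) * u ^ double (suc j)) c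
  expansionˡ-even u c b = begin-equality
    expansionˡ u (suc (double c)) b + expansionˡ (- u) (suc (double c)) b
      ≡⟨ antidiagonal-+ (suc (double c)) (λ i j → σ i * coefficient b i * u ^ suc j)
                                         (λ i j → σ i * coefficient b i * (- u) ^ suc j) ⟨
    antidiagonal F (suc (double c))
      ≡⟨ antidiagonal-odd c F ⟩
    antidiagonal (λ i j → F (double i) (suc (double j))) c + antidiagonal (λ i j → F (suc (double i)) (double j)) c
      ≡⟨ cong₂ _+_ (trans (antidiagonal-cong c even) (antidiagonal-*ˡ c 2ℚ _))
                   (trans (antidiagonal-cong c odd) (antidiagonal-*ˡ c 0ℚ (λ _ _ → 0ℚ))) ⟩
    2ℚ * E + 0ℚ * antidiagonal (λ _ _ → 0ℚ) c
      ≡⟨ drop (2ℚ * E) (antidiagonal (λ _ _ → 0ℚ) c) ⟩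
    2ℚ * E ∎
    where
    F : ℕ → ℕ → ℚ
    F i j = σ i * coefficient b i * u ^ suc j + σ i * coefficient b i * (- u) ^ suc j
    E = antidiagonal (λ i j → coefficient b (double i) * u ^ double (suc j)) c
    drop : ∀ p q → p + 0ℚ * q ≡ p
    drop = solve-∀ ℚ-ring
    twice : ∀ k p → 1ℚ * k * p + 1ℚ * k * p ≡ 2ℚ * (k * p)
    twice = solve-∀ ℚ-ring
    cancel : ∀ s k u p → s * k * (u * p) + s * k * (- u * p) ≡ 0ℚ
    cancel = solve-∀ ℚ-ring
    even : ∀ i j → F (double i) (suc (double j)) ≡ 2ℚ * (coefficient b (double i) * u ^ double (suc j))
    even i j = trans (cong₂ (λ s p → s * coefficient b (double i) * u ^ double (suc j) + s * coefficient b (double i) * p)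
                       (σ-double i) (neg-^-double u (suc j)))
                     (twice (coefficient b (double i)) (u ^ double (suc j)))
    odd : ∀ i j → F (suc (double i)) (double j) ≡ 0ℚ * 0ℚ
    odd i j = trans (cong (λ p → - σ (double i) * k * (u * u ^ double j) + - σ (double i) * k * (- u * p)) (neg-^-double u j))
                    (cancel (- σ (double i)) k u (u ^ double j))
      where k = coefficient b (suc (double i))

  -- At u = -ω all terms carry the same power of ω and their signs multiply to 1, so the
  -- hockey-stick identity sums the binomials. This is what the expansion for 1/(q - n) would
  -- contribute at q = n, where it does not exist.
  expansionˡ-diag : ∀ c b → expansionˡ (- ω) (suc (double c)) b
    ≡ B (suc b) (suc (double c)) * (ω ^ double (suc c) * ω ^ suc b)
  expansionˡ-diag c b = begin-equality
    expansionˡ (- ω) a b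
      ≡⟨ antidiagonal-cong-≡ a term ⟩
    antidiagonal (λ i j → B b i * (ω ^ suc a * ω ^ suc b)) a
      ≡⟨ antidiagonal-*ʳ a (ω ^ suc a * ω ^ suc b) (λ i j → B b i) ⟩
    antidiagonal (λ i j → B b i) a * (ω ^ suc a * ω ^ suc b)
      ≡⟨ cong (_* (ω ^ suc a * ω ^ suc b)) (hockey-stick b a) ⟩
    B (suc b) a * (ω ^ suc a * ω ^ suc b) ∎
    where
    a = suc (double c)
    regroup : ∀ s t x p q r → s * (x * (p * q)) * (t * r) ≡ s * t * (x * (q * r * p))
    regroup = solve-∀ ℚ-ring
    term : ∀ i j → i ℕ.+ j ≡ a → σ i * coefficient b i * (- ω) ^ suc j ≡ B b i * (ω ^ suc a * ω ^ suc b)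
    term i j i+j≡a = begin-equality
      σ i * (B b i * (ω ^ suc b * ω ^ i)) * (- ω) ^ suc j
        ≡⟨ cong (σ i * coefficient b i *_) (neg-^ ω (suc j)) ⟩
      σ i * (B b i * (ω ^ suc b * ω ^ i)) * (σ (suc j) * ω ^ suc j)
        ≡⟨ regroup (σ i) (σ (suc j)) (B b i) (ω ^ suc b) (ω ^ i) (ω ^ suc j) ⟩
      σ i * σ (suc j) * (B b i * (ω ^ i * ω ^ suc j * ω ^ suc b))
        ≡⟨ cong₂ (λ s p → s * (B b i * (p * ω ^ suc b)))
             (trans (sym (σ-+ i (suc j))) (trans (cong σ i+suc-j≡) (σ-double (suc c))))
             (trans (sym (^-homo-* ω i (suc j))) (cong (ω ^_) i+suc-j≡)) ⟩
      1ℚ * (B b i * (ω ^ suc a * ω ^ suc b))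
        ≡⟨ *-identityˡ _ ⟩
      B b i * (ω ^ suc a * ω ^ suc b) ∎
      where
      i+suc-j≡ : i ℕ.+ suc j ≡ suc a
      i+suc-j≡ = trans (ℕₚ.+-suc i j) (cong suc i+j≡a)

  expansionʳ-0 : ∀ a b → expansionʳ 0ℚ a b ≡ 0ℚ
  expansionʳ-0 a b = begin-equality
    antidiagonal (λ i j → coefficient a i * (0ℚ * 0ℚ ^ j)) b
      ≡⟨ antidiagonal-cong b (λ i j → vanish (coefficient a i) (0ℚ ^ j)) ⟩
    antidiagonal (λ i j → 0ℚ * 0ℚ) b
      ≡⟨ antidiagonal-*ˡ b 0ℚ (λ _ _ → 0ℚ) ⟩
    0ℚ * antidiagonal (λ _ _ → 0ℚ) b
      ≡⟨ *-zeroˡ (antidiagonal (λ _ _ → 0ℚ) b) ⟩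
    0ℚ ∎
    where
    vanish : ∀ p q → p * (0ℚ * q) ≡ 0ℚ * 0ℚ
    vanish = solve-∀ ℚ-ring

-- In 1-based indices the pairs (1/n, 1/(q + n)) and (-1/n, 1/(q - n)) both satisfy the relation
-- with ω = 1/q, and the even exponent of 1/n hides the sign in the second pair. At q = n only the
-- first pair is present; the `kronecker` term restores a uniform formula.
symmetric-partial-fractions : ∀ c b {q n} → Position q n → let open PartialFractions (w q); a = suc (double c) in
  w n ^ suc a * (w⁺ q n ^ suc b + w⁻ q n ^ suc b)
    ≡ 2ℚ * antidiagonal (λ i j → coefficient b (double i) * w n ^ double (suc j)) c
      + (expansionʳ (w⁺ q n) a b + expansionʳ (w⁻ q n) a b)
      - kronecker q n * (B (suc b) a * (w n ^ suc a * w n ^ suc b))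
symmetric-partial-fractions c b {n = n} equal = begin-equality
  u ^ suc a * (v ^ suc b + w⁻ n n ^ suc b)
    ≡⟨ cong (λ z → u ^ suc a * (v ^ suc b + z ^ suc b)) (w⁻-diag n) ⟩
  u ^ suc a * (v ^ suc b + 0ℚ * 0ℚ ^ b)
    ≡⟨ drop (u ^ suc a) (v ^ suc b) (0ℚ ^ b) ⟩
  u ^ suc a * v ^ suc b
    ≡⟨ partial-fractions {u} {v} (w*w⁺ n n) a b ⟩
  expansionˡ u a b - - σ (double c) * expansionʳ v a b
    ≡⟨ cong (λ s → expansionˡ u a b - - s * expansionʳ v a b) (σ-double c) ⟩
  expansionˡ u a b - - 1ℚ * expansionʳ v a b
    -- Here ω is u, so the expansion that is added and subtracted is the one summed by
    -- `expansionˡ-diag`.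
    ≡⟨ insert (expansionˡ u a b) (expansionˡ (- u) a b) (expansionʳ v a b) ⟩
  expansionˡ u a b + expansionˡ (- u) a b + (expansionʳ v a b + 0ℚ) - 1ℚ * expansionˡ (- u) a b
    ≡⟨ cong₂ (λ x y → x + (expansionʳ v a b + 0ℚ) - 1ℚ * y) (expansionˡ-even u u c b) (expansionˡ-diag u c b) ⟩
  2ℚ * E + (expansionʳ v a b + 0ℚ) - 1ℚ * (B (suc b) a * (u ^ suc a * u ^ suc b))
    ≡⟨ cong₂ (λ x y → 2ℚ * E + (expansionʳ v a b + x) - y * (B (suc b) a * (u ^ suc a * u ^ suc b)))
         (trans (cong (λ z → expansionʳ z a b) (w⁻-diag n)) (expansionʳ-0 u a b)) (kronecker-diag n) ⟨
  2ℚ * E + (expansionʳ v a b + expansionʳ (w⁻ n n) a b) - kronecker n n * (B (suc b) a * (u ^ suc a * u ^ suc b)) ∎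
  where
  open PartialFractions (w n)
  a = suc (double c)
  u = w n
  v = w⁺ n n
  E = antidiagonal (λ i j → coefficient b (double i) * u ^ double (suc j)) c
  drop : ∀ p q r → p * (q + 0ℚ * r) ≡ p * q
  drop = solve-∀ ℚ-ring
  insert : ∀ x y z → x - - 1ℚ * z ≡ x + y + (z + 0ℚ) - 1ℚ * y
  insert = solve-∀ ℚ-ring
symmetric-partial-fractions c b {q} {n} (distinct inv off) = begin-equality
  u ^ suc a * (v ^ suc b + v′ ^ suc b)
    ≡⟨ *-distribˡ-+ (u ^ suc a) (v ^ suc b) (v′ ^ suc b) ⟩
  u ^ suc a * v ^ suc b + u ^ suc a * v′ ^ suc b
    ≡⟨ cong₂ (λ y z → y + z * v′ ^ suc b) (partial-fractions {u} {v} (w*w⁺ q n) a b) (sym (neg-^-double u (suc c))) ⟩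
  expansionˡ u a b - σ a * expansionʳ v a b + (- u) ^ suc a * v′ ^ suc b
    ≡⟨ cong (λ z → expansionˡ u a b - σ a * expansionʳ v a b + z) (partial-fractions { - u} {v′} (w*w⁻ q n inv) a b) ⟩
  expansionˡ u a b - σ a * expansionʳ v a b + (expansionˡ (- u) a b - σ a * expansionʳ v′ a b)
    ≡⟨ cong (λ s → expansionˡ u a b - - s * expansionʳ v a b + (expansionˡ (- u) a b - - s * expansionʳ v′ a b)) (σ-double c) ⟩
  expansionˡ u a b - - 1ℚ * expansionʳ v a b + (expansionˡ (- u) a b - - 1ℚ * expansionʳ v′ a b)
    ≡⟨ collect (expansionˡ u a b) (expansionˡ (- u) a b) (expansionʳ v a b) (expansionʳ v′ a b) K ⟩
  expansionˡ u a b + expansionˡ (- u) a b + (expansionʳ v a b + expansionʳ v′ a b) - 0ℚ * K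
    ≡⟨ cong₂ (λ x y → x + (expansionʳ v a b + expansionʳ v′ a b) - y * K) (expansionˡ-even (w q) u c b) (sym off) ⟩
  2ℚ * E + (expansionʳ v a b + expansionʳ v′ a b) - kronecker q n * K ∎
  where
  open PartialFractions (w q)
  a = suc (double c)
  u = w n
  v = w⁺ q n
  v′ = w⁻ q n
  E = antidiagonal (λ i j → coefficient b (double i) * u ^ double (suc j)) c
  K = B (suc b) a * (u ^ suc a * u ^ suc b)
  collect : ∀ x x′ y y′ k → x - - 1ℚ * y + (x′ - - 1ℚ * y′) ≡ x + x′ + (y + y′) - 0ℚ * k
  collect = solve-∀ ℚ-ring

-- Summation over windows and its boundary errors

sum-kronecker : ∀ n m → sum (suc n ℕ.+ m) (λ q → kronecker q n) ≡ 1ℚ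
sum-kronecker zero    m = trans (sum-front m (λ q → kronecker q 0)) (trans (cong (1ℚ +_) (sum-zero m)) refl)
sum-kronecker (suc n) m = trans (sum-front (suc n ℕ.+ m) (λ q → kronecker q (suc n)))
                                (trans (+-identityˡ _) (sum-kronecker n m))

-- A function of q - n, summed over a window of values of q.
sum-window : ∀ (F : ℕ → ℕ → ℚ) → F 0 0 ≡ 0ℚ → (∀ q n → F (suc q) (suc n) ≡ F q n) → ∀ n m →
  sum (suc n ℕ.+ m) (λ q → F q n) ≡ sum n (λ k → F 0 (suc k)) + sum m (λ k → F (suc k) 0)
sum-window F F00 F-shift zero    m = trans (sum-front m (λ q → F q 0)) (cong (_+ sum m (λ k → F (suc k) 0)) F00)
sum-window F F00 F-shift (suc n) m = begin-equality
  sum (suc (suc n ℕ.+ m)) (λ q → F q (suc n))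
    ≡⟨ sum-front (suc n ℕ.+ m) (λ q → F q (suc n)) ⟩
  F 0 (suc n) + sum (suc n ℕ.+ m) (λ q → F (suc q) (suc n))
    ≡⟨ cong (F 0 (suc n) +_) (sum-cong (suc n ℕ.+ m) (λ q → F-shift q n)) ⟩
  F 0 (suc n) + sum (suc n ℕ.+ m) (λ q → F q n)
    ≡⟨ cong (F 0 (suc n) +_) (sum-window F F00 F-shift n m) ⟩
  F 0 (suc n) + (X + Y)
    ≡⟨ regroup (F 0 (suc n)) X Y ⟩
  X + F 0 (suc n) + Y ∎
  where
  X = sum n (λ k → F 0 (suc k))
  Y = sum m (λ k → F (suc k) 0)
  regroup : ∀ a x y → a + (x + y) ≡ x + a + y
  regroup = solve-∀ ℚ-ring

module _ (l : ℕ) where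

  -- Writing the length of the window as `suc n + m` places the zero of q - n inside it, with n
  -- terms below and m terms above.
  sum-w⁻ : ∀ n m → sum (suc n ℕ.+ m) (λ q → w⁻ q n ^ suc l) ≡ σ (suc l) * zetaSum (suc l) n + zetaSum (suc l) m
  sum-w⁻ n m = trans (sum-window (λ q n → w⁻ q n ^ suc l) (*-zeroˡ (0ℚ ^ l)) (λ _ _ → refl) n m)
    (cong (_+ zetaSum (suc l) m) (trans (sum-cong n (λ k → neg-^ (w k) (suc l)))
                                        (sum-*ˡ n (σ (suc l)) (λ k → w k ^ suc l))))

  sum-w⁺ : ∀ n N → sum N (λ q → w⁺ q n ^ suc l) ≡ zetaSum (suc l) (N ℕ.+ suc n) - zetaSum (suc l) (suc n)
  sum-w⁺ n N = trans (cancel (zetaSum (suc l) (suc n)) _)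
                     (cong (_- zetaSum (suc l) (suc n)) (sym (sum-++ (suc n) N (λ k → w k ^ suc l))))
    where
    cancel : ∀ x y → y ≡ x + y - x
    cancel = solve-∀ ℚ-ring

  -- Multiplying by `σ q * σ q`, which is 1, makes the sign depend on n - q alone, so `sum-window`
  -- applies.
  sum-σ-w⁻ : ∀ q m → sum (suc q ℕ.+ m) (λ n → σ n * w⁻ q n ^ suc l)
    ≡ - σ q * (etaSum (suc l) q + σ (suc l) * etaSum (suc l) m)
  sum-σ-w⁻ q m = begin-equality
    sum (suc q ℕ.+ m) (λ n → σ n * w⁻ q n ^ suc l)
      ≡⟨ sum-cong (suc q ℕ.+ m) (λ n → trans (insert (σ n) (w⁻ q n ^ suc l))
           (trans (cong (λ z → z * (σ n * w⁻ q n ^ suc l)) (sym (σ*σ q)))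
                  (regroup (σ q) (σ n) (w⁻ q n ^ suc l)))) ⟩
    sum (suc q ℕ.+ m) (λ n → σ q * F n q)
      ≡⟨ sum-*ˡ (suc q ℕ.+ m) (σ q) (λ n → F n q) ⟩
    σ q * sum (suc q ℕ.+ m) (λ n → F n q)
      ≡⟨ cong (σ q *_) (sum-window F (F00 (0ℚ ^ l)) F-shift q m) ⟩
    σ q * (sum q (λ k → F 0 (suc k)) + sum m (λ k → F (suc k) 0))
      ≡⟨ cong₂ (λ x y → σ q * (x + y)) (trans (sum-cong q left) (sum-*ˡ q -1ℚ (λ k → σ k * w k ^ suc l)))
                                       (trans (sum-cong m right) (sum-*ˡ m (- σ (suc l)) (λ k → σ k * w k ^ suc l))) ⟩
    σ q * (-1ℚ * etaSum (suc l) q + - σ (suc l) * etaSum (suc l) m)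
      ≡⟨ finish (σ q) (etaSum (suc l) q) (σ (suc l)) (etaSum (suc l) m) ⟩
    - σ q * (etaSum (suc l) q + σ (suc l) * etaSum (suc l) m) ∎
    where
    F : ℕ → ℕ → ℚ
    F n q = σ n * σ q * w⁻ q n ^ suc l
    insert : ∀ s p → s * p ≡ 1ℚ * (s * p)
    insert = solve-∀ ℚ-ring
    regroup : ∀ t s p → t * t * (s * p) ≡ t * (s * t * p)
    regroup = solve-∀ ℚ-ring
    F00 : ∀ p → 1ℚ * 1ℚ * (0ℚ * p) ≡ 0ℚ
    F00 = solve-∀ ℚ-ring
    neg*neg : ∀ s t p → - s * - t * p ≡ s * t * p
    neg*neg = solve-∀ ℚ-ring
    F-shift : ∀ n q → F (suc n) (suc q) ≡ F n q
    F-shift n q = neg*neg (σ n) (σ q) (w⁻ q n ^ suc l)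
    left : ∀ k → F 0 (suc k) ≡ -1ℚ * (σ k * w k ^ suc l)
    left k = sign-out (σ k) (w k ^ suc l)
      where
      sign-out : ∀ s p → 1ℚ * - s * p ≡ -1ℚ * (s * p)
      sign-out = solve-∀ ℚ-ring
    right : ∀ k → F (suc k) 0 ≡ - σ (suc l) * (σ k * w k ^ suc l)
    right k = trans (cong (- σ k * 1ℚ *_) (neg-^ (w k) (suc l))) (sign-out (σ k) (σ (suc l)) (w k ^ suc l))
      where
      sign-out : ∀ s t p → - s * 1ℚ * (t * p) ≡ - t * (s * p)
      sign-out = solve-∀ ℚ-ring
    finish : ∀ s x t y → s * (-1ℚ * x + - t * y) ≡ - s * (x + t * y)
    finish = solve-∀ ℚ-ring

  sum-σ-w⁺ : ∀ q N → sum N (λ n → σ n * w⁺ q n ^ suc l)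
    ≡ - σ q * (etaSum (suc l) (N ℕ.+ suc q) - etaSum (suc l) (suc q))
  sum-σ-w⁺ q N = begin-equality
    sum N (λ n → σ n * w (q ℕ.+ suc n) ^ suc l)
      ≡⟨ sum-cong N term ⟩
    sum N (λ n → - σ q * (σ (n ℕ.+ suc q) * w (n ℕ.+ suc q) ^ suc l))
      ≡⟨ sum-*ˡ N (- σ q) (λ n → σ (n ℕ.+ suc q) * w (n ℕ.+ suc q) ^ suc l) ⟩
    - σ q * sum N (λ n → σ (n ℕ.+ suc q) * w (n ℕ.+ suc q) ^ suc l)
      ≡⟨ cong (- σ q *_) (trans (cancel (etaSum (suc l) (suc q)) _)
           (cong (_- etaSum (suc l) (suc q)) (sym (sum-++ (suc q) N (λ k → σ k * w k ^ suc l))))) ⟩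
    - σ q * (etaSum (suc l) (N ℕ.+ suc q) - etaSum (suc l) (suc q)) ∎
    where
    cancel : ∀ x y → y ≡ x + y - x
    cancel = solve-∀ ℚ-ring
    insert : ∀ s p → s * p ≡ 1ℚ * (s * p)
    insert = solve-∀ ℚ-ring
    regroup : ∀ t s p → t * t * (s * p) ≡ - t * (s * - t * p)
    regroup = solve-∀ ℚ-ring
    swap : ∀ q n → q ℕ.+ suc n ≡ n ℕ.+ suc q
    swap q n = trans (ℕₚ.+-suc q n) (trans (cong suc (ℕₚ.+-comm q n)) (sym (ℕₚ.+-suc n q)))
    term : ∀ n → σ n * w (q ℕ.+ suc n) ^ suc l ≡ - σ q * (σ (n ℕ.+ suc q) * w (n ℕ.+ suc q) ^ suc l)
    term n = begin-equality
      σ n * w (q ℕ.+ suc n) ^ suc l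
        ≡⟨ cong (λ k → σ n * w k ^ suc l) (swap q n) ⟩
      σ n * w (n ℕ.+ suc q) ^ suc l
        ≡⟨ insert (σ n) _ ⟩
      1ℚ * (σ n * w (n ℕ.+ suc q) ^ suc l)
        ≡⟨ cong (_* (σ n * w (n ℕ.+ suc q) ^ suc l)) (σ*σ q) ⟨
      σ q * σ q * (σ n * w (n ℕ.+ suc q) ^ suc l)
        ≡⟨ regroup (σ q) (σ n) (w (n ℕ.+ suc q) ^ suc l) ⟩
      - σ q * (σ n * - σ q * w (n ℕ.+ suc q) ^ suc l)
        ≡⟨ cong (λ s → - σ q * (s * w (n ℕ.+ suc q) ^ suc l)) (σ-+ n (suc q)) ⟨
      - σ q * (σ (n ℕ.+ suc q) * w (n ℕ.+ suc q) ^ suc l) ∎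

  -- Each of the k terms is at most `w m`. The estimate is crude but covers the harmonic sum, which
  -- has no convergent tail; in `rowError-term` a factor 1/n compensates `ι k`.
  zeta-gap : ∀ m k → ∣ zetaSum (suc l) (k ℕ.+ m) - zetaSum (suc l) m ∣ ≤ ι k * w m
  zeta-gap m k = recast-≤ (bound≤ k) (cong ∣_∣ (sym (trans (cong (_- zetaSum (suc l) m) (sum-++ m k (λ i → w i ^ suc l)))
                                             (cancel (zetaSum (suc l) m) _)))) refl
    where
    cancel : ∀ x y → x + y - x ≡ y
    cancel = solve-∀ ℚ-ring
    term≤ : ∀ i → ∣ w (i ℕ.+ m) ^ suc l ∣ ≤ w m
    term≤ i = recast-≤ (≤-trans (*-monoˡ (w (i ℕ.+ m)) (w-nonNeg (i ℕ.+ m)) (w^≤1 (i ℕ.+ m) l))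
                                (recast-≤ (w-anti (ℕₚ.m≤n+m m i)) (sym (*-identityʳ _)) refl))
                       (sym (0≤p⇒∣p∣≡p (w^-nonNeg (i ℕ.+ m) (suc l)))) refl
    sum-const : ∀ k → sum k (λ _ → w m) ≡ ι k * w m
    sum-const zero    = sym (*-zeroˡ (w m))
    sum-const (suc k) = trans (cong (_+ w m) (sum-const k)) (trans (one (ι k) (w m)) (cong (_* w m) (sym (ι-suc k))))
      where
      one : ∀ i v → i * v + v ≡ (i + 1ℚ) * v
      one = solve-∀ ℚ-ring
    bound≤ : ∀ k → ∣ sum k (λ i → w (i ℕ.+ m) ^ suc l) ∣ ≤ ι k * w m
    bound≤ k = ≤-trans (∣sum∣≤-bound k (λ i _ → term≤ i)) (≤-reflexive (sum-const k))

alternating-sum-bounds : ∀ (x : ℕ → ℚ) → (∀ i → 0ℚ ≤ x i) → (∀ i → x (suc i) ≤ x i) → ∀ k →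
  0ℚ ≤ sum k (λ i → σ i * x i) × sum k (λ i → σ i * x i) ≤ x 0
alternating-sum-bounds x 0≤x x-anti zero    = ≤-refl , 0≤x 0
alternating-sum-bounds x 0≤x x-anti (suc k) =
  let 0≤s , s≤x₁ = alternating-sum-bounds (λ i → x (suc i)) (λ i → 0≤x (suc i)) (λ i → x-anti (suc i)) k
  in recast-≤ (+-monoʳ-≤ (x 0) (neg-antimono-≤ (≤-trans s≤x₁ (x-anti 0)))) (+-inverseʳ (x 0)) (sym split)
   , recast-≤ (+-monoʳ-≤ (x 0) (neg-antimono-≤ 0≤s)) (sym split) (+-identityʳ (x 0))
  where
  pull : ∀ s p → - s * p ≡ - (s * p)
  pull = solve-∀ ℚ-ring
  split : sum (suc k) (λ i → σ i * x i) ≡ x 0 - sum k (λ i → σ i * x (suc i))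
  split = trans (sum-front k (λ i → σ i * x i))
    (cong₂ _+_ (*-identityˡ (x 0)) (trans (sum-cong k (λ i → pull (σ i) (x (suc i)))) (sum-neg k (λ i → σ i * x (suc i)))))

w^-anti : ∀ {m n} k → m ℕ.≤ n → w n ^ k ≤ w m ^ k
w^-anti zero    m≤n = ≤-refl
w^-anti {m} {n} (suc k) m≤n = ≤-trans (*-monoˡ (w n) (w-nonNeg n) (w^-anti k m≤n))
                                      (*-monoʳ (w m ^ k) (w^-nonNeg m k) (w-anti m≤n))

-- Leibniz's bound for alternating sums: the first omitted term suffices, whatever the number k of
-- terms, also for exponent 1.
eta-gap : ∀ l m k → ∣ etaSum (suc l) (k ℕ.+ m) - etaSum (suc l) m ∣ ≤ w m
eta-gap l m k =
  let 0≤s , s≤ = alternating-sum-bounds x (λ i → w^-nonNeg (i ℕ.+ m) (suc l)) (λ i → w^-anti (suc l) (ℕₚ.n≤1+n (i ℕ.+ m))) k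
  in recast-≤ (≤-trans s≤ (recast-≤ (*-monoˡ (w m) (w-nonNeg m) (w^≤1 m l)) refl (*-identityʳ (w m))))
       (sym (trans (cong ∣_∣ gap) (trans (∣σ*∣ m _) (0≤p⇒∣p∣≡p 0≤s)))) refl
  where
  x : ℕ → ℚ
  x i = w (i ℕ.+ m) ^ suc l
  cancel : ∀ x y → x + y - x ≡ y
  cancel = solve-∀ ℚ-ring
  swap : ∀ s t p → s * t * p ≡ t * (s * p)
  swap = solve-∀ ℚ-ring
  gap : etaSum (suc l) (k ℕ.+ m) - etaSum (suc l) m ≡ σ m * sum k (λ i → σ i * x i)
  gap = trans (trans (cong (_- etaSum (suc l) m) (sum-++ m k (λ i → σ i * w i ^ suc l))) (cancel (etaSum (suc l) m) _))
    (trans (sum-cong k (λ i → trans (cong (_* x i) (σ-+ i m)) (swap (σ i) (σ m) (x i)))) (sum-*ˡ k (σ m) (λ i → σ i * x i)))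

sum≡antidiagonal : ∀ M (F : ℕ → ℕ → ℚ) → sum (suc M) (λ q → F q (M ℕ.∸ q)) ≡ antidiagonal F M
sum≡antidiagonal zero    F = +-identityˡ (F 0 0)
sum≡antidiagonal (suc M) F = trans (sum-front (suc M) (λ q → F q (suc M ℕ.∸ q)))
                                   (cong (F 0 (suc M) +_) (sum≡antidiagonal M (λ i j → F (suc i) j)))

-- From 1/(xy) = (1/x + 1/y)/(x + y) with x + y = N + 1, the sum is twice the N-th harmonic number
-- over N + 1. That this tends to 0 is `remainder-null` for the list `1 ∷ []`.
convolution-null : Null (λ N → sum N (λ q → w q * w (N ℕ.∸ suc q)))
convolution-null = null-≤ bound≤ (const*null 2ℚ shifted)
  where
  -- `remainder` at `M` involves the truncation at `suc M`, hence the shift; for N = 0 the sum to be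
  -- bounded is empty.
  R : ℕ → ℚ
  R zero    = 0ℚ
  R (suc M) = remainder (1 ∷ []) M
  shifted : Null R
  shifted = mkNull λ ε 0<ε → let N , r<ε = remainder-null {1 ∷ []} (s≤s z≤n ∷ []) ε 0<ε in
    suc N , λ { (suc M) (s≤s N≤M) → recast-< (sym (0≤p⇒∣p∣≡p (remainder-nonNeg (1 ∷ []) M))) (r<ε M N≤M) }
  exact : ∀ M → antidiagonal (λ i j → w i * w j) M ≡ w (suc M) * (2ℚ * sum (suc M) (λ k → w k))
  exact M = begin-equality
    antidiagonal (λ i j → w i * w j) M
      ≡⟨ antidiagonal-cong-≡ M term ⟩
    antidiagonal (λ i j → w (suc M) * (w i + w j)) M
      ≡⟨ antidiagonal-*ˡ M (w (suc M)) (λ i j → w i + w j) ⟩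
    w (suc M) * antidiagonal (λ i j → w i + w j) M
      ≡⟨ cong (w (suc M) *_) (antidiagonal-+ M (λ i j → w i) (λ i j → w j)) ⟩
    w (suc M) * (antidiagonal (λ i j → w i) M + antidiagonal (λ i j → w j) M)
      ≡⟨ cong₂ (λ x y → w (suc M) * (x + y)) (antidiagonal-const M w)
           (trans (antidiagonal-flip M (λ i j → w j)) (antidiagonal-const M w)) ⟩
    w (suc M) * (sum (suc M) w + sum (suc M) w)
      ≡⟨ cong (w (suc M) *_) (twice (sum (suc M) w)) ⟩
    w (suc M) * (2ℚ * sum (suc M) (λ k → w k)) ∎
    where
    twice : ∀ x → x + x ≡ 2ℚ * x
    twice = solve-∀ ℚ-ring
    insert : ∀ x y → x * y ≡ 1ℚ * (x * y)
    insert = solve-∀ ℚ-ring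
    spread : ∀ a b v x y → (a + b) * v * (x * y) ≡ v * ((a * x) * y + (b * y) * x)
    spread = solve-∀ ℚ-ring
    one : ∀ v x y → v * (1ℚ * y + 1ℚ * x) ≡ v * (x + y)
    one = solve-∀ ℚ-ring
    term : ∀ i j → i ℕ.+ j ≡ M → w i * w j ≡ w (suc M) * (w i + w j)
    term i j refl = begin-equality
      w i * w j                                             ≡⟨ insert (w i) (w j) ⟩
      1ℚ * (w i * w j)                                      ≡⟨ cong (_* (w i * w j)) (ι*w (suc (i ℕ.+ j))) ⟨
      ι (suc (suc (i ℕ.+ j))) * w (suc (i ℕ.+ j)) * (w i * w j)
        ≡⟨ cong (λ z → z * w (suc (i ℕ.+ j)) * (w i * w j))
             (trans (cong ι (sym (ℕₚ.+-suc (suc i) j))) (ι-+ (suc i) (suc j))) ⟩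
      (ι (suc i) + ι (suc j)) * w (suc (i ℕ.+ j)) * (w i * w j)
        ≡⟨ spread (ι (suc i)) (ι (suc j)) (w (suc (i ℕ.+ j))) (w i) (w j) ⟩
      w (suc (i ℕ.+ j)) * ((ι (suc i) * w i) * w j + (ι (suc j) * w j) * w i)
        ≡⟨ cong₂ (λ x y → w (suc (i ℕ.+ j)) * (x * w j + y * w i)) (ι*w i) (ι*w j) ⟩
      w (suc (i ℕ.+ j)) * (1ℚ * w j + 1ℚ * w i)
        ≡⟨ one (w (suc (i ℕ.+ j))) (w i) (w j) ⟩
      w (suc (i ℕ.+ j)) * (w i + w j) ∎
  0≤sum : ∀ N → 0ℚ ≤ sum N (λ q → w q * w (N ℕ.∸ suc q))
  0≤sum N = recast-≤ (sum-mono N (λ q _ → 0≤* (w-nonNeg q) (w-nonNeg (N ℕ.∸ suc q)))) (sum-zero N) refl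
  0≤2 : 0ℚ ≤ 2ℚ
  0≤2 = <⇒≤ (positive⁻¹ 2ℚ)
  harmonic≤ : ∀ M → sum (suc M) (λ k → w k) ≤ suffixSum (1 ∷ []) (suc M)
  harmonic≤ M = recast-≤ (+-monoʳ-≤ (nestedSum (1 ∷ []) (suc M)) (<⇒≤ (positive⁻¹ 1ℚ)))
    (trans (+-identityʳ _) (trans (nestedSum-single 1 (suc M)) (sum-cong (suc M) (λ k → *-identityʳ (w k))))) refl
  bound≤ : ∀ N → ∣ sum N (λ q → w q * w (N ℕ.∸ suc q)) ∣ ≤ 2ℚ * R N
  bound≤ zero    = ≤-refl
  bound≤ (suc M) = begin
    ∣ sum (suc M) (λ q → w q * w (M ℕ.∸ q)) ∣     ≡⟨ 0≤p⇒∣p∣≡p (0≤sum (suc M)) ⟩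
    sum (suc M) (λ q → w q * w (M ℕ.∸ q))         ≡⟨ sum≡antidiagonal M (λ i j → w i * w j) ⟩
    antidiagonal (λ i j → w i * w j) M            ≡⟨ exact M ⟩
    w (suc M) * (2ℚ * sum (suc M) (λ k → w k))
      ≤⟨ *-monoˡ (w (suc M)) (w-nonNeg (suc M)) (*-monoˡ 2ℚ 0≤2 (harmonic≤ M)) ⟩
    w (suc M) * (2ℚ * suffixSum (1 ∷ []) (suc M))
      ≤⟨ *-monoʳ (2ℚ * suffixSum (1 ∷ []) (suc M)) (0≤* 0≤2 (suffixSum-nonNeg (1 ∷ []) (suc M))) (w-anti (ℕₚ.n≤1+n M)) ⟩
    w M * (2ℚ * suffixSum (1 ∷ []) (suc M))       ≡⟨ swap (w M) (suffixSum (1 ∷ []) (suc M)) ⟩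
    2ℚ * (suffixSum (1 ∷ []) (suc M) * w M)       ∎
    where
    swap : ∀ v s → v * (2ℚ * s) ≡ 2ℚ * (s * v)
    swap = solve-∀ ℚ-ring

-- Double counting over the square n, q ≤ N

module _ (c d : ℕ) where

  private
    a = suc (double c)
    b = double d
    s = suc a
    r = suc b

  open PartialFractions using (coefficient; expansionʳ)

  -- Summing over q first yields the Euler sum plainSum; expanding every term into partial
  -- fractions yields products of single sums.
  squareSum : ℕ → ℚ
  squareSum N = sum N (λ n → σ n * sum N (λ q → w n ^ s * (w⁺ q n ^ r + w⁻ q n ^ r)))

  -- Write Z for the partial zeta sums of exponent r and n for the 1-based index. As r is odd, the
  -- terms with q < n enter negatively, and the row is close to 2 Z(N) - Z(n) - Z(n - 1); the last
  -- two make up twice the half-weighted sum. Z(N) is left truncated because it has no limit when r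
  -- = 1.
  rowError : ℕ → ℕ → ℚ
  rowError N n = sum N (λ q → w⁺ q n ^ r + w⁻ q n ^ r) - (2ℚ * zetaSum r N - 2ℚ * halfSum r n)

  private
    rowError≡ : ∀ n m → let N = suc n ℕ.+ m in
      rowError N n ≡ (zetaSum r (suc n ℕ.+ N) - zetaSum r N) - (zetaSum r (suc n ℕ.+ m) - zetaSum r m)
    rowError≡ n m = begin-equality
      sum N (λ q → w⁺ q n ^ r + w⁻ q n ^ r) - (2ℚ * z N - 2ℚ * halfSum r n)
        ≡⟨ cong (_- (2ℚ * z N - 2ℚ * halfSum r n)) (sum-+ N (λ q → w⁺ q n ^ r) (λ q → w⁻ q n ^ r)) ⟩
      sum N (λ q → w⁺ q n ^ r) + sum N (λ q → w⁻ q n ^ r) - (2ℚ * z N - 2ℚ * halfSum r n)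
        ≡⟨ cong₂ (λ x y → x + y - (2ℚ * z N - 2ℚ * halfSum r n)) (sum-w⁺ b n N) (sum-w⁻ b n m) ⟩
      z (N ℕ.+ suc n) - (z n + p) + (σ r * z n + z m) - (2ℚ * z N - 2ℚ * (z n + ½ * p))
        ≡⟨ cong₂ (λ x y → x - (z n + p) + (- y * z n + z m) - (2ℚ * z N - 2ℚ * (z n + ½ * p)))
             (cong z (ℕₚ.+-comm N (suc n))) (σ-double d) ⟩
      z (suc n ℕ.+ N) - (z n + p) + (- 1ℚ * z n + z m) - (2ℚ * z N - 2ℚ * (z n + ½ * p))
        ≡⟨ collect (z (suc n ℕ.+ N)) (z n) p (z m) (z N) ⟩
      (z (suc n ℕ.+ N) - z N) - (z N - z m) ∎
      where
      N = suc n ℕ.+ m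
      z = zetaSum r
      p = w n ^ r
      collect : ∀ x y p t u → x - (y + p) + (- 1ℚ * y + t) - (2ℚ * u - 2ℚ * (y + ½ * p)) ≡ (x - u) - (u - t)
      collect = solve-∀ ℚ-ring

    rowError-bound : ∀ n m → ∣ rowError (suc n ℕ.+ m) n ∣ ≤ 2ℚ * (ι (suc n) * w m)
    rowError-bound n m = begin
      ∣ rowError N n ∣
        ≡⟨ cong ∣_∣ (rowError≡ n m) ⟩
      ∣ (zetaSum r (suc n ℕ.+ N) - zetaSum r N) - (zetaSum r (suc n ℕ.+ m) - zetaSum r m) ∣
        ≤⟨ ∣p-q∣≤∣p∣+∣q∣ (zetaSum r (suc n ℕ.+ N) - zetaSum r N) (zetaSum r (suc n ℕ.+ m) - zetaSum r m) ⟩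
      ∣ zetaSum r (suc n ℕ.+ N) - zetaSum r N ∣ + ∣ zetaSum r (suc n ℕ.+ m) - zetaSum r m ∣
        ≤⟨ +-mono-≤ (zeta-gap b N (suc n)) (zeta-gap b m (suc n)) ⟩
      ι (suc n) * w N + ι (suc n) * w m
        ≤⟨ +-monoˡ-≤ (ι (suc n) * w m) (*-monoˡ (ι (suc n)) (ι-nonNeg (suc n)) (w-anti (ℕₚ.m≤n+m m (suc n)))) ⟩
      ι (suc n) * w m + ι (suc n) * w m
        ≡⟨ twice (ι (suc n) * w m) ⟩
      2ℚ * (ι (suc n) * w m) ∎
      where
      N = suc n ℕ.+ m
      twice : ∀ x → x + x ≡ 2ℚ * x
      twice = solve-∀ ℚ-ring

    -- Of the at least two factors `w n`, one cancels the length `ι (suc n)` of the gap and another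
    -- survives, giving a term of the convolution in `convolution-null`.
    rowError-term : ∀ n m → ∣ σ n * (w n ^ s * rowError (suc n ℕ.+ m) n) ∣ ≤ 2ℚ * (w n * w m)
    rowError-term n m = begin
      ∣ σ n * (w n ^ s * e) ∣
        ≡⟨ ∣σ*∣ n (w n ^ s * e) ⟩
      ∣ w n ^ s * e ∣
        ≡⟨ ∣p*q∣≡∣p∣*∣q∣ (w n ^ s) e ⟩
      ∣ w n ^ s ∣ * ∣ e ∣
        ≡⟨ cong (_* ∣ e ∣) (0≤p⇒∣p∣≡p (w^-nonNeg n s)) ⟩
      w n ^ s * ∣ e ∣
        ≤⟨ *-monoˡ (w n ^ s) (w^-nonNeg n s) (rowError-bound n m) ⟩
      w n * (w n * p) * (2ℚ * (ι (suc n) * w m))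
        ≡⟨ regroup (w n) p (ι (suc n)) (w m) ⟩
      2ℚ * (w n * w m) * (ι (suc n) * w n) * p
        ≡⟨ cong (λ z → 2ℚ * (w n * w m) * z * p) (ι*w n) ⟩
      2ℚ * (w n * w m) * 1ℚ * p
        ≤⟨ *-monoˡ (2ℚ * (w n * w m) * 1ℚ) 0≤ (w^≤1 n (double c)) ⟩
      2ℚ * (w n * w m) * 1ℚ * 1ℚ
        ≡⟨ trans (*-identityʳ _) (*-identityʳ _) ⟩
      2ℚ * (w n * w m) ∎
      where
      e = rowError (suc n ℕ.+ m) n
      p = w n ^ double c
      regroup : ∀ u p i v → u * (u * p) * (2ℚ * (i * v)) ≡ 2ℚ * (u * v) * (i * u) * p
      regroup = solve-∀ ℚ-ring
      0≤ : 0ℚ ≤ 2ℚ * (w n * w m) * 1ℚ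
      0≤ = 0≤* (0≤* (<⇒≤ (positive⁻¹ 2ℚ)) (0≤* (w-nonNeg n) (w-nonNeg m))) (<⇒≤ (positive⁻¹ 1ℚ))

    split-N : ∀ {n N} → n ℕ.< N → suc n ℕ.+ (N ℕ.∸ suc n) ≡ N
    split-N n<N = ℕₚ.m+[n∸m]≡n n<N

  rowError-null : Null (λ N → sum N (λ n → σ n * (w n ^ s * rowError N n)))
  rowError-null = null-≤ (λ N → ≤-trans
        (∣sum∣≤-bound N (λ n n<N → subst (λ M → ∣ σ n * (w n ^ s * rowError M n) ∣ ≤ 2ℚ * (w n * w (N ℕ.∸ suc n)))
                                         (split-N n<N) (rowError-term n (N ℕ.∸ suc n))))
        (≤-reflexive (sum-*ˡ N 2ℚ (λ n → w n * w (N ℕ.∸ suc n)))))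
      (const*null 2ℚ convolution-null)

  squareSum-rows : ∀ N → squareSum N ≡ 2ℚ * (zetaSum r N * etaSum s N) - 2ℚ * plainSum N c d
                                     + sum N (λ n → σ n * (w n ^ s * rowError N n))
  squareSum-rows N = begin-equality
    squareSum N
      ≡⟨ sum-cong N term ⟩
    sum N (λ n → 2ℚ * z * x n - 2ℚ * y n + e n)
      ≡⟨ sum-+ N (λ n → 2ℚ * z * x n - 2ℚ * y n) e ⟩
    sum N (λ n → 2ℚ * z * x n - 2ℚ * y n) + sum N e
      ≡⟨ cong (_+ sum N e) (trans (sum-- N (λ n → 2ℚ * z * x n) (λ n → 2ℚ * y n))
           (cong₂ _-_ (sum-*ˡ N (2ℚ * z) x) (sum-*ˡ N 2ℚ y))) ⟩
    2ℚ * z * etaSum s N - 2ℚ * plainSum N c d + sum N e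
      ≡⟨ cong (λ t → t - 2ℚ * plainSum N c d + sum N e) (*-assoc 2ℚ z (etaSum s N)) ⟩
    2ℚ * (z * etaSum s N) - 2ℚ * plainSum N c d + sum N e ∎
    where
    z = zetaSum r N
    x y e : ℕ → ℚ
    x n = σ n * w n ^ s
    y n = σ n * (w n ^ s * halfSum r n)
    e n = σ n * (w n ^ s * rowError N n)
    expand : ∀ t p S z h → t * (p * S) ≡ 2ℚ * z * (t * p) - 2ℚ * (t * (p * h)) + t * (p * (S - (2ℚ * z - 2ℚ * h)))
    expand = solve-∀ ℚ-ring
    term : ∀ n → σ n * sum N (λ q → w n ^ s * (w⁺ q n ^ r + w⁻ q n ^ r)) ≡ 2ℚ * z * x n - 2ℚ * y n + e n
    term n = trans (cong (σ n *_) (sum-*ˡ N (w n ^ s) (λ q → w⁺ q n ^ r + w⁻ q n ^ r)))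
                   (expand (σ n) (w n ^ s) (sum N (λ q → w⁺ q n ^ r + w⁻ q n ^ r)) z (halfSum r n))

  columnSum : ℕ → ℕ → ℕ → ℚ
  columnSum l N q = sum N (λ n → σ n * (w⁺ q n ^ l + w⁻ q n ^ l))

  private
    sum-coefficient : ∀ N x i → sum N (λ q → coefficient (w q) x i) ≡ B x i * zetaSum (suc x ℕ.+ i) N
    sum-coefficient N x i = trans (sum-*ˡ N (B x i) (λ q → w q ^ suc x * w q ^ i))
      (cong (B x i *_) (sum-cong N (λ q → sym (^-homo-* (w q) (suc x) i))))

    evenPart : ℕ → ℕ → ℚ
    evenPart n q = antidiagonal (λ i j → coefficient (w q) b (double i) * w n ^ double (suc j)) c

    oddPart : ℕ → ℕ → ℚ
    oddPart n q = expansionʳ (w q) (w⁺ q n) a b + expansionʳ (w q) (w⁻ q n) a b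

    evenPart-sum : ∀ N → sum N (λ n → σ n * sum N (λ q → evenPart n q))
      ≡ antidiagonal (λ i j → B b (double i) * zetaSum (r ℕ.+ double i) N * etaSum (double (suc j)) N) c
    evenPart-sum N = begin-equality
      sum N (λ n → σ n * sum N (λ q → evenPart n q))
        ≡⟨ sum-cong N row ⟩
      sum N (λ n → antidiagonal (λ i j → X i * (σ n * w n ^ double (suc j))) c)
        ≡⟨ sum-antidiagonal N c (λ n i j → X i * (σ n * w n ^ double (suc j))) ⟩
      antidiagonal (λ i j → sum N (λ n → X i * (σ n * w n ^ double (suc j)))) c
        ≡⟨ antidiagonal-cong c (λ i j → sum-*ˡ N (X i) (λ n → σ n * w n ^ double (suc j))) ⟩
      antidiagonal (λ i j → X i * etaSum (double (suc j)) N) c ∎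
      where
      X : ℕ → ℚ
      X i = B b (double i) * zetaSum (r ℕ.+ double i) N
      swap : ∀ t x y → t * (x * y) ≡ x * (t * y)
      swap = solve-∀ ℚ-ring
      row : ∀ n → σ n * sum N (λ q → evenPart n q) ≡ antidiagonal (λ i j → X i * (σ n * w n ^ double (suc j))) c
      row n = begin-equality
        σ n * sum N (λ q → evenPart n q)
          ≡⟨ cong (σ n *_) (sum-antidiagonal N c (λ q i j → coefficient (w q) b (double i) * w n ^ double (suc j))) ⟩
        σ n * antidiagonal (λ i j → sum N (λ q → coefficient (w q) b (double i) * w n ^ double (suc j))) c
          ≡⟨ antidiagonal-*ˡ c (σ n) (λ i j → sum N (λ q → coefficient (w q) b (double i) * w n ^ double (suc j))) ⟨
        antidiagonal (λ i j → σ n * sum N (λ q → coefficient (w q) b (double i) * w n ^ double (suc j))) c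
          ≡⟨ antidiagonal-cong c (λ i j → trans (cong (σ n *_) (trans
               (sum-*ʳ N (w n ^ double (suc j)) (λ q → coefficient (w q) b (double i)))
               (cong (_* w n ^ double (suc j)) (sum-coefficient N b (double i)))))
               (swap (σ n) (X i) (w n ^ double (suc j)))) ⟩
        antidiagonal (λ i j → X i * (σ n * w n ^ double (suc j))) c ∎

    -- Here n occurs only in 1/(q + n) and 1/(q - n), so the signed sum over n is taken first,
    -- whereas `evenPart` separates into a function of q times one of n.
    oddPart-sum : ∀ N → sum N (λ n → σ n * sum N (λ q → oddPart n q))
      ≡ antidiagonal (λ i j → sum N (λ q → coefficient (w q) a i * columnSum (suc j) N q)) b
    oddPart-sum N = begin-equality
      sum N (λ n → σ n * sum N (λ q → oddPart n q))
        ≡⟨ sum-cong N (λ n → sym (sum-*ˡ N (σ n) (λ q → oddPart n q))) ⟩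
      sum N (λ n → sum N (λ q → σ n * oddPart n q))
        ≡⟨ sum-swap N N (λ n q → σ n * oddPart n q) ⟩
      sum N (λ q → sum N (λ n → σ n * oddPart n q))
        ≡⟨ sum-cong N column ⟩
      sum N (λ q → antidiagonal (λ i j → coefficient (w q) a i * columnSum (suc j) N q) b)
        ≡⟨ sum-antidiagonal N b (λ q i j → coefficient (w q) a i * columnSum (suc j) N q) ⟩
      antidiagonal (λ i j → sum N (λ q → coefficient (w q) a i * columnSum (suc j) N q)) b ∎
      where
      regroup : ∀ t k x y → t * (k * x + k * y) ≡ k * (t * (x + y))
      regroup = solve-∀ ℚ-ring
      cell : ∀ q n → σ n * oddPart n q
        ≡ antidiagonal (λ i j → coefficient (w q) a i * (σ n * (w⁺ q n ^ suc j + w⁻ q n ^ suc j))) b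
      cell q n = trans (cong (σ n *_) (sym (antidiagonal-+ b (λ i j → coefficient (w q) a i * w⁺ q n ^ suc j)
                                                            (λ i j → coefficient (w q) a i * w⁻ q n ^ suc j))))
        (trans (sym (antidiagonal-*ˡ b (σ n) (λ i j → coefficient (w q) a i * w⁺ q n ^ suc j + coefficient (w q) a i * w⁻ q n ^ suc j)))
               (antidiagonal-cong b (λ i j → regroup (σ n) (coefficient (w q) a i) (w⁺ q n ^ suc j) (w⁻ q n ^ suc j))))
      column : ∀ q → sum N (λ n → σ n * oddPart n q)
        ≡ antidiagonal (λ i j → coefficient (w q) a i * columnSum (suc j) N q) b
      column q = trans (sum-cong N (cell q))
        (trans (sum-antidiagonal N b (λ n i j → coefficient (w q) a i * (σ n * (w⁺ q n ^ suc j + w⁻ q n ^ suc j))))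
               (antidiagonal-cong b (λ i j → sum-*ˡ N (coefficient (w q) a i) (λ n → σ n * (w⁺ q n ^ suc j + w⁻ q n ^ suc j)))))

    diagonal-sum : ∀ N → sum N (λ n → σ n * sum N (λ q → kronecker q n * (B (suc b) a * (w n ^ s * w n ^ r))))
      ≡ B (suc b) a * etaSum (s ℕ.+ r) N
    diagonal-sum N = trans (sum-cong-< N term) (sum-*ˡ N (B (suc b) a) (λ n → σ n * w n ^ (s ℕ.+ r)))
      where
      swap : ∀ t k p → t * (1ℚ * (k * p)) ≡ k * (t * p)
      swap = solve-∀ ℚ-ring
      term : ∀ n → n ℕ.< N → σ n * sum N (λ q → kronecker q n * (B (suc b) a * (w n ^ s * w n ^ r)))
                           ≡ B (suc b) a * (σ n * w n ^ (s ℕ.+ r))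
      term n n<N = trans (cong (σ n *_) (sum-*ʳ N (B (suc b) a * (w n ^ s * w n ^ r)) (λ q → kronecker q n)))
        (trans (cong₂ (λ x y → σ n * (x * (B (suc b) a * y)))
                 (trans (cong (λ M → sum M (λ q → kronecker q n)) (sym (split-N n<N))) (sum-kronecker n (N ℕ.∸ suc n)))
                 (sym (^-homo-* (w n) s r)))
               (swap (σ n) (B (suc b) a) (w n ^ (s ℕ.+ r))))

  squareSum-columns : ∀ N → squareSum N
    ≡ 2ℚ * antidiagonal (λ i j → B b (double i) * zetaSum (r ℕ.+ double i) N * etaSum (double (suc j)) N) c
    + antidiagonal (λ i j → sum N (λ q → coefficient (w q) a i * columnSum (suc j) N q)) b
    - B (suc b) a * etaSum (s ℕ.+ r) N
  squareSum-columns N = begin-equality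
    squareSum N
      ≡⟨ sum-cong N (λ n → trans (cong (σ n *_) (row n)) (expand (σ n) (sum N (evenPart n)) (sum N (oddPart n)) (diag n))) ⟩
    sum N (λ n → 2ℚ * (σ n * sum N (evenPart n)) + σ n * sum N (oddPart n) - σ n * diag n)
      ≡⟨ sum-- N (λ n → 2ℚ * (σ n * sum N (evenPart n)) + σ n * sum N (oddPart n)) (λ n → σ n * diag n) ⟩
    sum N (λ n → 2ℚ * (σ n * sum N (evenPart n)) + σ n * sum N (oddPart n)) - sum N (λ n → σ n * diag n)
      ≡⟨ cong (_- sum N (λ n → σ n * diag n)) (trans
           (sum-+ N (λ n → 2ℚ * (σ n * sum N (evenPart n))) (λ n → σ n * sum N (oddPart n)))
           (cong (_+ sum N (λ n → σ n * sum N (oddPart n))) (sum-*ˡ N 2ℚ (λ n → σ n * sum N (evenPart n))))) ⟩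
    2ℚ * sum N (λ n → σ n * sum N (evenPart n)) + sum N (λ n → σ n * sum N (oddPart n)) - sum N (λ n → σ n * diag n)
      ≡⟨ cong₂ _-_ (cong₂ (λ x y → 2ℚ * x + y) (evenPart-sum N) (oddPart-sum N)) (diagonal-sum N) ⟩
    2ℚ * antidiagonal (λ i j → B b (double i) * zetaSum (r ℕ.+ double i) N * etaSum (double (suc j)) N) c
      + antidiagonal (λ i j → sum N (λ q → coefficient (w q) a i * columnSum (suc j) N q)) b
      - B (suc b) a * etaSum (s ℕ.+ r) N ∎
    where
    diag : ℕ → ℚ
    diag n = sum N (λ q → kronecker q n * (B (suc b) a * (w n ^ s * w n ^ r)))
    expand : ∀ t x y z → t * (2ℚ * x + y - z) ≡ 2ℚ * (t * x) + t * y - t * z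
    expand = solve-∀ ℚ-ring
    row : ∀ n → sum N (λ q → w n ^ s * (w⁺ q n ^ r + w⁻ q n ^ r))
              ≡ 2ℚ * sum N (evenPart n) + sum N (oddPart n) - diag n
    row n = begin-equality
      sum N (λ q → w n ^ s * (w⁺ q n ^ r + w⁻ q n ^ r))
        ≡⟨ sum-cong N (λ q → symmetric-partial-fractions c b (position q n)) ⟩
      sum N (λ q → 2ℚ * evenPart n q + oddPart n q - kronecker q n * (B (suc b) a * (w n ^ s * w n ^ r)))
        ≡⟨ sum-- N (λ q → 2ℚ * evenPart n q + oddPart n q) (λ q → kronecker q n * (B (suc b) a * (w n ^ s * w n ^ r))) ⟩
      sum N (λ q → 2ℚ * evenPart n q + oddPart n q) - diag n
        ≡⟨ cong (_- diag n) (trans (sum-+ N (λ q → 2ℚ * evenPart n q) (oddPart n))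
             (cong (_+ sum N (oddPart n)) (sum-*ˡ N 2ℚ (evenPart n)))) ⟩
      2ℚ * sum N (evenPart n) + sum N (oddPart n) - diag n ∎

-- With k = c + j + 1 this is the binomial of 2k over 2j + 1 times an eta sum of weight 2k + 1.
-- Likewise `zetaTerm d N i`, with k = d + i, is the binomial of 2k over 2i times a zeta sum of
-- weight 2k + 1. These become the two binomials of `c` in the statement.
etaTerm : ℕ → ℕ → ℕ → ℚ
etaTerm c N j = B (suc (double c)) (suc (double j)) * etaSum (double (suc c) ℕ.+ suc (double j)) N

zetaTerm : ℕ → ℕ → ℕ → ℚ
zetaTerm d N i = B (double d) (double i) * zetaSum (suc (double d) ℕ.+ double i) N

-- Evaluation of the alternating Euler sums

module _ (c d : ℕ) where

  private
    a = suc (double c)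
    b = double d
    s = suc a
    r = suc b

  open PartialFractions using (coefficient)

  -- The eta sums up to q coming from 1/(q + n) and from 1/(q - n) cancel except for the term at q
  -- itself, whose sign squares to 1 and which leaves `w q ^ suc l`. The other two eta sums run
  -- almost to N and combine with the factor `1ℚ + σ (suc l)`.
  columnError : ℕ → ℕ → ℕ → ℚ
  columnError l N q = columnSum c d (suc l) N q
    - (w q ^ suc l - σ q * ((1ℚ + σ (suc l)) * etaSum (suc l) N))

  private
    columnError≡ : ∀ l q m → let N = suc q ℕ.+ m in columnError l N q
      ≡ - σ q * ((etaSum (suc l) (suc q ℕ.+ N) - etaSum (suc l) N)
                - σ (suc l) * (etaSum (suc l) (suc q ℕ.+ m) - etaSum (suc l) m))
    columnError≡ l q m = begin-equality
      sum N (λ n → σ n * (w⁺ q n ^ suc l + w⁻ q n ^ suc l)) - T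
        ≡⟨ cong (_- T) (trans (sum-cong N (λ n → *-distribˡ-+ (σ n) (w⁺ q n ^ suc l) (w⁻ q n ^ suc l)))
             (sum-+ N (λ n → σ n * w⁺ q n ^ suc l) (λ n → σ n * w⁻ q n ^ suc l))) ⟩
      sum N (λ n → σ n * w⁺ q n ^ suc l) + sum N (λ n → σ n * w⁻ q n ^ suc l) - T
        ≡⟨ cong₂ (λ x y → x + y - T) (sum-σ-w⁺ l q N) (sum-σ-w⁻ l q m) ⟩
      - σ q * (η (N ℕ.+ suc q) - (η q + σ q * p)) + - σ q * (η q + t * η m) - T
        ≡⟨ cong (λ k → - σ q * (η k - (η q + σ q * p)) + - σ q * (η q + t * η m) - T) (ℕₚ.+-comm N (suc q)) ⟩
      - σ q * (η (suc q ℕ.+ N) - (η q + σ q * p)) + - σ q * (η q + t * η m) - T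
        ≡⟨ split (σ q) (η (suc q ℕ.+ N)) (η q) p t (η m) T ⟩
      σ q * σ q * p - σ q * (η (suc q ℕ.+ N) + t * η m) - T
        ≡⟨ cong (λ z → z * p - σ q * (η (suc q ℕ.+ N) + t * η m) - T) (σ*σ q) ⟩
      1ℚ * p - σ q * (η (suc q ℕ.+ N) + t * η m) - (p - σ q * ((1ℚ + t) * η N))
        ≡⟨ collect (σ q) (η (suc q ℕ.+ N)) p t (η m) (η N) ⟩
      - σ q * ((η (suc q ℕ.+ N) - η N) - t * (η N - η m)) ∎
      where
      N = suc q ℕ.+ m
      η = etaSum (suc l)
      t = σ (suc l)
      p = w q ^ suc l
      T = p - σ q * ((1ℚ + t) * η N)
      split : ∀ s x y p t z T → - s * (x - (y + s * p)) + - s * (y + t * z) - T ≡ s * s * p - s * (x + t * z) - T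
      split = solve-∀ ℚ-ring
      collect : ∀ s x p t z y → 1ℚ * p - s * (x + t * z) - (p - s * ((1ℚ + t) * y)) ≡ - s * ((x - y) - t * (y - z))
      collect = solve-∀ ℚ-ring

    columnError-bound : ∀ l q m → ∣ columnError l (suc q ℕ.+ m) q ∣ ≤ 2ℚ * w m
    columnError-bound l q m = begin
      ∣ columnError l N q ∣
        ≡⟨ cong ∣_∣ (trans (columnError≡ l q m) (neg-out (σ q) (x - t * y))) ⟩
      ∣ - (σ q * (x - t * y)) ∣
        ≡⟨ trans (∣-p∣≡∣p∣ (σ q * (x - t * y))) (∣σ*∣ q (x - t * y)) ⟩
      ∣ x - t * y ∣
        ≤⟨ ∣p-q∣≤∣p∣+∣q∣ x (t * y) ⟩
      ∣ x ∣ + ∣ t * y ∣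
        ≡⟨ cong (∣ x ∣ +_) (∣σ*∣ (suc l) y) ⟩
      ∣ x ∣ + ∣ y ∣
        ≤⟨ +-mono-≤ (eta-gap l N (suc q)) (eta-gap l m (suc q)) ⟩
      w N + w m
        ≤⟨ +-monoˡ-≤ (w m) (w-anti (ℕₚ.m≤n+m m (suc q))) ⟩
      w m + w m
        ≡⟨ twice (w m) ⟩
      2ℚ * w m ∎
      where
      N = suc q ℕ.+ m
      t = σ (suc l)
      x = etaSum (suc l) (suc q ℕ.+ N) - etaSum (suc l) N
      y = etaSum (suc l) (suc q ℕ.+ m) - etaSum (suc l) m
      neg-out : ∀ s x → - s * x ≡ - (s * x)
      neg-out = solve-∀ ℚ-ring
      twice : ∀ x → x + x ≡ 2ℚ * x
      twice = solve-∀ ℚ-ring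

    B-nonNeg : ∀ b i → 0ℚ ≤ B b i
    B-nonNeg zero    i       = <⇒≤ (positive⁻¹ 1ℚ)
    B-nonNeg (suc b) zero    = <⇒≤ (positive⁻¹ 1ℚ)
    B-nonNeg (suc b) (suc i) = 0≤+ (B-nonNeg (suc b) i) (B-nonNeg b (suc i))

    coefficient-nonNeg : ∀ q i → 0ℚ ≤ coefficient (w q) a i
    coefficient-nonNeg q i = 0≤* (B-nonNeg a i) (0≤* (w^-nonNeg q s) (w^-nonNeg q i))

    coefficient≤ : ∀ q i → coefficient (w q) a i ≤ B a i * w q
    coefficient≤ q i = *-monoˡ (B a i) (B-nonNeg a i) (≤-trans
      (*-monoˡ (w q ^ s) (w^-nonNeg q s) (w^≤1 q i))
      (recast-≤ (*-monoˡ (w q) (w-nonNeg q) (w^≤1 q a)) (sym (*-identityʳ (w q ^ s))) (*-identityʳ (w q))))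

    columnError-term : ∀ i l q m → ∣ coefficient (w q) a i * columnError l (suc q ℕ.+ m) q ∣ ≤ B a i * 2ℚ * (w q * w m)
    columnError-term i l q m = begin
      ∣ k * e ∣
        ≡⟨ trans (∣p*q∣≡∣p∣*∣q∣ k e) (cong (_* ∣ e ∣) (0≤p⇒∣p∣≡p (coefficient-nonNeg q i))) ⟩
      k * ∣ e ∣
        ≤⟨ *-monoˡ k (coefficient-nonNeg q i) (columnError-bound l q m) ⟩
      k * (2ℚ * w m)
        ≤⟨ *-monoʳ (2ℚ * w m) (0≤* (<⇒≤ (positive⁻¹ 2ℚ)) (w-nonNeg m)) (coefficient≤ q i) ⟩
      B a i * w q * (2ℚ * w m)
        ≡⟨ regroup (B a i) (w q) (w m) ⟩
      B a i * 2ℚ * (w q * w m) ∎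
      where
      k = coefficient (w q) a i
      e = columnError l (suc q ℕ.+ m) q
      regroup : ∀ x u v → x * u * (2ℚ * v) ≡ x * 2ℚ * (u * v)
      regroup = solve-∀ ℚ-ring

    columnError-null : ∀ i l → Null (λ N → sum N (λ q → coefficient (w q) a i * columnError l N q))
    columnError-null i l = null-≤ (λ N → ≤-trans
        (∣sum∣≤-bound N (λ q q<N → subst (λ M → ∣ coefficient (w q) a i * columnError l M q ∣ ≤ B a i * 2ℚ * (w q * w (N ℕ.∸ suc q)))
                                         (ℕₚ.m+[n∸m]≡n q<N) (columnError-term i l q (N ℕ.∸ suc q))))
        (≤-reflexive (sum-*ˡ N (B a i * 2ℚ) (λ q → w q * w (N ℕ.∸ suc q)))))
      (const*null (B a i * 2ℚ) convolution-null)

  columnTerm : ℕ → ℕ → ℕ → ℚ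
  columnTerm i l N = B a i * zetaSum (s ℕ.+ i ℕ.+ suc l) N
                   - B a i * etaSum (s ℕ.+ i) N * ((1ℚ + σ (suc l)) * etaSum (suc l) N)

  column~ : ∀ i l → (λ N → sum N (λ q → coefficient (w q) a i * columnSum c d (suc l) N q)) ~ columnTerm i l
  column~ i l = mk~ (null-cong (λ N → sym (difference N)) (columnError-null i l))
    where
    difference : ∀ N → sum N (λ q → coefficient (w q) a i * columnSum c d (suc l) N q) - columnTerm i l N
                     ≡ sum N (λ q → coefficient (w q) a i * columnError l N q)
    difference N = begin-equality
      sum N (λ q → k q * S q) - (B a i * zetaSum (s ℕ.+ i ℕ.+ suc l) N - B a i * etaSum (s ℕ.+ i) N * Y)
        ≡⟨ cong₂ (λ x y → sum N (λ q → k q * S q) - (x - y * Y)) ζ-sum η-sum ⟨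
      sum N (λ q → k q * S q) - (sum N (λ q → k q * w q ^ suc l) - sum N (λ q → k q * σ q) * Y)
        ≡⟨ cong (λ z → sum N (λ q → k q * S q) - (sum N (λ q → k q * w q ^ suc l) - z)) (sum-*ʳ N Y (λ q → k q * σ q)) ⟨
      sum N (λ q → k q * S q) - (sum N (λ q → k q * w q ^ suc l) - sum N (λ q → k q * σ q * Y))
        ≡⟨ cong (λ z → sum N (λ q → k q * S q) - z) (sum-- N (λ q → k q * w q ^ suc l) (λ q → k q * σ q * Y)) ⟨
      sum N (λ q → k q * S q) - sum N (λ q → k q * w q ^ suc l - k q * σ q * Y)
        ≡⟨ sum-- N (λ q → k q * S q) (λ q → k q * w q ^ suc l - k q * σ q * Y) ⟨
      sum N (λ q → k q * S q - (k q * w q ^ suc l - k q * σ q * Y))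
        ≡⟨ sum-cong N (λ q → gather (k q) (S q) (w q ^ suc l) (σ q) Y) ⟩
      sum N (λ q → k q * columnError l N q) ∎
      where
      k S : ℕ → ℚ
      k q = coefficient (w q) a i
      S q = columnSum c d (suc l) N q
      Y = (1ℚ + σ (suc l)) * etaSum (suc l) N
      gather : ∀ k S p s Y → k * S - (k * p - k * s * Y) ≡ k * (S - (p - s * Y))
      gather = solve-∀ ℚ-ring
      swap : ∀ x y z → x * y * z ≡ x * (z * y)
      swap = solve-∀ ℚ-ring
      ζ-sum : sum N (λ q → k q * w q ^ suc l) ≡ B a i * zetaSum (s ℕ.+ i ℕ.+ suc l) N
      ζ-sum = trans (sum-cong N (λ q → trans (*-assoc (B a i) (w q ^ s * w q ^ i) (w q ^ suc l))
          (cong (B a i *_) (trans (cong (_* w q ^ suc l) (sym (^-homo-* (w q) s i)))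
                                  (sym (^-homo-* (w q) (s ℕ.+ i) (suc l)))))))
        (sum-*ˡ N (B a i) (λ q → w q ^ (s ℕ.+ i ℕ.+ suc l)))
      η-sum : sum N (λ q → k q * σ q) ≡ B a i * etaSum (s ℕ.+ i) N
      η-sum = trans (sum-cong N (λ q → trans (swap (B a i) (w q ^ s * w q ^ i) (σ q))
          (cong (λ z → B a i * (σ q * z)) (sym (^-homo-* (w q) s i)))))
        (sum-*ˡ N (B a i) (λ q → σ q * w q ^ (s ℕ.+ i)))

  private
    columnTerms : ∀ N → antidiagonal (λ i j → columnTerm i j N) b
      ≡ B (suc a) b * zetaSum (s ℕ.+ r) N
      - antidiagonal (λ i j → B a i * etaSum (s ℕ.+ i) N * ((1ℚ + σ (suc j)) * etaSum (suc j) N)) b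
    columnTerms N = trans (antidiagonal-- b (λ i j → B a i * zetaSum (s ℕ.+ i ℕ.+ suc j) N) M)
      (cong (_- antidiagonal M b) (trans (antidiagonal-cong-≡ b weight)
        (trans (antidiagonal-*ʳ b (zetaSum (s ℕ.+ r) N) (λ i j → B a i))
               (cong (_* zetaSum (s ℕ.+ r) N) (hockey-stick a b)))))
      where
      M : ℕ → ℕ → ℚ
      M i j = B a i * etaSum (s ℕ.+ i) N * ((1ℚ + σ (suc j)) * etaSum (suc j) N)
      weight : ∀ i j → i ℕ.+ j ≡ b → B a i * zetaSum (s ℕ.+ i ℕ.+ suc j) N ≡ B a i * zetaSum (s ℕ.+ r) N
      weight i j i+j≡b = cong (λ k → B a i * zetaSum k N) (trans (ℕₚ.+-assoc s i (suc j))
        (cong (s ℕ.+_) (trans (ℕₚ.+-suc i j) (cong suc i+j≡b))))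

    -- The factor `1ℚ + σ (suc j)` is 0 at odd weight and 2 at even weight, where it turns the eta
    -- sum into `τ`. The subtracted `etaTerm` completes the convolution by its `τ N 0` term; in
    -- `twice-plainSum` it cancels against the contribution of the diagonal q = n.
    odd-part : ∀ N e → antidiagonal (λ i j → B a i * etaSum (s ℕ.+ i) N * ((1ℚ + σ (suc j)) * etaSum (suc j) N)) (double e)
      ≡ antidiagonal (λ i j → τ N i * etaTerm c N j) e - etaTerm c N e
    odd-part N zero    = vanish (B a 0 * etaSum (s ℕ.+ 0) N) (etaSum 1 N) (etaTerm c N 0)
      where
      vanish : ∀ x y z → x * ((1ℚ + - 1ℚ) * y) ≡ 1ℚ * z - z
      vanish = solve-∀ ℚ-ring
    odd-part N (suc e) = begin-equality
      antidiagonal M (double (suc e))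
        ≡⟨ antidiagonal-even e M ⟩
      antidiagonal (λ i j → M (double i) (double j)) (suc e) + antidiagonal (λ i j → M (suc (double i)) (suc (double j))) e
        ≡⟨ cong₂ _+_ (trans (antidiagonal-cong (suc e) even) (antidiagonal-*ˡ (suc e) 0ℚ (λ _ _ → 0ℚ)))
                     (trans (antidiagonal-cong e odd) (antidiagonal-flip e (λ i j → τ N (suc j) * etaTerm c N i))) ⟩
      0ℚ * antidiagonal (λ _ _ → 0ℚ) (suc e) + X
        ≡⟨ regroup (antidiagonal (λ _ _ → 0ℚ) (suc e)) X (etaTerm c N (suc e)) ⟩
      1ℚ * etaTerm c N (suc e) + X - etaTerm c N (suc e) ∎
      where
      M : ℕ → ℕ → ℚ
      M i j = B a i * etaSum (s ℕ.+ i) N * ((1ℚ + σ (suc j)) * etaSum (suc j) N)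
      X = antidiagonal (λ i j → τ N (suc i) * etaTerm c N j) e
      regroup : ∀ z x y → 0ℚ * z + x ≡ 1ℚ * y + x - y
      regroup = solve-∀ ℚ-ring
      even : ∀ i j → M (double i) (double j) ≡ 0ℚ * 0ℚ
      even i j = trans (cong (λ t → k * ((1ℚ + - t) * η)) (σ-double j)) (vanish k η)
        where
        k = B a (double i) * etaSum (s ℕ.+ double i) N
        η = etaSum (suc (double j)) N
        vanish : ∀ x y → x * ((1ℚ + - 1ℚ) * y) ≡ 0ℚ * 0ℚ
        vanish = solve-∀ ℚ-ring
      odd : ∀ i j → M (suc (double i)) (suc (double j)) ≡ τ N (suc j) * etaTerm c N i
      odd i j = trans (cong (λ t → k * ((1ℚ + t) * η)) (σ-double (suc j))) (double-up k η)
        where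
        k = B a (suc (double i)) * etaSum (s ℕ.+ suc (double i)) N
        η = etaSum (double (suc j)) N
        double-up : ∀ x y → x * ((1ℚ + 1ℚ) * y) ≡ 2ℚ * y * x
        double-up = solve-∀ ℚ-ring

    -- The term i = 0 contains `zetaSum r N`, unbounded when r = 1, and is isolated because the same
    -- product occurs in `squareSum-rows`. The subtracted `zetaTerm` completes the convolution by
    -- its `τ N 0` term and cancels against the zeta term of `columnTerms`.
    even-part : ∀ N → 2ℚ * antidiagonal (λ i j → B b (double i) * zetaSum (r ℕ.+ double i) N * etaSum (double (suc j)) N) c
      ≡ 2ℚ * (zetaSum r N * etaSum s N) + antidiagonal (λ i j → τ N i * zetaTerm d N (suc j)) c - zetaTerm d N (suc c)
    even-part N = begin-equality
      2ℚ * antidiagonal (λ i j → zetaTerm d N i * etaSum (double (suc j)) N) c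
        ≡⟨ antidiagonal-*ˡ c 2ℚ (λ i j → zetaTerm d N i * etaSum (double (suc j)) N) ⟨
      antidiagonal (λ i j → 2ℚ * (zetaTerm d N i * etaSum (double (suc j)) N)) c
        ≡⟨ antidiagonal-cong c (λ i j → swap (zetaTerm d N i) (etaSum (double (suc j)) N)) ⟩
      antidiagonal (λ i j → τ N (suc j) * zetaTerm d N i) c
        ≡⟨ antidiagonal-flip c (λ i j → τ N (suc j) * zetaTerm d N i) ⟩
      antidiagonal (λ i j → τ N (suc i) * zetaTerm d N j) c
        ≡⟨ isolate (τ N 0 * zetaTerm d N (suc c)) _ ⟩
      τ N 0 * zetaTerm d N (suc c) + antidiagonal (λ i j → τ N (suc i) * zetaTerm d N j) c - τ N 0 * zetaTerm d N (suc c)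
        ≡⟨ cong (_- τ N 0 * zetaTerm d N (suc c)) (antidiagonal-last c (λ i j → τ N i * zetaTerm d N j)) ⟩
      antidiagonal (λ i j → τ N i * zetaTerm d N (suc j)) c + τ N (suc c) * zetaTerm d N 0 - τ N 0 * zetaTerm d N (suc c)
        ≡⟨ cong₂ (λ x k → Q + τ N (suc c) * (x * zetaSum k N) - 1ℚ * zetaTerm d N (suc c)) (B-zeroʳ b) (ℕₚ.+-identityʳ r) ⟩
      Q + 2ℚ * etaSum s N * (1ℚ * zetaSum r N) - 1ℚ * zetaTerm d N (suc c)
        ≡⟨ finish Q (etaSum s N) (zetaSum r N) (zetaTerm d N (suc c)) ⟩
      2ℚ * (zetaSum r N * etaSum s N) + Q - zetaTerm d N (suc c) ∎
      where
      Q = antidiagonal (λ i j → τ N i * zetaTerm d N (suc j)) c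
      swap : ∀ x y → 2ℚ * (x * y) ≡ 2ℚ * y * x
      swap = solve-∀ ℚ-ring
      isolate : ∀ x y → y ≡ x + y - x
      isolate = solve-∀ ℚ-ring
      finish : ∀ q e z t → q + 2ℚ * e * (1ℚ * z) - 1ℚ * t ≡ 2ℚ * (z * e) + q - t
      finish = solve-∀ ℚ-ring

    τη τζ : ℕ → ℚ
    τη N = antidiagonal (λ i j → τ N i * etaTerm c N j) d
    τζ N = antidiagonal (λ i j → τ N i * zetaTerm d N (suc j)) c

    columns : ℕ → ℚ
    columns N = antidiagonal (λ i j → sum N (λ q → coefficient (w q) a i * columnSum c d (suc j) N q)) b

    columnTerms≡ : ∀ N → antidiagonal (λ i j → columnTerm i j N) b
      ≡ zetaTerm d N (suc c) - (τη N - etaTerm c N d)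
    columnTerms≡ N = trans (columnTerms N) (cong₂ _-_
      (cong₂ (λ x k → x * zetaSum k N) (B-sym (suc a) b) (ℕₚ.+-comm s r)) (odd-part N d))

    -- Equating the row and column evaluations of `squareSum` gives this with no limit taken: the
    -- possibly divergent product is already gone, and the bracket collects exactly the two errors
    -- known to be null.
    twice-plainSum : ∀ N → 2ℚ * plainSum N c d ≡ τη N - τζ N
      + (sum N (λ n → σ n * (w n ^ s * rowError c d N n)) - (columns N - antidiagonal (λ i j → columnTerm i j N) b))
    twice-plainSum N = begin-equality
      2ℚ * plainSum N c d
        ≡⟨ solve-for (2ℚ * (zetaSum r N * etaSum s N)) (2ℚ * plainSum N c d) E ⟩
      2ℚ * (zetaSum r N * etaSum s N) + E - (2ℚ * (zetaSum r N * etaSum s N) - 2ℚ * plainSum N c d + E)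
        ≡⟨ cong (λ z → 2ℚ * (zetaSum r N * etaSum s N) + E - z)
             (trans (sym (squareSum-rows c d N)) (squareSum-columns c d N)) ⟩
      2ℚ * (zetaSum r N * etaSum s N) + E
        - (2ℚ * antidiagonal (λ i j → zetaTerm d N i * etaSum (double (suc j)) N) c
           + columns N - B (suc b) a * etaSum (s ℕ.+ r) N)
        ≡⟨ cong₂ (λ x y → 2ℚ * (zetaSum r N * etaSum s N) + E - (x + columns N - y * etaSum (s ℕ.+ r) N))
             (even-part N) (B-sym (suc b) a) ⟩
      2ℚ * (zetaSum r N * etaSum s N) + E
        - (2ℚ * (zetaSum r N * etaSum s N) + τζ N - zetaTerm d N (suc c) + columns N - etaTerm c N d)
        ≡⟨ rearrange (2ℚ * (zetaSum r N * etaSum s N)) E (τζ N) (zetaTerm d N (suc c)) (columns N)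
             (etaTerm c N d) (τη N) ⟩
      τη N - τζ N + (E - (columns N - (zetaTerm d N (suc c) - (τη N - etaTerm c N d))))
        ≡⟨ cong (λ z → τη N - τζ N + (E - (columns N - z))) (columnTerms≡ N) ⟨
      τη N - τζ N + (E - (columns N - antidiagonal (λ i j → columnTerm i j N) b)) ∎
      where
      E = sum N (λ n → σ n * (w n ^ s * rowError c d N n))
      solve-for : ∀ x y e → y ≡ x + e - (x - y + e)
      solve-for = solve-∀ ℚ-ring
      rearrange : ∀ x e q g t f p → x + e - (x + q - g + t - f) ≡ p - q + (e - (t - (g - (p - f))))
      rearrange = solve-∀ ℚ-ring

  plainSum~ : (λ N → 2ℚ * plainSum N c d) ~ (λ N → antidiagonal (λ i j → τ N i * etaTerm c N j) d
                                                 - antidiagonal (λ i j → τ N i * zetaTerm d N (suc j)) c)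
  plainSum~ = ~-trans (≗⇒~ twice-plainSum) (mk~ (null-cong (λ N → drop (τη N - τζ N) _)
      (null-+ (rowError-null c d) (null-neg (diff-null (~-antidiagonal b (λ i j → column~ i j)))))))
    where
    drop : ∀ x y → y ≡ x + y - x
    drop = solve-∀ ℚ-ring

-- Assembling the evaluation

seq-∑ℝ : ∀ K (f : (k : ℕ) → .{{ℕ.NonZero k}} → ℝ) N → seq (∑ℝ K f) N ≡ ∑ℚ K (λ k → seq (f k) N)
seq-∑ℝ zero    f N = refl
seq-∑ℝ (suc K) f N = cong (_+ seq (f (suc K)) N) (seq-∑ℝ K f N)

reverse-replicate : ∀ n (x : ℕ) → reverse (replicate n x) ≡ replicate n x
reverse-replicate zero    x = refl
reverse-replicate (suc n) x = trans (unfold-reverse x (replicate n x))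
  (trans (cong (λ xs → xs ++ x ∷ []) (reverse-replicate n x)) (snoc n))
  where
  snoc : ∀ n → replicate n x ++ x ∷ [] ≡ x ∷ replicate n x
  snoc zero    = refl
  snoc (suc n) = cong (x ∷_) (snoc n)

reverse-twos-3-twos : ∀ a b → reverse (replicate a 2 ++ 3 ∷ replicate b 2) ≡ replicate b 2 ++ 3 ∷ replicate a 2
reverse-twos-3-twos a b =
  trans (reverse-++ (replicate a 2) (3 ∷ replicate b 2))
 (trans (cong₂ _++_ (unfold-reverse 3 (replicate b 2)) (reverse-replicate a 2))
 (trans (cong (λ xs → (xs ++ 3 ∷ []) ++ replicate a 2) (reverse-replicate b 2))
        (++-assoc (replicate b 2) (3 ∷ []) (replicate a 2))))

twos : ℕ → ℕ → ℚ
twos n N = nestedSum (replicate n 2) N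

seq-H : ∀ n N → seq (H n) N ≡ twos n N
seq-H zero    N = refl
seq-H (suc n) N = cong (λ ks → nestedSum ks N) (reverse-replicate (suc n) 2)

bounded-twos : ∀ n → Bounded (twos n)
bounded-twos n = cauchy⇒bounded (cauchy-cong (seq-H n) (cauchy (H n)))

sign≡σ : ∀ k → sign k ≡ σ k
sign≡σ zero    = refl
sign≡σ (suc k) = trans (neg-/1 (ℤ.-1ℤ ℤ.^ k)) (cong -_ (sign≡σ k))
  where
  neg-/1 : ∀ z → (ℤ.-1ℤ ℤ.* z) / 1 ≡ - (z / 1)
  neg-/1 z = trans (cong (_/ 1) (ℤₚ.-1*i≡-i z)) (toℚᵘ-injective (ℚᵘₚ.≃-trans (toℚᵘ-/ (ℤ.- z) 0)
    (ℚᵘₚ.≃-sym (ℚᵘₚ.≃-trans (toℚᵘ-homo‿- (z / 1)) (ℚᵘₚ.-‿cong (toℚᵘ-/ z 0))))))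

euler-0 : ∀ N a → euler N (λ _ → 0ℚ) a ≡ 0ℚ
euler-0 zero    a       = refl
euler-0 (suc N) zero    = euler-0 N zero
euler-0 (suc N) (suc a) = trans (cong₂ (λ y z → y - w N * w N * z) (euler-0 N (suc a)) (euler-0 N a)) (vanish (w N))
  where
  vanish : ∀ v → 0ℚ - v * v * 0ℚ ≡ 0ℚ
  vanish = solve-∀ ℚ-ring

euler-*ˡ : ∀ N s f a → euler N (λ i → s * f i) a ≡ s * euler N f a
euler-*ˡ N s f a = begin-equality
  euler N (λ i → s * f i) a              ≡⟨ euler-cong N (λ i → +-identityˡ (s * f i)) a ⟨
  euler N (λ i → 0ℚ + s * f i) a         ≡⟨ euler-linear N s (λ _ → 0ℚ) f a ⟩
  euler N (λ _ → 0ℚ) a + s * euler N f a ≡⟨ cong (_+ s * euler N f a) (euler-0 N a) ⟩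
  0ℚ + s * euler N f a                   ≡⟨ +-identityˡ (s * euler N f a) ⟩
  s * euler N f a                        ∎

euler-- : ∀ N f g a → euler N (λ i → f i - g i) a ≡ euler N f a - euler N g a
euler-- N f g a = begin-equality
  euler N (λ i → f i - g i) a           ≡⟨ euler-cong N (λ i → cong (λ z → f i + z) (-≡-1* (g i))) a ⟩
  euler N (λ i → f i + -1ℚ * g i) a     ≡⟨ euler-linear N -1ℚ f g a ⟩
  euler N f a + -1ℚ * euler N g a       ≡⟨ cong (λ z → euler N f a + z) (-≡-1* (euler N g a)) ⟨
  euler N f a - euler N g a             ∎

euler-inside : ∀ N (k : ℕ → ℚ) (G : ℕ → ℕ → ℚ) d a →
  euler N (λ c → antidiagonal (λ i j → k i * G c j) d) a ≡ antidiagonal (λ i j → k i * euler N (λ c → G c j) a) d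
euler-inside N k G zero    a = euler-*ˡ N (k 0) (λ c → G c 0) a
euler-inside N k G (suc d) a = begin-equality
  euler N (λ c → k 0 * G c (suc d) + antidiagonal (λ i j → k (suc i) * G c j) d) a
    ≡⟨ euler-cong N (λ c → +-comm (k 0 * G c (suc d)) (antidiagonal (λ i j → k (suc i) * G c j) d)) a ⟩
  euler N (λ c → antidiagonal (λ i j → k (suc i) * G c j) d + k 0 * G c (suc d)) a
    ≡⟨ euler-linear N (k 0) (λ c → antidiagonal (λ i j → k (suc i) * G c j) d) (λ c → G c (suc d)) a ⟩
  euler N (λ c → antidiagonal (λ i j → k (suc i) * G c j) d) a + k 0 * euler N (λ c → G c (suc d)) a
    ≡⟨ cong (_+ k 0 * euler N (λ c → G c (suc d)) a) (euler-inside N (λ i → k (suc i)) G d a) ⟩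
  antidiagonal (λ i j → k (suc i) * euler N (λ c → G c j) a) d + k 0 * euler N (λ c → G c (suc d)) a
    ≡⟨ +-comm (antidiagonal (λ i j → k (suc i) * euler N (λ c → G c j) a) d) (k 0 * euler N (λ c → G c (suc d)) a) ⟩
  k 0 * euler N (λ c → G c (suc d)) a + antidiagonal (λ i j → k (suc i) * euler N (λ c → G c j) a) d ∎

~-euler : ∀ a {f g : ℕ → ℕ → ℚ} → (∀ i → (λ N → f N i) ~ (λ N → g N i)) → (λ N → euler N (f N) a) ~ (λ N → euler N (g N) a)
~-euler a {f} {g} f~g = ~-trans (≗⇒~ (λ N → euler-convolution N (f N) a))
  (~-trans (~-antidiagonal a (λ i j → ~-*ˡ (bounded-euler-δ i) (f~g j)))
           (≗⇒~ (λ N → sym (euler-convolution N (g N) a))))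
  where
  bounded-euler-δ : ∀ i → Bounded (λ N → euler N δ i)
  bounded-euler-δ i = bounded-cong (λ N → sym (euler-δ N i)) (bounded-* (bounded-const (σ i)) (bounded-twos i))

bounded-zetaSum : ∀ s → Bounded (zetaSum (suc (suc s)))
bounded-zetaSum s = cauchy⇒bounded (zetaSum-cauchy {suc (suc s)} (s≤s (s≤s z≤n)))

bounded-etaSum : ∀ s → Bounded (etaSum (suc s))
bounded-etaSum s = mkBounded (0 , 1ℚ , positive⁻¹ 1ℚ , λ N _ →
  recast-≤ (eta-gap s 0 N) (cong ∣_∣ (trans (+-identityʳ (etaSum (suc s) (N ℕ.+ 0))) (cong (etaSum (suc s)) (ℕₚ.+-identityʳ N)))) refl)

private
  h-side τ-side : ℕ → ℕ → ℕ → ℚ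
  h-side c d N = antidiagonal (λ i j → h N i * (2ℚ * etaTerm c N j)) d
               - antidiagonal (λ i j → h N i * (2ℚ * zetaTerm d N (suc j))) c
  τ-side c d N = antidiagonal (λ i j → τ N i * etaTerm c N j) d
               - antidiagonal (λ i j → τ N i * zetaTerm d N (suc j)) c

  -- `τ` is traded back for `h`, because `h N` is the exact inverse of P at level N. The factors
  -- next to it must be bounded for this; the zeta sums in `zetaTerm d N (suc j)` have weight at
  -- least 3.
  weightedSum~ : ∀ c d → (λ N → 4ℚ * weightedSum N c d) ~ h-side c d
  weightedSum~ c d = ~-trans (~-const* 4ℚ (weightedSum~plainSum c d))
    (~-trans (≗⇒~ (λ N → four (plainSum N c d)))
    (~-trans (~-const* 2ℚ (plainSum~ c d))
    (~-trans (≗⇒~ (λ N → double-inside N))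
      (~-- (~-antidiagonal d (λ i j → ~-*ʳ (bounded-* (bounded-const 2ℚ) (bounded-etaTerm j)) (~-sym (h~τ i))))
           (~-antidiagonal c (λ i j → ~-*ʳ (bounded-* (bounded-const 2ℚ) (bounded-zetaTerm j)) (~-sym (h~τ i))))))))
    where
    four : ∀ x → 4ℚ * x ≡ 2ℚ * (2ℚ * x)
    four = solve-∀ ℚ-ring
    distrib : ∀ x y → 2ℚ * (x - y) ≡ 2ℚ * x - 2ℚ * y
    distrib = solve-∀ ℚ-ring
    swap : ∀ x y → 2ℚ * (x * y) ≡ x * (2ℚ * y)
    swap = solve-∀ ℚ-ring
    double-inside : ∀ N → 2ℚ * τ-side c d N ≡ antidiagonal (λ i j → τ N i * (2ℚ * etaTerm c N j)) d
                                            - antidiagonal (λ i j → τ N i * (2ℚ * zetaTerm d N (suc j))) c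
    double-inside N = trans (distrib (antidiagonal (λ i j → τ N i * etaTerm c N j) d)
                                     (antidiagonal (λ i j → τ N i * zetaTerm d N (suc j)) c))
      (cong₂ _-_ (trans (sym (antidiagonal-*ˡ d 2ℚ (λ i j → τ N i * etaTerm c N j)))
                        (antidiagonal-cong d (λ i j → swap (τ N i) (etaTerm c N j))))
                 (trans (sym (antidiagonal-*ˡ c 2ℚ (λ i j → τ N i * zetaTerm d N (suc j))))
                        (antidiagonal-cong c (λ i j → swap (τ N i) (zetaTerm d N (suc j))))))
    bounded-etaTerm : ∀ j → Bounded (λ N → etaTerm c N j)
    bounded-etaTerm j = bounded-* (bounded-const (B (suc (double c)) (suc (double j))))
                                  (bounded-etaSum (suc (double c) ℕ.+ suc (double j)))
    bounded-zetaTerm : ∀ j → Bounded (λ N → zetaTerm d N (suc j))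
    bounded-zetaTerm j = bounded-* (bounded-const (B (double d) (double (suc j)))) (bounded-cong
      (λ N → cong (λ k → zetaSum k N) (sym (cong suc (ℕₚ.+-suc (double d) (suc (double j))))))
      (bounded-zetaSum (double d ℕ.+ suc (double j))))

  -- The eta part is a convolution with `h` in the index d of y, the zeta part in the index c of x.
  -- So P(y) cancels `h` in the first and P(x) in the second; the other factor remains in each as a
  -- convolution with the coefficients of P.
  euler-h-side : ∀ N a b → euler N (λ d → euler N (λ c → h-side c d N) a) b
    ≡ antidiagonal (λ i j → euler N δ i * (2ℚ * etaTerm j N b)) a
    - antidiagonal (λ i j → euler N δ i * (2ℚ * zetaTerm j N (suc a))) b
  euler-h-side N a b = begin-equality
    euler N (λ d → euler N (λ c → h-side c d N) a) b
      ≡⟨ euler-cong N inner b ⟩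
    euler N (λ d → antidiagonal (λ i j → h N i * euler N (λ c → 2ℚ * etaTerm c N j) a) d - 2ℚ * zetaTerm d N (suc a)) b
      ≡⟨ euler-- N (antidiagonal (λ i j → h N i * euler N (λ c → 2ℚ * etaTerm c N j) a)) (λ d → 2ℚ * zetaTerm d N (suc a)) b ⟩
    euler N (antidiagonal (λ i j → h N i * euler N (λ c → 2ℚ * etaTerm c N j) a)) b - euler N (λ d → 2ℚ * zetaTerm d N (suc a)) b
      ≡⟨ cong₂ _-_
           (trans (euler-h-convolution N (λ j → euler N (λ c → 2ℚ * etaTerm c N j) a) b)
                  (euler-convolution N (λ c → 2ℚ * etaTerm c N b) a))
           (euler-convolution N (λ d → 2ℚ * zetaTerm d N (suc a)) b) ⟩
    antidiagonal (λ i j → euler N δ i * (2ℚ * etaTerm j N b)) a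
      - antidiagonal (λ i j → euler N δ i * (2ℚ * zetaTerm j N (suc a))) b ∎
    where
    inner : ∀ d → euler N (λ c → h-side c d N) a
      ≡ antidiagonal (λ i j → h N i * euler N (λ c → 2ℚ * etaTerm c N j) a) d - 2ℚ * zetaTerm d N (suc a)
    inner d = trans (euler-- N (λ c → antidiagonal (λ i j → h N i * (2ℚ * etaTerm c N j)) d)
                               (antidiagonal (λ i j → h N i * (2ℚ * zetaTerm d N (suc j)))) a)
      (cong₂ _-_ (euler-inside N (h N) (λ c j → 2ℚ * etaTerm c N j) d a)
                 (euler-h-convolution N (λ j → 2ℚ * zetaTerm d N (suc j)) a))

twos-3-twos~ : ∀ a b → (λ N → nestedSum (replicate b 2 ++ 3 ∷ replicate a 2) N)
  ~ (λ N → σ a * σ b * (antidiagonal (λ i j → σ i * twos i N * (2ℚ * etaTerm j N b)) a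
                       - antidiagonal (λ i j → σ i * twos i N * (2ℚ * zetaTerm j N (suc a))) b))
twos-3-twos~ a b = ~-trans (≗⇒~ signed)
  (~-const* (σ a * σ b)
    (~-trans (~-euler b (λ d → ~-euler a (λ c → weightedSum~ c d)))
             (≗⇒~ (λ N → trans (euler-h-side N a b) (cong₂ _-_
               (antidiagonal-cong a (λ i j → cong (_* (2ℚ * etaTerm j N b)) (euler-δ N i)))
               (antidiagonal-cong b (λ i j → cong (_* (2ℚ * zetaTerm j N (suc a))) (euler-δ N i))))))))
  where
  X : ℕ → ℚ
  X N = nestedSum (replicate b 2 ++ 3 ∷ replicate a 2) N
  insert : ∀ x → x ≡ 1ℚ * 1ℚ * x
  insert = solve-∀ ℚ-ring
  regroup : ∀ s t x → s * s * (t * t) * x ≡ s * t * (s * t * x)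
  regroup = solve-∀ ℚ-ring
  signed : ∀ N → X N ≡ σ a * σ b * euler N (λ d → euler N (λ c → 4ℚ * weightedSum N c d) a) b
  signed N = begin-equality
    X N                                  ≡⟨ insert (X N) ⟩
    1ℚ * 1ℚ * X N                        ≡⟨ cong₂ (λ s t → s * t * X N) (σ*σ a) (σ*σ b) ⟨
    σ a * σ a * (σ b * σ b) * X N        ≡⟨ regroup (σ a) (σ b) (X N) ⟩
    σ a * σ b * (σ a * σ b * X N)        ≡⟨ cong (σ a * σ b *_) (nestedSum-twos-3-twos N a b) ⟨
    σ a * σ b * euler N (λ d → euler N (λ c → 4ℚ * weightedSum N c d) a) b ∎

-- Alternating sums as multiples of zeta sums

*-^ : ∀ p q n → (p * q) ^ n ≡ p ^ n * q ^ n
*-^ p q zero    = refl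
*-^ p q (suc n) = trans (cong (p * q *_) (*-^ p q n)) (regroup p q (p ^ n) (q ^ n))
  where
  regroup : ∀ a b x y → a * b * (x * y) ≡ a * x * (b * y)
  regroup = solve-∀ ℚ-ring

w-odd : ∀ m → w (suc (double m)) ≡ ½ * w m
w-odd m = trans (cong (λ n → ℤ.+ 1 / suc n) (index m)) (recip-* 1 m)
  where
  index : ∀ m → suc (double m) ≡ m ℕ.+ 1 ℕ.* suc m
  index m = trans (cong suc (double≡2* m)) (sym (ℕₚ.+-suc m (m ℕ.+ 0)))

module _ (s : ℕ) where

  private
    -- Only the terms with even n change sign, and those with n = 2m form `½ ^ s` times a zeta sum
    -- of half the length. In 0-based indices they sit at the odd positions `suc (double m)`.
    even-step : ∀ M → etaSum s (double M) ≡ zetaSum s (double M) - 2ℚ * (½ ^ s * zetaSum s M)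
    even-step zero    = vanish (½ ^ s)
      where
      vanish : ∀ p → 0ℚ ≡ 0ℚ - 2ℚ * (p * 0ℚ)
      vanish = solve-∀ ℚ-ring
    even-step (suc M) = begin-equality
      etaSum s (double M) + σ (double M) * x + - σ (double M) * y
        ≡⟨ cong₂ (λ e t → e + t * x + - t * y) (even-step M) (σ-double M) ⟩
      z - 2ℚ * (½ ^ s * z′) + 1ℚ * x + - 1ℚ * y
        ≡⟨ collect z (½ ^ s * z′) x y ⟩
      z + x + y - 2ℚ * (½ ^ s * z′ + y)
        ≡⟨ cong (λ t → z + x + y - 2ℚ * (½ ^ s * z′ + t)) (trans (cong (_^ s) (w-odd M)) (*-^ ½ (w M) s)) ⟩
      z + x + y - 2ℚ * (½ ^ s * z′ + ½ ^ s * w M ^ s)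
        ≡⟨ cong (λ t → z + x + y - 2ℚ * t) (*-distribˡ-+ (½ ^ s) z′ (w M ^ s)) ⟨
      z + x + y - 2ℚ * (½ ^ s * (z′ + w M ^ s)) ∎
      where
      x = w (double M) ^ s
      y = w (suc (double M)) ^ s
      z = zetaSum s (double M)
      z′ = zetaSum s M
      collect : ∀ z t x y → z - 2ℚ * t + 1ℚ * x + - 1ℚ * y ≡ z + x + y - 2ℚ * (t + y)
      collect = solve-∀ ℚ-ring

    odd-step : ∀ M → etaSum s (suc (double M)) ≡ zetaSum s (suc (double M)) - 2ℚ * (½ ^ s * zetaSum s M)
    odd-step M = trans (cong₂ (λ e t → e + t * x) (even-step M) (σ-double M)) (swap (zetaSum s (double M)) _ x)
      where
      x = w (double M) ^ s
      swap : ∀ z t x → z - t + 1ℚ * x ≡ z + x - t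
      swap = solve-∀ ℚ-ring

    parity : ∀ N → N ≡ double ⌊ N /2⌋ ⊎ N ≡ suc (double ⌊ N /2⌋)
    parity zero          = inj₁ refl
    parity (suc zero)    = inj₂ refl
    parity (suc (suc N)) with parity N
    ... | inj₁ eq = inj₁ (cong (λ n → suc (suc n)) eq)
    ... | inj₂ eq = inj₂ (cong (λ n → suc (suc n)) eq)

    etaSum-at : ∀ {N M} → N ≡ double M ⊎ N ≡ suc (double M) → etaSum s N ≡ zetaSum s N - 2ℚ * (½ ^ s * zetaSum s M)
    etaSum-at {M = M} (inj₁ refl) = even-step M
    etaSum-at {M = M} (inj₂ refl) = odd-step M

    ⌊double/2⌋ : ∀ n → ⌊ double n /2⌋ ≡ n
    ⌊double/2⌋ zero    = refl
    ⌊double/2⌋ (suc n) = cong suc (⌊double/2⌋ n)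

    n≤double : ∀ n → n ℕ.≤ double n
    n≤double zero    = z≤n
    n≤double (suc n) = s≤s (ℕₚ.m≤n⇒m≤1+n (n≤double n))

  zetaSum-half~ : 1 ℕ.< s → (λ N → zetaSum s ⌊ N /2⌋) ~ zetaSum s
  zetaSum-half~ 1<s = mk~ (mkNull λ ε 0<ε →
    let K , close = zetaSum-cauchy {s} 1<s ε 0<ε in
    double K , λ n 2K≤n → close ⌊ n /2⌋ n
      (subst (ℕ._≤ ⌊ n /2⌋) (⌊double/2⌋ K) (ℕₚ.⌊n/2⌋-mono 2K≤n)) (ℕₚ.≤-trans (n≤double K) 2K≤n))

  etaSum~ : 1 ℕ.< s → etaSum s ~ (λ N → (1ℚ - 2ℚ * ½ ^ s) * zetaSum s N)
  etaSum~ 1<s = ~-trans (≗⇒~ (λ N → etaSum-at (parity N)))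
    (~-trans (~-- (~-refl {zetaSum s}) (~-const* 2ℚ (~-const* (½ ^ s) (zetaSum-half~ 1<s))))
             (≗⇒~ (λ N → factor-out (½ ^ s) (zetaSum s N))))
    where
    factor-out : ∀ p z → z - 2ℚ * (p * z) ≡ (1ℚ - 2ℚ * p) * z
    factor-out = solve-∀ ℚ-ring

-- Matching with the sum over k in the statement

antidiagonal-drop : ∀ a n (F : ℕ → ℕ → ℚ) → (∀ i j → i ℕ.< a → F i j ≡ 0ℚ) →
  antidiagonal F (a ℕ.+ n) ≡ antidiagonal (λ i j → F (a ℕ.+ i) j) n
antidiagonal-drop zero    n F F≡0 = refl
antidiagonal-drop (suc a) n F F≡0 = trans
  (cong₂ _+_ (F≡0 0 (suc (a ℕ.+ n)) (s≤s z≤n)) (antidiagonal-drop a n (λ i → F (suc i)) (λ i j i<a → F≡0 (suc i) j (s≤s i<a))))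
  (+-identityˡ (antidiagonal (λ i j → F (suc a ℕ.+ i) j) n))

-- The two halves of the k-th term of the evaluation, with k = m + 1 and j = a + b + 1 - k.
firstTerm secondTerm : ℕ → ℕ → ℕ → ℕ → ℚ
firstTerm N a m j = σ (suc m) * (ι ((2 ℕ.* suc m) C (2 ℕ.* a ℕ.+ 2)) * zetaSum (suc (double (suc m))) N * twos j N)
secondTerm N b m j = σ (suc m) * ((1ℚ - 2ℚ * ½ ^ suc (double (suc m))) * ι ((2 ℕ.* suc m) C (2 ℕ.* b ℕ.+ 1))
                                  * zetaSum (suc (double (suc m))) N * twos j N)

private
  2*suc≡ : ∀ m → 2 ℕ.* suc m ≡ double (suc m)
  2*suc≡ m = sym (double≡2* (suc m))

  2*+2≡ : ∀ a → 2 ℕ.* a ℕ.+ 2 ≡ double (suc a)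
  2*+2≡ a = trans (ℕₚ.+-comm (2 ℕ.* a) 2) (cong (λ n → suc (suc n)) (sym (double≡2* a)))

  2*+1≡ : ∀ b → 2 ℕ.* b ℕ.+ 1 ≡ suc (double b)
  2*+1≡ b = trans (ℕₚ.+-comm (2 ℕ.* b) 1) (cong suc (sym (double≡2* b)))

  double-+ : ∀ m n → double (m ℕ.+ n) ≡ double m ℕ.+ double n
  double-+ zero    n = refl
  double-+ (suc m) n = cong (λ k → suc (suc k)) (double-+ m n)

  double-mono : ∀ {m n} → m ℕ.≤ n → double m ℕ.≤ double n
  double-mono z≤n       = z≤n
  double-mono (s≤s m≤n) = s≤s (s≤s (double-mono m≤n))

  -- The binomial of 2k over 2a + 2 vanishes for k ≤ a. This, and `second-zero` for k ≤ b, shorten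
  -- the sum over all k ≤ a + b + 1 to the ranges of the two convolutions.
  first-zero : ∀ N a m j → m ℕ.< a → firstTerm N a m j ≡ 0ℚ
  first-zero N a m j m<a = trans
    (cong (λ n → σ (suc m) * (ι n * zetaSum (suc (double (suc m))) N * twos j N))
      (trans (cong₂ _C_ (2*suc≡ m) (2*+2≡ a)) (k>n⇒nCk≡0 (ℕₚ.≤-trans (s≤s (double-mono m<a)) (ℕₚ.n≤1+n _)))))
    (vanish (σ (suc m)) (zetaSum (suc (double (suc m))) N) (twos j N))
    where
    vanish : ∀ s z t → s * (0ℚ * z * t) ≡ 0ℚ
    vanish = solve-∀ ℚ-ring

  second-zero : ∀ N b m j → m ℕ.< b → secondTerm N b m j ≡ 0ℚ
  second-zero N b m j m<b = trans
    (cong (λ n → σ (suc m) * (k * ι n * zetaSum (suc (double (suc m))) N * twos j N))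
      (trans (cong₂ _C_ (2*suc≡ m) (2*+1≡ b)) (k>n⇒nCk≡0 (s≤s (double-mono m<b)))))
    (vanish (σ (suc m)) k (zetaSum (suc (double (suc m))) N) (twos j N))
    where
    k = 1ℚ - 2ℚ * ½ ^ suc (double (suc m))
    vanish : ∀ s k z t → s * (k * 0ℚ * z * t) ≡ 0ℚ
    vanish = solve-∀ ℚ-ring

  -- Here k = a + j + 1, so the sign is -(-1)ᵃ⁺ʲ, and j has the parity of b + i. The result has the
  -- common sign `- (σ a * σ b)` in front, as in `second-term`, where k = b + j + 1.
  first-term : ∀ N a b i j → i ℕ.+ j ≡ b →
    firstTerm N a (a ℕ.+ j) i ≡ - (σ a * σ b * (σ i * twos i N * zetaTerm j N (suc a)))
  first-term N a b i j i+j≡b = begin-equality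
    - σ (a ℕ.+ j) * (ι ((2 ℕ.* suc (a ℕ.+ j)) C (2 ℕ.* a ℕ.+ 2)) * zetaSum (suc (double (suc (a ℕ.+ j)))) N * twos i N)
      ≡⟨ cong₂ (λ s k → - s * (k * zetaSum (suc (double (suc (a ℕ.+ j)))) N * twos i N)) (σ-+ a j)
           (trans (cong₂ (λ n k → ι (n C k)) (trans (2*suc≡ (a ℕ.+ j)) index) (2*+2≡ a)) (binomial≡B (double j) (double (suc a)))) ⟩
    - (σ a * σ j) * (β * zetaSum (suc (double (suc (a ℕ.+ j)))) N * twos i N)
      ≡⟨ cong₂ (λ s k → - (σ a * s) * (β * zetaSum k N * twos i N)) σj≡ (cong suc index) ⟩
    - (σ a * (σ b * σ i)) * (β * zetaSum (suc (double j ℕ.+ double (suc a))) N * twos i N)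
      ≡⟨ regroup (σ a) (σ b) (σ i) β (zetaSum (suc (double j) ℕ.+ double (suc a)) N) (twos i N) ⟩
    - (σ a * σ b * (σ i * twos i N * zetaTerm j N (suc a))) ∎
    where
    β = B (double j) (double (suc a))
    index : double (suc (a ℕ.+ j)) ≡ double j ℕ.+ double (suc a)
    index = trans (cong double (ℕₚ.+-comm (suc a) j)) (double-+ j (suc a))
    unit : ∀ s → s ≡ 1ℚ * s
    unit = solve-∀ ℚ-ring
    assoc : ∀ t s → t * t * s ≡ t * s * t
    assoc = solve-∀ ℚ-ring
    σj≡ : σ j ≡ σ b * σ i
    σj≡ = trans (unit (σ j)) (trans (cong (_* σ j) (sym (σ*σ i))) (trans (assoc (σ i) (σ j))
          (cong (_* σ i) (trans (sym (σ-+ i j)) (cong σ i+j≡b)))))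
    regroup : ∀ s t u k z x → - (s * (t * u)) * (k * z * x) ≡ - (s * t * (u * x * (k * z)))
    regroup = solve-∀ ℚ-ring

  etaFactor : ℕ → ℕ → ℕ → ℚ
  etaFactor N j b = (1ℚ - 2ℚ * ½ ^ (double (suc j) ℕ.+ suc (double b))) * zetaSum (double (suc j) ℕ.+ suc (double b)) N

  second-term : ∀ N a b i j → i ℕ.+ j ≡ a →
    secondTerm N b (b ℕ.+ j) i
      ≡ - (σ a * σ b * (σ i * twos i N * (B (suc (double j)) (suc (double b)) * etaFactor N j b)))
  second-term N a b i j i+j≡a = begin-equality
    - σ (b ℕ.+ j) * (κ (suc (double (suc (b ℕ.+ j)))) * ι ((2 ℕ.* suc (b ℕ.+ j)) C (2 ℕ.* b ℕ.+ 1))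
                     * zetaSum (suc (double (suc (b ℕ.+ j)))) N * twos i N)
      ≡⟨ cong₂ (λ s k → - s * (κ (suc (double (suc (b ℕ.+ j)))) * k * zetaSum (suc (double (suc (b ℕ.+ j)))) N * twos i N)) (σ-+ b j)
           (trans (cong₂ (λ n k → ι (n C k)) (trans (2*suc≡ (b ℕ.+ j)) index) (2*+1≡ b)) (binomial≡B (suc (double j)) (suc (double b)))) ⟩
    - (σ b * σ j) * (κ (suc (double (suc (b ℕ.+ j)))) * β * zetaSum (suc (double (suc (b ℕ.+ j)))) N * twos i N)
      ≡⟨ cong₂ (λ s k → - (σ b * s) * (κ k * β * zetaSum k N * twos i N)) σj≡ (cong suc index) ⟩
    - (σ b * (σ a * σ i)) * (κ e * β * zetaSum e N * twos i N)
      ≡⟨ regroup (σ a) (σ b) (σ i) β (κ e) (zetaSum e N) (twos i N) ⟩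
    - (σ a * σ b * (σ i * twos i N * (β * etaFactor N j b))) ∎
    where
    κ : ℕ → ℚ
    κ k = 1ℚ - 2ℚ * ½ ^ k
    e = double (suc j) ℕ.+ suc (double b)
    β = B (suc (double j)) (suc (double b))
    index : double (suc (b ℕ.+ j)) ≡ suc (double j) ℕ.+ suc (double b)
    index = trans (cong (λ n → double (suc n)) (ℕₚ.+-comm b j)) (trans (cong (λ n → suc (suc n)) (double-+ j b))
      (cong suc (sym (ℕₚ.+-suc (double j) (double b)))))
    unit : ∀ s → s ≡ 1ℚ * s
    unit = solve-∀ ℚ-ring
    assoc : ∀ t s → t * t * s ≡ t * s * t
    assoc = solve-∀ ℚ-ring
    σj≡ : σ j ≡ σ a * σ i
    σj≡ = trans (unit (σ j)) (trans (cong (_* σ j) (sym (σ*σ i))) (trans (assoc (σ i) (σ j))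
          (cong (_* σ i) (trans (sym (σ-+ i j)) (cong σ i+j≡a)))))
    regroup : ∀ s t u k q z x → - (t * (s * u)) * (q * k * z * x) ≡ - (s * t * (u * x * (k * (q * z))))
    regroup = solve-∀ ℚ-ring

twos-3-twos-evaluation : ∀ a b → (λ N → nestedSum (replicate b 2 ++ 3 ∷ replicate a 2) N)
  ~ (λ N → 2ℚ * antidiagonal (λ m j → firstTerm N a m j - secondTerm N b m j) (a ℕ.+ b))
twos-3-twos-evaluation a b = ~-trans (twos-3-twos~ a b) (~-trans
  (~-const* (σ a * σ b) (~-- (~-antidiagonal a (λ i j →
      ~-*ˡ (bounded-* (bounded-const (σ i)) (bounded-twos i))
        (~-const* 2ℚ (~-const* (B (suc (double j)) (suc (double b)))
          (etaSum~ (double (suc j) ℕ.+ suc (double b)) (s≤s (s≤s z≤n)))))))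
    ~-refl))
  (≗⇒~ (λ N → sym (evaluate N))))
  where
  evaluate : ∀ N → 2ℚ * antidiagonal (λ m j → firstTerm N a m j - secondTerm N b m j) (a ℕ.+ b)
    ≡ σ a * σ b * (antidiagonal (λ i j → σ i * twos i N * (2ℚ * (B (suc (double j)) (suc (double b)) * etaFactor N j b))) a
                 - antidiagonal (λ i j → σ i * twos i N * (2ℚ * zetaTerm j N (suc a))) b)
  evaluate N = begin-equality
    2ℚ * antidiagonal (λ m j → firstTerm N a m j - secondTerm N b m j) (a ℕ.+ b)
      ≡⟨ cong (2ℚ *_) (antidiagonal-- (a ℕ.+ b) (firstTerm N a) (secondTerm N b)) ⟩
    2ℚ * (antidiagonal (firstTerm N a) (a ℕ.+ b) - antidiagonal (secondTerm N b) (a ℕ.+ b))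
      ≡⟨ cong₂ (λ x y → 2ℚ * (x - y))
           (antidiagonal-drop a b (firstTerm N a) (first-zero N a))
           (trans (cong (antidiagonal (secondTerm N b)) (ℕₚ.+-comm a b))
                  (antidiagonal-drop b a (secondTerm N b) (second-zero N b))) ⟩
    2ℚ * (antidiagonal (λ j i → firstTerm N a (a ℕ.+ j) i) b - antidiagonal (λ j i → secondTerm N b (b ℕ.+ j) i) a)
      ≡⟨ cong₂ (λ x y → 2ℚ * (x - y)) first-sum second-sum ⟩
    2ℚ * (- (σ a * σ b * Z) - - (σ a * σ b * E))
      ≡⟨ regroup (σ a * σ b) Z E ⟩
    σ a * σ b * (2ℚ * E - 2ℚ * Z)
      ≡⟨ cong₂ (λ x y → σ a * σ b * (x - y)) (sym (double-inside a _)) (sym (double-inside b _)) ⟩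
    σ a * σ b * (antidiagonal (λ i j → σ i * twos i N * (2ℚ * (B (suc (double j)) (suc (double b)) * etaFactor N j b))) a
               - antidiagonal (λ i j → σ i * twos i N * (2ℚ * zetaTerm j N (suc a))) b) ∎
    where
    Z = antidiagonal (λ i j → σ i * twos i N * zetaTerm j N (suc a)) b
    E = antidiagonal (λ i j → σ i * twos i N * (B (suc (double j)) (suc (double b)) * etaFactor N j b)) a
    regroup : ∀ s z e → 2ℚ * (- (s * z) - - (s * e)) ≡ s * (2ℚ * e - 2ℚ * z)
    regroup = solve-∀ ℚ-ring
    swap : ∀ x y → x * (2ℚ * y) ≡ 2ℚ * (x * y)
    swap = solve-∀ ℚ-ring
    double-inside : ∀ n (G : ℕ → ℚ) → antidiagonal (λ i j → σ i * twos i N * (2ℚ * G j)) n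
                                    ≡ 2ℚ * antidiagonal (λ i j → σ i * twos i N * G j) n
    double-inside n G = trans (antidiagonal-cong n (λ i j → swap (σ i * twos i N) (G j)))
                              (antidiagonal-*ˡ n 2ℚ (λ i j → σ i * twos i N * G j))
    signs-out : ∀ n (F : ℕ → ℕ → ℚ) → antidiagonal (λ i j → - (σ a * σ b * F i j)) n ≡ - (σ a * σ b * antidiagonal F n)
    signs-out n F = trans (antidiagonal-neg n (λ i j → σ a * σ b * F i j)) (cong -_ (antidiagonal-*ˡ n (σ a * σ b) F))
    first-sum : antidiagonal (λ j i → firstTerm N a (a ℕ.+ j) i) b ≡ - (σ a * σ b * Z)
    first-sum = trans (antidiagonal-flip b (λ j i → firstTerm N a (a ℕ.+ j) i))
      (trans (antidiagonal-cong-≡ b (first-term N a b)) (signs-out b (λ i j → σ i * twos i N * zetaTerm j N (suc a))))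
    second-sum : antidiagonal (λ j i → secondTerm N b (b ℕ.+ j) i) a ≡ - (σ a * σ b * E)
    second-sum = trans (antidiagonal-flip a (λ j i → secondTerm N b (b ℕ.+ j) i))
      (trans (antidiagonal-cong-≡ a (second-term N a b))
             (signs-out a (λ i j → σ i * twos i N * (B (suc (double j)) (suc (double b)) * etaFactor N j b))))

private
  summand : ∀ a b m j N →
    sign (suc m) * c a b (suc m) * nestedSum (2 ℕ.* suc m ℕ.+ 1 ∷ []) N * seq (H j) N
      ≡ firstTerm N a m j - secondTerm N b m j
  summand a b m j N = begin-equality
    sign (suc m) * c a b (suc m) * nestedSum (2 ℕ.* suc m ℕ.+ 1 ∷ []) N * seq (H j) N
      ≡⟨ cong₂ (λ x y → x * c a b (suc m) * nestedSum (2 ℕ.* suc m ℕ.+ 1 ∷ []) N * y) (sign≡σ (suc m)) (seq-H j N) ⟩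
    σ (suc m) * c a b (suc m) * nestedSum (2 ℕ.* suc m ℕ.+ 1 ∷ []) N * twos j N
      ≡⟨ cong₂ (λ x y → σ (suc m) * (p - (1ℚ - x) * q) * y * twos j N) power zeta ⟩
    σ (suc m) * (p - (1ℚ - 2ℚ * ½ ^ suc (double (suc m))) * q) * z * twos j N
      ≡⟨ expand (σ (suc m)) p (1ℚ - 2ℚ * ½ ^ suc (double (suc m))) q z (twos j N) ⟩
    firstTerm N a m j - secondTerm N b m j ∎
    where
    p = ι ((2 ℕ.* suc m) C (2 ℕ.* a ℕ.+ 2))
    q = ι ((2 ℕ.* suc m) C (2 ℕ.* b ℕ.+ 1))
    z = zetaSum (suc (double (suc m))) N
    -- At weight s = 2k + 1 the number 2¹⁻ˢ of `etaSum~` is the 2⁻²ᵏ in the bracket of `c`.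
    power : recipPow 2 (2 ℕ.* suc m) ≡ 2ℚ * ½ ^ suc (double (suc m))
    power = trans (recipPow≡ 1 (2 ℕ.* suc m)) (trans (cong (½ ^_) (2*suc≡ m)) (twice (½ ^ double (suc m))))
      where
      twice : ∀ x → x ≡ 2ℚ * (½ * x)
      twice = solve-∀ ℚ-ring
    zeta : nestedSum (2 ℕ.* suc m ℕ.+ 1 ∷ []) N ≡ z
    zeta = trans (nestedSum-single (2 ℕ.* suc m ℕ.+ 1) N) (cong (λ k → zetaSum k N) (2*+1≡ (suc m)))
    expand : ∀ s p k q z t → s * (p - k * q) * z * t ≡ s * (p * z * t) - s * (k * q * z * t)
    expand = solve-∀ ℚ-ring

theorem1p1 : (a b : ℕ) →
  H₂ a b ≈ℝ
    fromℚ (ℤ.+ 2 / 1) *ℝ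
      ∑ℝ (a ℕ.+ b ℕ.+ 1) (λ k →
        fromℚ (sign k) *ℝ fromℚ (c a b k) *ℝ
          ζ (2 ℕ.* k ℕ.+ 1 ∷ []) (2k+1-admissible k) *ℝ H (a ℕ.+ b ℕ.+ 1 ℕ.∸ k))
theorem1p1 a b = small (diff-null (~-trans (≗⇒~ left) (~-trans (twos-3-twos-evaluation a b) (≗⇒~ (λ N → sym (right N))))))
  where
  left : ∀ N → seq (H₂ a b) N ≡ nestedSum (replicate b 2 ++ 3 ∷ replicate a 2) N
  left N = cong (λ ks → nestedSum ks N) (reverse-twos-3-twos a b)
  term : ℕ → (k : ℕ) → .{{ℕ.NonZero k}} → ℝ
  term K k = fromℚ (sign k) *ℝ fromℚ (c a b k) *ℝ ζ (2 ℕ.* k ℕ.+ 1 ∷ []) (2k+1-admissible k) *ℝ H (K ℕ.∸ k)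
  -- The length is abstracted to `K` because it also occurs inside `term`. Once it is
  -- `suc (a ℕ.+ b)`, the index `K ℕ.∸ suc m` computes to `a ℕ.+ b ℕ.∸ m`, as `sum≡antidiagonal`
  -- requires.
  right-at : ∀ N K → K ≡ suc (a ℕ.+ b) →
    2ℚ * seq (∑ℝ K (term K)) N ≡ 2ℚ * antidiagonal (λ m j → firstTerm N a m j - secondTerm N b m j) (a ℕ.+ b)
  right-at N K refl = cong (2ℚ *_) (begin-equality
    seq (∑ℝ K (term K)) N
      ≡⟨ seq-∑ℝ K (term K) N ⟩
    ∑ℚ K (λ k → seq (term K k) N)
      ≡⟨ ∑ℚ≡sum K (λ k → seq (term K k) N) ⟩
    sum K (λ m → seq (term K (suc m)) N)
      ≡⟨ sum-cong K (λ m → summand a b m (a ℕ.+ b ℕ.∸ m) N) ⟩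
    sum K (λ m → firstTerm N a m (a ℕ.+ b ℕ.∸ m) - secondTerm N b m (a ℕ.+ b ℕ.∸ m))
      ≡⟨ sum≡antidiagonal (a ℕ.+ b) (λ m j → firstTerm N a m j - secondTerm N b m j) ⟩
    antidiagonal (λ m j → firstTerm N a m j - secondTerm N b m j) (a ℕ.+ b) ∎)
  right : ∀ N → 2ℚ * seq (∑ℝ (a ℕ.+ b ℕ.+ 1) (term (a ℕ.+ b ℕ.+ 1))) N
              ≡ 2ℚ * antidiagonal (λ m j → firstTerm N a m j - secondTerm N b m j) (a ℕ.+ b)
  right N = right-at N (a ℕ.+ b ℕ.+ 1) (ℕₚ.+-comm (a ℕ.+ b) 1)
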